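{- For even $n\ge 2$, there are exactly $\binom{n}{n/2}$ centrally symmetric matchings in $\mathcal{M}_n$, and the centrally symmetric matchings form connected components of $\mathcal{H}_n$ (each such component contains only centrally symmetric matchings) that are trees. There are exactly $C_{n/2}$ such components, and each of them contains exactly $n/2+1$ matchings. Every matching that is not centrally symmetric lies in a connected component of $\mathcal{H}_n$ that is not a tree.
   Context: Fix an integer $n\ge 2$ and place $2n$ points equidistantly on the unit circle. $\mathcal{M}_n$ is the set of all non-crossing straight-line perfect matchings on these $2n$ points (each has $n$ edges). For $M\in\mathcal{M}_n$, two edges $e,f\in M$ span an empty quadrilateral if the convex hull of $e$ and $f$ contains no other edge of $M$; replacing $e,f$ by the other two edges of this quadrilateral yields another matching of $\mathcal{M}_n$ (a flip). A flip is centered if the closed quadrilateral contains the center of the circle (possibly on its boundary). $\mathcal{H}_n$ is the graph with vertex set $\mathcal{M}_n$ and an edge between two matchings if they differ by a centered flip. A matching is centrally symmetric if it is invariant under point reflection at the circle center. $C_k=\frac{1}{k+1}\binom{2k}{k}$ is the $k$th Catalan number. -}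

module Defs where

open import Data.Nat using (ℕ; zero; suc; _+_; _*_; _<_; _≤_; _⊔_; _⊓_; _/_)
open import Data.Nat.Combinatorics using (_C_)
open import Data.Fin using (Fin; toℕ)
open import Data.Vec using (Vec; lookup)
open import Data.List using (List; []; _∷_; length; _++_; [_])
open import Data.List.Relation.Unary.All using (All)
open import Data.List.Relation.Unary.Any using (Any)
open import Data.List.Relation.Unary.AllPairs using (AllPairs)
open import Data.List.Relation.Unary.Unique.Propositional using (Unique)
open import Data.List.Relation.Unary.Linked using (Linked)
open import Data.List.Membership.Propositional using (_∈_)
open import Data.Empty using (⊥)
open import Data.Product using (Σ; Σ-syntax; _×_; _,_)
open import Data.Sum using (_⊎_)
open import Relation.Nullary using (¬_)
open import Relation.Binary.PropositionalEquality using (_≡_; _≢_)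
open import Relation.Binary.Construct.Closure.ReflexiveTransitive using (Star)

-- Convention: the 2n points on the unit circle are labelled 0,1,…,2n-1
-- in counterclockwise order (point k at angle k·π/n).  A chord between
-- points a and b is represented by its endpoint labels (as naturals).

-- x lies strictly on the one side of chord {a,b} (on the arc a..b),
-- resp. strictly on the other side (x ∉ {a,b}).
Btw : ℕ → ℕ → ℕ → Set
Btw a b x = (a ⊓ b < x) × (x < a ⊔ b)

Out : ℕ → ℕ → ℕ → Set
Out a b x = (x < a ⊓ b) ⊎ (a ⊔ b < x)

Cross : ℕ → ℕ → ℕ → ℕ → Set
Cross a b c d = (Btw a b c × Out a b d) ⊎ (Out a b c × Btw a b d)

Pt : ℕ → Set
Pt n = Fin (2 * n)

-- A configuration assigns to every point a partner point.
Config : ℕ → Set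
Config n = Vec (Pt n) (2 * n)

IsPerfectMatching : (n : ℕ) → Config n → Set
IsPerfectMatching n v = ∀ i → (lookup v (lookup v i) ≡ i) × (lookup v i ≢ i)

NonCrossing : (n : ℕ) → Config n → Set
NonCrossing n v = ∀ i j →
  ¬ Cross (toℕ i) (toℕ (lookup v i)) (toℕ j) (toℕ (lookup v j))

IsNCMatching : (n : ℕ) → Config n → Set
IsNCMatching n v = IsPerfectMatching n v × NonCrossing n v

-- a and b are antipodal points (point reflection at the centre maps
-- point k to point k+n mod 2n).
Antipodal : ℕ → ℕ → ℕ → Set
Antipodal n a b = (a + n ≡ b) ⊎ (b + n ≡ a)

-- Invariance under point reflection at the centre: the image of every
-- edge {i, v[i]} is again an edge.
CentrallySymmetric : (n : ℕ) → Config n → Set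
CentrallySymmetric n v = ∀ i j → Antipodal n (toℕ i) (toℕ j) →
  Antipodal n (toℕ (lookup v i)) (toℕ (lookup v j))

-- Segment {x,y} meets the convex hull of the points qs (all on the
-- circle, distinct from x,y): some of them lie on each side of it.
MeetsHull : ℕ → ℕ → List ℕ → Set
MeetsHull x y qs = Any (Btw x y) qs × Any (Out x y) qs

EmptyQuad : (n : ℕ) → Config n → Pt n → Pt n → Pt n → Pt n → Set
EmptyQuad n v a b c d = ∀ x → x ≢ a → x ≢ b → x ≢ c → x ≢ d →
  ¬ MeetsHull (toℕ x) (toℕ (lookup v x)) (toℕ a ∷ toℕ b ∷ toℕ c ∷ toℕ d ∷ [])

-- Point p lies among the n cyclically consecutive points k, k+1, …, k+n-1
-- (mod 2n); these are exactly the point sets lying in an open semicircle.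
InArc : ℕ → ℕ → ℕ → Set
InArc n k p = ((k ≤ p) × (p < k + n)) ⊎ ((k ≤ p + 2 * n) × (p + 2 * n < k + n))

-- The closed convex hull of the points a,b,c,d contains the centre iff
-- they do not all lie in a common open semicircle.
ContainsCentre : (n : ℕ) → Pt n → Pt n → Pt n → Pt n → Set
ContainsCentre n a b c d = ¬ (Σ[ k ∈ ℕ ] (k < 2 * n) ×
  InArc n k (toℕ a) × InArc n k (toℕ b) × InArc n k (toℕ c) × InArc n k (toℕ d))

CenteredFlip : (n : ℕ) → Config n → Config n → Set
CenteredFlip n v w = Σ[ a ∈ Pt n ] Σ[ b ∈ Pt n ] Σ[ c ∈ Pt n ] Σ[ d ∈ Pt n ]
  (lookup v a ≡ b) × (lookup v c ≡ d) × (c ≢ a) × (c ≢ b) ×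
  EmptyQuad n v a b c d ×
  ContainsCentre n a b c d ×
  ¬ Cross (toℕ a) (toℕ c) (toℕ b) (toℕ d) ×
  (lookup w a ≡ c) × (lookup w c ≡ a) × (lookup w b ≡ d) × (lookup w d ≡ b) ×
  (∀ x → x ≢ a → x ≢ b → x ≢ c → x ≢ d → lookup w x ≡ lookup v x)

HEdge : (n : ℕ) → Config n → Config n → Set
HEdge n v w = IsNCMatching n v × IsNCMatching n w × CenteredFlip n v w

Reach : (n : ℕ) → Config n → Config n → Set
Reach n = Star (HEdge n)

IsCycle : (n : ℕ) → List (Config n) → Set
IsCycle n [] = ⊥
IsCycle n (x ∷ xs) = (2 ≤ length xs) × Unique (x ∷ xs) × Linked (HEdge n) (x ∷ xs ++ [ x ])

ComponentHasCycle : (n : ℕ) → Config n → Set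
ComponentHasCycle n v = Σ[ cs ∈ List (Config n) ] IsCycle n cs × All (Reach n v) cs

-- The connected component of v (a connected graph) is a tree:
-- it contains no cycle.
ComponentIsTree : (n : ℕ) → Config n → Set
ComponentIsTree n v = ¬ ComponentHasCycle n v

HasCard : {A : Set} → (A → Set) → ℕ → Set
HasCard {A} P k = Σ[ xs ∈ List A ] Unique xs ×
  (∀ x → ((x ∈ xs → P x) × (P x → x ∈ xs))) × (length xs ≡ k)

HasComponentCount : (n : ℕ) → (Config n → Set) → ℕ → Set
HasComponentCount n P k = Σ[ rs ∈ List (Config n) ] All P rs ×
  AllPairs (λ x y → ¬ Reach n x y) rs ×
  (∀ v → P v → Any (Reach n v) rs) × (length rs ≡ k)

catalan : ℕ → ℕ
catalan k = ((2 * k) C k) / suc k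

{-# OPTIONS --safe #-}
module Submission where

-- Since n is even, no edge is a diameter, so a matching lifts to an involution
-- lf v of ℤ of period 2n that moves every point by less than n.  Its arcs are
-- nested or disjoint, and the exposed (outermost) ones bound the face of the
-- centre.  A centred flip replaces two exposed arcs [a,b] and [c,d] by [b,c] and
-- [d,a+2n].
--
-- A symmetric matching is a noncrossing matching of the 2m residues mod n with
-- the centre in one of its m+1 faces, and a flip moves the centre across an
-- edge.  So each component is the dual tree of a noncrossing matching of 2m
-- points, and there are Catalan many of these.
--
-- If a gap of the central face lies opposite a gap outside it, then two
-- different flips lead to matchings with the same property.  Such matchings
-- therefore admit infinite walks without immediate reversals, which close up to
-- cycles, and every asymmetric matching can be flipped into one of them.

-- Lifting to ℤ turns cyclic order into linear order, so that crossing and containment of the centre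
-- become chains of inequalities, which `lin` proves. A diameter would have no canonical lift, so
-- diameters have to be excluded beforehand, on the unlifted matching.
--
-- Acyclicity of symmetric components needs no explicit tree. Gap 0 marks a root face, every flip
-- leads towards it or away from it, each matching has at most one neighbour nearer to it, and a
-- walk without reversals that has once moved away can only move further away. A component is
-- enumerated through two data: partners modulo n never change, and once they are fixed, the arc
-- that separates the central face from gap 0 determines the matching.
--
-- For asymmetric matchings the obstacle is that the central face may look symmetric while the
-- asymmetry is buried under nested arcs. The outermost arcs around an asymmetric point are removed
-- one by one, each with its antipodal copy. The edges at the point and at its antipode stay
-- untouched, so this digging cannot end without meeting the property that feeds the infinite walk.

open import Defs
open import Data.Bool using (if_then_else_)
open import Data.Empty using (⊥; ⊥-elim)
open import Data.List as List using (List; []; _∷_; [_]; _++_; map; length)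
open import Data.List.Membership.Propositional using (_∈_; lose; find)
open import Data.List.Membership.Propositional.Properties using (∈-lookup; ∈-++⁺ˡ; ∈-++⁺ʳ; ∈-++⁻; ∈-map⁺; ∈-map⁻)
import Data.List.Membership.DecPropositional as DecMembership
open import Data.List.Properties using (length-map; length-++)
open import Data.List.Relation.Binary.Subset.Propositional using (_⊆_)
open import Data.List.Relation.Binary.Subset.Propositional.Properties using (Any-resp-⊆)
open import Data.List.Relation.Unary.All as All using (All; []; _∷_)
import Data.List.Relation.Unary.All.Properties as Allₚ
open import Data.List.Relation.Unary.AllPairs using (AllPairs; []; _∷_)
import Data.List.Relation.Unary.AllPairs.Properties as AllPairsₚ
open import Data.List.Relation.Unary.Any as Any using (Any; here; there)
open import Data.List.Relation.Unary.Linked using (Linked; [-]; _∷_)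
open import Data.List.Relation.Unary.Unique.Propositional using (Unique)
import Data.List.Relation.Unary.Unique.Propositional.Properties as Uniqueₚ
open import Data.Nat as ℕ using (ℕ; zero; suc; s≤s; z≤n)
open import Data.Nat.Combinatorics using (_C_; nCk+nC[k+1]≡[n+1]C[k+1]; nCk≡nC[n∸k]; nCn≡1; nC1≡n)
open import Data.Nat.DivMod using (m<n⇒m%n≡m; m*n/n≡m)
import Data.Nat.Properties as ℕₚ
import Data.Nat.Tactic.RingSolver as ℕ-Ring
open import Data.Integer using (ℤ; +_)
import Data.Integer.Properties as ℤₚ
open import Data.Integer.Tactic.RingSolver using (solve-∀)
open import Data.Product using (∃; _×_; _,_; proj₁; proj₂)
open import Data.Sum using (_⊎_; inj₁; inj₂; [_,_]′)
open import Data.Vec using (Vec; []; _∷_; lookup; tabulate)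
open import Relation.Binary.Construct.Closure.ReflexiveTransitive using (ε; _◅_; _◅◅_; reverse)
open import Relation.Binary.Definitions using (Tri; tri<; tri≈; tri>)
open import Relation.Binary.PropositionalEquality hiding ([_])
open import Relation.Nullary using (Dec; ¬_; yes; no; does)
open import Relation.Nullary.Decidable using (dec-true; dec-false)

-- Linear arithmetic over ℤ by Fourier–Motzkin elimination

module Linear where
  open import Data.Bool using (Bool; T; _∧_)
  open import Data.Bool.Properties using (T-∧)
  open import Data.Fin using (Fin; zero; suc)
  open import Data.Integer using (-1ℤ; ∣_∣; _+_; _-_; _*_; _≤_; _<_; _≟_; _<?_)
  open import Data.Integer.Properties hiding (_≟_; _<?_)
  open import Data.List using (filter; cartesianProductWith; allFin)
  open import Data.List.Relation.Unary.Any using (any?)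
  open import Data.Vec using (replicate; zipWith) renaming (map to mapᵛ; allFin to allFinᵛ)
  open import Data.Vec.N-ary using (N-ary; _$ⁿ_)
  open import Data.Vec.Properties using (≡-dec)
  open import Function using (Equivalence)
  open import Relation.Nullary.Decidable using (_×-dec_)

  private
    variable
      k : ℕ

  Row : ℕ → Set
  Row k = ℤ × Vec ℤ k

  dot : Vec ℤ k → Vec ℤ k → ℤ
  dot []       []       = + 0
  dot (c ∷ cs) (x ∷ xs) = c * x + dot cs xs

  value : Row k → Vec ℤ k → ℤ
  value (c , cs) ρ = c + dot cs ρ

  infixl 6 _+ʳ_
  infixl 7 _·ʳ_

  _+ʳ_ : Row k → Row k → Row k
  (c , cs) +ʳ (d , ds) = c + d , zipWith _+_ cs ds

  _·ʳ_ : ℤ → Row k → Row k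
  a ·ʳ (c , cs) = a * c , mapᵛ (a *_) cs

  value-+ʳ : (r s : Row k) (ρ : Vec ℤ k) → value (r +ʳ s) ρ ≡ value r ρ + value s ρ
  value-+ʳ (c , cs) (d , ds) ρ = trans (cong (_+_ (c + d)) (dot-+ cs ds ρ)) (arrange c d _ _)
    where
    arrange : ∀ a b x y → a + b + (x + y) ≡ a + x + (b + y)
    arrange = solve-∀
    distribute : ∀ a b x u v → (a + b) * x + (u + v) ≡ a * x + u + (b * x + v)
    distribute = solve-∀
    dot-+ : (cs ds ρ : Vec ℤ k) → dot (zipWith _+_ cs ds) ρ ≡ dot cs ρ + dot ds ρ
    dot-+ []       []       []      = refl
    dot-+ (c ∷ cs) (d ∷ ds) (x ∷ ρ) =
      trans (cong (_+_ ((c + d) * x)) (dot-+ cs ds ρ)) (distribute c d x _ _)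

  value-·ʳ : (a : ℤ) (r : Row k) (ρ : Vec ℤ k) → value (a ·ʳ r) ρ ≡ a * value r ρ
  value-·ʳ a (c , cs) ρ = trans (cong (_+_ (a * c)) (dot-· cs ρ)) (sym (*-distribˡ-+ a c _))
    where
    factor : ∀ a c x u → a * c * x + a * u ≡ a * (c * x + u)
    factor = solve-∀
    dot-· : (cs ρ : Vec ℤ k) → dot (mapᵛ (a *_) cs) ρ ≡ a * dot cs ρ
    dot-· []       []      = sym (*-zeroʳ a)
    dot-· (c ∷ cs) (x ∷ ρ) = trans (cong (_+_ (a * c * x)) (dot-· cs ρ)) (factor a c x _)

  infixl 6 _⊕_ _⊖_
  infix  4 _≼_ _≺_ _≐_
  infixr 3 _⇒_
  infix  3 ⊢_

  data Exp (k : ℕ) : Set where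
    var     : Fin k → Exp k
    κ       : ℕ → Exp k
    _⊕_ _⊖_ : Exp k → Exp k → Exp k

  data Atom (k : ℕ) : Set where
    _≼_ _≺_ _≐_ : Exp k → Exp k → Atom k

  data Sequent (k : ℕ) : Set where
    ⊢_  : Atom k → Sequent k
    ⊢⊥  : Sequent k
    _⇒_ : Atom k → Sequent k → Sequent k

  ⟦_⟧ : Exp k → Vec ℤ k → ℤ
  ⟦ var i ⟧   ρ = lookup ρ i
  ⟦ κ c ⟧     ρ = + c
  ⟦ e ⊕ e′ ⟧ ρ = ⟦ e ⟧ ρ + ⟦ e′ ⟧ ρ
  ⟦ e ⊖ e′ ⟧ ρ = ⟦ e ⟧ ρ - ⟦ e′ ⟧ ρ

  ⟦_⟧ᵃ : Atom k → Vec ℤ k → Set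
  ⟦ e ≼ e′ ⟧ᵃ ρ = ⟦ e ⟧ ρ ≤ ⟦ e′ ⟧ ρ
  ⟦ e ≺ e′ ⟧ᵃ ρ = ⟦ e ⟧ ρ < ⟦ e′ ⟧ ρ
  ⟦ e ≐ e′ ⟧ᵃ ρ = ⟦ e ⟧ ρ ≡ ⟦ e′ ⟧ ρ

  ⟦_⟧ˢ : Sequent k → Vec ℤ k → Set
  ⟦ ⊢ a ⟧ˢ   ρ = ⟦ a ⟧ᵃ ρ
  ⟦ ⊢⊥ ⟧ˢ    ρ = ⊥
  ⟦ a ⇒ s ⟧ˢ ρ = ⟦ a ⟧ᵃ ρ → ⟦ s ⟧ˢ ρ

  unit : Fin k → Vec ℤ k
  unit zero    = + 1 ∷ replicate _ (+ 0)
  unit (suc i) = + 0 ∷ unit i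

  dot-zero : (ρ : Vec ℤ k) → dot (replicate k (+ 0)) ρ ≡ + 0
  dot-zero []      = refl
  dot-zero (x ∷ ρ) = trans (cong₂ _+_ (*-zeroˡ x) (dot-zero ρ)) refl

  dot-unit : (i : Fin k) (ρ : Vec ℤ k) → dot (unit i) ρ ≡ lookup ρ i
  dot-unit zero    (x ∷ ρ) = trans (cong₂ _+_ (*-identityˡ x) (dot-zero ρ)) (+-identityʳ x)
  dot-unit (suc i) (x ∷ ρ) = trans (cong₂ _+_ (*-zeroˡ x) (dot-unit i ρ)) (+-identityˡ _)

  row : Exp k → Row k
  row (var i)  = + 0 , unit i
  row (κ c)    = + c , replicate _ (+ 0)
  row (e ⊕ e′) = row e +ʳ row e′
  row (e ⊖ e′) = row e +ʳ -1ℤ ·ʳ row e′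

  value-row : (e : Exp k) (ρ : Vec ℤ k) → value (row e) ρ ≡ ⟦ e ⟧ ρ
  value-row (var i)  ρ = trans (+-identityˡ _) (dot-unit i ρ)
  value-row (κ c)    ρ = trans (cong (_+_ (+ c)) (dot-zero ρ)) (+-identityʳ (+ c))
  value-row (e ⊕ e′) ρ =
    trans (value-+ʳ (row e) (row e′) ρ) (cong₂ _+_ (value-row e ρ) (value-row e′ ρ))
  value-row (e ⊖ e′) ρ =
    trans (value-+ʳ (row e) (-1ℤ ·ʳ row e′) ρ)
      (cong₂ _+_ (value-row e ρ)
        (trans (value-·ʳ -1ℤ (row e′) ρ) (trans (cong (-1ℤ *_) (value-row e′ ρ)) (-1*i≡-i _))))

  NonNeg : Vec ℤ k → Row k → Set
  NonNeg ρ r = + 0 ≤ value r ρ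

  gap : Exp k → Exp k → Row k
  gap e e′ = row (e′ ⊖ e)

  NonNeg-gap : (e e′ : Exp k) (ρ : Vec ℤ k) → ⟦ e ⟧ ρ ≤ ⟦ e′ ⟧ ρ → NonNeg ρ (gap e e′)
  NonNeg-gap e e′ ρ e≤e′ = subst (+ 0 ≤_) (sym (value-row (e′ ⊖ e) ρ)) (i≤j⇒0≤j-i e≤e′)

  rows : Atom k → List (Row k)
  rows (e ≼ e′) = gap e e′ ∷ []
  -- Over ℤ a strict inequality is a non-strict one with a margin of 1. Integrality enters only
  -- here; the elimination itself would serve equally over the rationals.
  rows (e ≺ e′) = gap (κ 1 ⊕ e) e′ ∷ []
  rows (e ≐ e′) = gap e e′ ∷ gap e′ e ∷ []

  rows-sound : (a : Atom k) (ρ : Vec ℤ k) → ⟦ a ⟧ᵃ ρ → All (NonNeg ρ) (rows a)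
  rows-sound (e ≼ e′) ρ h = NonNeg-gap e e′ ρ h ∷ []
  rows-sound (e ≺ e′) ρ h = NonNeg-gap (κ 1 ⊕ e) e′ ρ (i<j⇒suc[i]≤j h) ∷ []
  rows-sound (e ≐ e′) ρ h = NonNeg-gap e e′ ρ (≤-reflexive h) ∷ NonNeg-gap e′ e ρ (≤-reflexive (sym h)) ∷ []

  contradictory : Row k → Set
  contradictory {k} (c , cs) = c < + 0 × cs ≡ replicate k (+ 0)

  contradictory? : (r : Row k) → Dec (contradictory r)
  contradictory? (c , cs) = (c <? + 0) ×-dec ≡-dec _≟_ cs _

  -- The weights are absolute values, so that the combination is sound whatever
  -- the signs of the two coefficients are.
  eliminate : Fin k → List (Row k) → List (Row k)
  eliminate i rs = filter (λ r → coeff r ≟ + 0) rs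
                 ++ cartesianProductWith combine (filter (λ r → + 0 <? coeff r) rs)
                                                 (filter (λ r → coeff r <? + 0) rs)
    where
    coeff : Row _ → ℤ
    coeff r = lookup (proj₂ r) i
    combine : Row _ → Row _ → Row _
    combine r s = + ∣ coeff s ∣ ·ʳ r +ʳ + ∣ coeff r ∣ ·ʳ s

  NonNeg-combine : (a b : ℕ) (r s : Row k) (ρ : Vec ℤ k) →
    NonNeg ρ r → NonNeg ρ s → NonNeg ρ (+ a ·ʳ r +ʳ + b ·ʳ s)
  NonNeg-combine a b r s ρ 0≤r 0≤s = subst (+ 0 ≤_)
    (sym (trans (value-+ʳ (+ a ·ʳ r) (+ b ·ʳ s) ρ) (cong₂ _+_ (value-·ʳ (+ a) r ρ) (value-·ʳ (+ b) s ρ))))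
    (+-mono-≤ (scale a 0≤r) (scale b 0≤s))
    where
    scale : ∀ c {x} → + 0 ≤ x → + 0 ≤ + c * x
    scale c {x} 0≤x = subst (_≤ + c * x) (*-zeroʳ (+ c)) (*-monoˡ-≤-nonNeg (+ c) 0≤x)

  eliminate-sound : (i : Fin k) (rs : List (Row k)) (ρ : Vec ℤ k) →
    All (NonNeg ρ) rs → All (NonNeg ρ) (eliminate i rs)
  eliminate-sound i rs ρ hs = Allₚ.++⁺ (Allₚ.filter⁺ _ hs)
    (Allₚ.cartesianProductWith⁺ (setoid _) (setoid _) _ _ _ λ {r} {s} r∈ s∈ →
      NonNeg-combine ∣ lookup (proj₂ s) i ∣ ∣ lookup (proj₂ r) i ∣ r s ρ (All.lookup (Allₚ.filter⁺ _ hs) r∈)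
        (All.lookup (Allₚ.filter⁺ _ hs) s∈))

  eliminateAll : List (Fin k) → List (Row k) → List (Row k)
  eliminateAll []       rs = rs
  eliminateAll (i ∷ is) rs = eliminateAll is (eliminate i rs)

  eliminateAll-sound : (is : List (Fin k)) (rs : List (Row k)) (ρ : Vec ℤ k) →
    All (NonNeg ρ) rs → All (NonNeg ρ) (eliminateAll is rs)
  eliminateAll-sound []       rs ρ hs = hs
  eliminateAll-sound (i ∷ is) rs ρ hs = eliminateAll-sound is _ ρ (eliminate-sound i rs ρ hs)

  refutes : List (Row k) → Bool
  refutes {k} rs = does (any? contradictory? (eliminateAll (allFin k) rs))

  contradictory⇒¬NonNeg : (r : Row k) (ρ : Vec ℤ k) → contradictory r → ¬ NonNeg ρ r
  contradictory⇒¬NonNeg (c , _) ρ (c<0 , refl) 0≤ =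
    <⇒≱ c<0 (subst (+ 0 ≤_) (trans (cong (_+_ c) (dot-zero ρ)) (+-identityʳ c)) 0≤)

  refutes-sound : (rs : List (Row k)) (ρ : Vec ℤ k) → T (refutes rs) → ¬ All (NonNeg ρ) rs
  refutes-sound {k} rs ρ ok hs with any? contradictory? (eliminateAll (allFin k) rs)
  ... | yes found = let r , r∈ , bad = find found in
    contradictory⇒¬NonNeg r ρ bad (All.lookup (eliminateAll-sound (allFin k) rs ρ hs) r∈)

  -- Goals are proved by refuting their negation. The negation of an equation is a disjunction, so
  -- its two strict halves are refuted separately.
  validFrom : List (Row k) → Sequent k → Bool
  validFrom rs (⊢ e ≼ e′) = refutes (rows (e′ ≺ e) ++ rs)
  validFrom rs (⊢ e ≺ e′) = refutes (rows (e′ ≼ e) ++ rs)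
  validFrom rs (⊢ e ≐ e′) = refutes (rows (e ≺ e′) ++ rs) ∧ refutes (rows (e′ ≺ e) ++ rs)
  validFrom rs ⊢⊥         = refutes rs
  validFrom rs (a ⇒ s)    = validFrom (rows a ++ rs) s

  validFrom-sound : (rs : List (Row k)) (s : Sequent k) (ρ : Vec ℤ k) →
    T (validFrom rs s) → All (NonNeg ρ) rs → ⟦ s ⟧ˢ ρ
  validFrom-sound {k} rs s ρ = go s
    where
    refuted : (a : Atom k) → T (refutes (rows a ++ rs)) → All (NonNeg ρ) rs → ¬ ⟦ a ⟧ᵃ ρ
    refuted a ok hs h = refutes-sound (rows a ++ rs) ρ ok (Allₚ.++⁺ (rows-sound a ρ h) hs)
    go : (s : Sequent k) → T (validFrom rs s) → All (NonNeg ρ) rs → ⟦ s ⟧ˢ ρ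
    go (⊢ e ≼ e′) ok hs = ≮⇒≥ (refuted (e′ ≺ e) ok hs)
    go (⊢ e ≺ e′) ok hs = ≰⇒> (refuted (e′ ≼ e) ok hs)
    go (⊢ e ≐ e′) ok hs =
      let ok₁ , ok₂ = Equivalence.to T-∧ ok
      in ≤-antisym (≮⇒≥ (refuted (e′ ≺ e) ok₂ hs)) (≮⇒≥ (refuted (e ≺ e′) ok₁ hs))
    go ⊢⊥         ok hs = refutes-sound rs ρ ok hs
    go (a ⇒ s)    ok hs = λ h → validFrom-sound (rows a ++ rs) s ρ ok (Allₚ.++⁺ (rows-sound a ρ h) hs)

  -- Variables are bound by an Agda function of matching arity, so that a sequent can be written as
  -- a λ-term whose arguments name the entries of the environment.
  close : N-ary k (Exp k) (Sequent k) → Sequent k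
  close {k} s = s $ⁿ mapᵛ var (allFinᵛ k)

  -- The implicit argument runs the decision procedure.  The definition is abstract
  -- because with-abstractions would otherwise normalise the proofs it returns.
  abstract
    lin : (ρ : Vec ℤ k) (s : N-ary k (Exp k) (Sequent k)) {_ : T (validFrom [] (close s))} → ⟦ close s ⟧ˢ ρ
    lin ρ s {ok} = validFrom-sound [] (close s) ρ ok []

-- Noncrossing matchings of integer intervals, encoded by binary trees

module IntervalMatchings where
  open Linear using (lin; κ; _⊕_; _⊖_; _≼_; _≺_; _≐_; ⊢_; ⊢⊥; _⇒_)
  open import Data.Integer using (_+_; _≤_; _<_; _≟_; _<?_)
  open import Data.Vec using (head)

  pos-suc : ∀ k → + suc k ≡ + k + + 1
  pos-suc k = cong +_ (ℕₚ.+-comm 1 k)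

  data Tree : Set where
    leaf : Tree
    node : Tree → Tree → Tree

  size : Tree → ℕ
  size leaf       = 0
  size (node l r) = suc (size l ℕ.+ size r)

  -- Defined by recursion in ℤ instead of as twice `size`, so that the width of a node is a linear
  -- expression in the widths of its subtrees.
  width : Tree → ℤ
  width leaf       = + 0
  width (node l r) = width l + width r + + 2

  width≡ : ∀ t → width t ≡ + size t + + size t
  width≡ leaf       = refl
  width≡ (node l r) = lin (width l ∷ + size l ∷ width r ∷ + size r ∷ + (size l ℕ.+ size r) ∷ + suc (size l ℕ.+ size r)
    ∷ + size (node l r) ∷ [])
    (λ a b c d e f g → a ≐ b ⊕ b ⇒ c ≐ d ⊕ d ⇒ e ≐ b ⊕ d ⇒ f ≐ e ⊕ κ 1 ⇒ g ≐ f ⇒ ⊢ a ⊕ c ⊕ κ 2 ≐ g ⊕ g) (width≡ l)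
    (width≡ r) (ℤₚ.pos-+ (size l) (size r)) (pos-suc (size l ℕ.+ size r)) unfold
    where
    unfold : + size (node l r) ≡ + suc (size l ℕ.+ size r)
    unfold = refl

  width≥0 : ∀ t → + 0 ≤ width t
  width≥0 leaf       = ℤₚ.≤-refl
  width≥0 (node l r) = lin (width l ∷ width r ∷ []) (λ a b → κ 0 ≼ a ⇒ κ 0 ≼ b ⇒ ⊢ κ 0 ≼ a ⊕ b ⊕ κ 2) (width≥0 l)
    (width≥0 r)

  -- The matching of [o , o + width t) in which node l r stands for an arc at o
  -- enclosing l, followed by r.
  abstract
    partner : Tree → ℤ → ℤ → ℤ
    -- With the decisions as arguments, the equations below are proved by cases on arbitrary
    -- decisions, without unfolding comparisons of integers.
    partnerBy : (l r : Tree) (o z : ℤ) → Dec (z ≡ o) → Dec (z ≡ o + + 1 + width l) → Dec (z < o + + 1 + width l) → ℤ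

    partner leaf       o z = z
    partner (node l r) o z = partnerBy l r o z (z ≟ o) (z ≟ o + + 1 + width l) (z <? o + + 1 + width l)

    partnerBy l r o z (yes _) _       _       = o + + 1 + width l
    partnerBy l r o z (no _)  (yes _) _       = o
    partnerBy l r o z (no _)  (no _)  (yes _) = partner l (o + + 1) z
    partnerBy l r o z (no _)  (no _)  (no _)  = partner r (o + + 1 + width l + + 1) z

    partner-open : ∀ l r o → partner (node l r) o o ≡ o + + 1 + width l
    partner-open l r o = go (o ≟ o) _ _
      where
      go : ∀ d d′ d″ → partnerBy l r o o d d′ d″ ≡ o + + 1 + width l
      go (yes _)   _ _ = refl
      go (no o≢o)  _ _ = ⊥-elim (o≢o refl)

    partner-close : ∀ l r o → partner (node l r) o (o + + 1 + width l) ≡ o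
    partner-close l r o = go (_ ≟ o) (_ ≟ _) _
      where
      go : ∀ d d′ d″ → partnerBy l r o (o + + 1 + width l) d d′ d″ ≡ o
      go (yes c≡o) _        _ = ⊥-elim (lin (o ∷ width l ∷ []) (λ a b → a ⊕ κ 1 ⊕ b ≐ a ⇒ κ 0 ≼ b ⇒ ⊢⊥) c≡o
        (width≥0 l))
      go (no _)    (yes _)  _ = refl
      go (no _)    (no c≢c) _ = ⊥-elim (c≢c refl)

    partner-inner : ∀ l r o {z} → o < z → z < o + + 1 + width l → partner (node l r) o z ≡ partner l (o + + 1) z
    partner-inner l r o {z} o<z z<c = go (z ≟ o) (z ≟ _) (z <? _)
      where
      go : ∀ d d′ d″ → partnerBy l r o z d d′ d″ ≡ partner l (o + + 1) z
      go (yes z≡o) _         _        = ⊥-elim (lin (o ∷ z ∷ []) (λ a b → a ≺ b ⇒ b ≐ a ⇒ ⊢⊥) o<z z≡o)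
      go (no _)    (yes z≡c) _        =
        ⊥-elim (lin (z ∷ o ∷ width l ∷ []) (λ a b c → a ≺ b ⊕ κ 1 ⊕ c ⇒ a ≐ b ⊕ κ 1 ⊕ c ⇒ ⊢⊥) z<c z≡c)
      go (no _)    (no _)    (yes _)  = refl
      go (no _)    (no _)    (no z≮c) = ⊥-elim (z≮c z<c)

    partner-outer : ∀ l r o {z} → o + + 1 + width l < z → partner (node l r) o z ≡ partner r (o + + 1 + width l + + 1)
      z
    partner-outer l r o {z} c<z = go (z ≟ o) (z ≟ _) (z <? _)
      where
      go : ∀ d d′ d″ → partnerBy l r o z d d′ d″ ≡ partner r (o + + 1 + width l + + 1) z
      go (yes z≡o) _         _         =
        ⊥-elim (lin (o ∷ width l ∷ z ∷ []) (λ a b c → a ⊕ κ 1 ⊕ b ≺ c ⇒ c ≐ a ⇒ κ 0 ≼ b ⇒ ⊢⊥) c<z z≡o (width≥0 l))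
      go (no _)    (yes z≡c) _         =
        ⊥-elim (lin (o ∷ width l ∷ z ∷ []) (λ a b c → a ⊕ κ 1 ⊕ b ≺ c ⇒ c ≐ a ⊕ κ 1 ⊕ b ⇒ ⊢⊥) c<z z≡c)
      go (no _)    (no _)    (yes z<c) =
        ⊥-elim (lin (z ∷ o ∷ width l ∷ []) (λ a b c → a ≺ b ⊕ κ 1 ⊕ c ⇒ b ⊕ κ 1 ⊕ c ≺ a ⇒ ⊢⊥) z<c c<z)
      go (no _)    (no _)    (no _)    = refl

  module _ (l r : Tree) (o : ℤ) where
    private
      c = o + + 1 + width l

    data Position (z : ℤ) : Set where
      opens  : z ≡ o → Position z
      inner  : o < z → z < o + + 1 + width l → Position z
      closes : z ≡ o + + 1 + width l → Position z
      outer  : o + + 1 + width l < z → Position z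

    position : ∀ {z} → o ≤ z → Position z
    position {z} o≤z with z ≟ o | z ≟ c | z <? c
    ... | yes z≡o | _       | _       = opens z≡o
    ... | no z≢o  | yes z≡c | _       = closes z≡c
    ... | no z≢o  | no z≢c  | yes z<c = inner (ℤₚ.≤∧≢⇒< o≤z (λ o≡z → z≢o (sym o≡z))) z<c
    ... | no z≢o  | no z≢c  | no z≮c  = outer (ℤₚ.≤∧≢⇒< (ℤₚ.≮⇒≥ z≮c) (λ c≡z → z≢c (sym c≡z)))

  record IntervalMatching (h : ℤ → ℤ) (lo hi : ℤ) : Set where
    field
      closed     : ∀ z → lo ≤ z → z < hi → lo ≤ h z × h z < hi
      involutive : ∀ z → lo ≤ z → z < hi → h (h z) ≡ z
      irreflexive : ∀ z → lo ≤ z → z < hi → h z ≢ z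
      nested     : ∀ x y → lo ≤ x → x < hi → x < y → y < h x → h y < h x

  module _ {h lo hi} (M : IntervalMatching h lo hi) where
    open IntervalMatching M

    -- If `h y` lay left of `x`, nesting applied to the arc from `h y` to `y` would put `h x` below
    -- `y`. Hence `nested` only has to bound partners on the right.
    interval-nestedˡ : ∀ x y → lo ≤ x → x < hi → x < y → y < h x → x < h y
    interval-nestedˡ x y lo≤x x<hi x<y y<hx with ℤₚ.<-cmp x (h y)
    ... | tri< x<hy _ _ = x<hy
    ... | tri≈ _ x≡hy _ = ⊥-elim (lin (y ∷ h x ∷ h (h y) ∷ []) (λ a b c → a ≺ b ⇒ b ≐ c ⇒ c ≐ a ⇒ ⊢⊥) y<hx
      (cong h x≡hy) (involutive y lo≤y y<hi))
      where
      lo≤y : lo ≤ y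
      lo≤y = lin (lo ∷ x ∷ y ∷ []) (λ a b c → a ≼ b ⇒ b ≺ c ⇒ ⊢ a ≼ c) lo≤x x<y
      y<hi : y < hi
      y<hi = ℤₚ.<-trans y<hx (proj₂ (closed x lo≤x x<hi))
    ... | tri> _ _ hy<x = ⊥-elim (lin (h x ∷ h (h y) ∷ y ∷ []) (λ a b c → a ≺ b ⇒ c ≺ a ⇒ b ≐ c ⇒ ⊢⊥) inside y<hx
      (involutive y lo≤y y<hi))
      where
      lo≤y : lo ≤ y
      lo≤y = lin (lo ∷ x ∷ y ∷ []) (λ a b c → a ≼ b ⇒ b ≺ c ⇒ ⊢ a ≼ c) lo≤x x<y
      y<hi : y < hi
      y<hi = ℤₚ.<-trans y<hx (proj₂ (closed x lo≤x x<hi))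
      x<hhy : x < h (h y)
      x<hhy = lin (x ∷ y ∷ h (h y) ∷ []) (λ a b c → a ≺ b ⇒ c ≐ b ⇒ ⊢ a ≺ c) x<y (involutive y lo≤y y<hi)
      inside : h x < h (h y)
      inside = nested (h y) x (proj₁ (closed y lo≤y y<hi)) (proj₂ (closed y lo≤y y<hi)) hy<x x<hhy

  partner-matching : ∀ t o → IntervalMatching (partner t o) o (o + width t)
  partner-matching leaf o = record
    { closed     = λ z o≤z z<o → ⊥-elim (lin (o ∷ z ∷ []) (λ a b → a ≼ b ⇒ b ≺ a ⊕ κ 0 ⇒ ⊢⊥) o≤z z<o)
    ; involutive = λ z o≤z z<o → ⊥-elim (lin (o ∷ z ∷ []) (λ a b → a ≼ b ⇒ b ≺ a ⊕ κ 0 ⇒ ⊢⊥) o≤z z<o)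
    ; irreflexive = λ z o≤z z<o → ⊥-elim (lin (o ∷ z ∷ []) (λ a b → a ≼ b ⇒ b ≺ a ⊕ κ 0 ⇒ ⊢⊥) o≤z z<o)
    ; nested     = λ z _ o≤z z<o → ⊥-elim (lin (o ∷ z ∷ []) (λ a b → a ≼ b ⇒ b ≺ a ⊕ κ 0 ⇒ ⊢⊥) o≤z z<o)
    }
  partner-matching (node l r) o = record
    { closed = closed ; involutive = involutive ; irreflexive = irreflexive ; nested = nested }
    where
    c = o + + 1 + width l
    hi = o + (width l + width r + + 2)
    p = partner (node l r) o
    module L = IntervalMatching (partner-matching l (o + + 1))
    module R = IntervalMatching (partner-matching r (o + + 1 + width l + + 1))
    0≤l = width≥0 l
    0≤r = width≥0 r
    l-closed : ∀ z → o < z → z < c → o < p z × p z < c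
    l-closed z o<z z<c =
      let q = L.closed z (lin (o ∷ z ∷ []) (λ a b → a ≺ b ⇒ ⊢ a ⊕ κ 1 ≼ b) o<z) z<c
          e = partner-inner l r o o<z z<c
      in (lin (o ∷ partner l (o + + 1) z ∷ partner (node l r) o z ∷ []) (λ a b c → a ⊕ κ 1 ≼ b ⇒ c ≐ b ⇒ ⊢ a ≺ c)
           (proj₁ q) e) , (lin (partner l (o + + 1) z ∷ o ∷ width l ∷ partner (node l r) o z ∷ [])
           (λ a b c d → a ≺ b ⊕ κ 1 ⊕ c ⇒ d ≐ a ⇒ ⊢ d ≺ b ⊕ κ 1 ⊕ c) (proj₂ q) e)
    r-closed : ∀ z → c < z → z < hi → c < p z × p z < hi
    r-closed z c<z z<hi =
      let q = R.closed z (lin (o ∷ width l ∷ z ∷ []) (λ a b c → a ⊕ κ 1 ⊕ b ≺ c ⇒ ⊢ a ⊕ κ 1 ⊕ b ⊕ κ 1 ≼ c) c<z)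
            (lin (z ∷ o ∷ width l ∷ width r ∷ []) (λ a b c d → a ≺ b ⊕ (c ⊕ d ⊕ κ 2) ⇒ ⊢ a ≺ b ⊕ κ 1 ⊕ c ⊕ κ 1 ⊕ d)
            z<hi)
          e = partner-outer l r o c<z
      in (lin (o ∷ width l ∷ partner r (o + + 1 + width l + + 1) z ∷ partner (node l r) o z ∷ [])
           (λ a b c d → a ⊕ κ 1 ⊕ b ⊕ κ 1 ≼ c ⇒ d ≐ c ⇒ ⊢ a ⊕ κ 1 ⊕ b ≺ d) (proj₁ q) e) ,
           (lin (partner r (o + + 1 + width l + + 1) z ∷ o ∷ width l ∷ width r ∷ partner (node l r) o z ∷ [])
           (λ a b c d e → a ≺ b ⊕ κ 1 ⊕ c ⊕ κ 1 ⊕ d ⇒ e ≐ a ⇒ ⊢ e ≺ b ⊕ (c ⊕ d ⊕ κ 2)) (proj₂ q) e)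
    closed : ∀ z → o ≤ z → z < hi → o ≤ p z × p z < hi
    closed z o≤z z<hi with position l r o o≤z
    ... | opens refl     =
      (lin (partner (node l r) z z ∷ z ∷ width l ∷ []) (λ a b c → a ≐ b ⊕ κ 1 ⊕ c ⇒ κ 0 ≼ c ⇒ ⊢ b ≼ a)
      (partner-open l r o) 0≤l) , (lin (partner (node l r) z z ∷ z ∷ width l ∷ width r ∷ [])
      (λ a b c d → a ≐ b ⊕ κ 1 ⊕ c ⇒ κ 0 ≼ d ⇒ ⊢ a ≺ b ⊕ (c ⊕ d ⊕ κ 2)) (partner-open l r o) 0≤r)
    ... | closes refl    = (lin (partner (node l r) o (o + + 1 + width l) ∷ o ∷ []) (λ a b → a ≐ b ⇒ ⊢ b ≼ a)
      (partner-close l r o)) , (lin (partner (node l r) o (o + + 1 + width l) ∷ o ∷ width l ∷ width r ∷ [])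
      (λ a b c d → a ≐ b ⇒ κ 0 ≼ c ⇒ κ 0 ≼ d ⇒ ⊢ a ≺ b ⊕ (c ⊕ d ⊕ κ 2)) (partner-close l r o) 0≤l 0≤r)
    ... | inner o<z z<c  = (ℤₚ.<⇒≤ (proj₁ (l-closed z o<z z<c))) , (lin (p z ∷ o ∷ width l ∷ width r ∷ [])
      (λ a b c d → a ≺ b ⊕ κ 1 ⊕ c ⇒ κ 0 ≼ d ⇒ ⊢ a ≺ b ⊕ (c ⊕ d ⊕ κ 2)) (proj₂ (l-closed z o<z z<c)) 0≤r)
    ... | outer c<z      = (lin (o ∷ width l ∷ p z ∷ []) (λ a b c → a ⊕ κ 1 ⊕ b ≺ c ⇒ κ 0 ≼ b ⇒ ⊢ a ≼ c)
      (proj₁ (r-closed z c<z z<hi)) 0≤l) , proj₂ (r-closed z c<z z<hi)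
    involutive : ∀ z → o ≤ z → z < hi → p (p z) ≡ z
    involutive z o≤z z<hi with position l r o o≤z
    ... | opens refl     = trans (cong p (partner-open l r o)) (partner-close l r o)
    ... | closes refl    = trans (cong p (partner-close l r o)) (partner-open l r o)
    ... | inner o<z z<c  =
      trans (partner-inner l r o (proj₁ (l-closed z o<z z<c)) (proj₂ (l-closed z o<z z<c)))
        (trans (cong (partner l (o + + 1)) (partner-inner l r o o<z z<c))
          (L.involutive z (lin (o ∷ z ∷ []) (λ a b → a ≺ b ⇒ ⊢ a ⊕ κ 1 ≼ b) o<z) z<c))
    ... | outer c<z      =
      trans (partner-outer l r o (proj₁ (r-closed z c<z z<hi)))
        (trans (cong (partner r (o + + 1 + width l + + 1)) (partner-outer l r o c<z))
          (R.involutive z (lin (o ∷ width l ∷ z ∷ []) (λ a b c → a ⊕ κ 1 ⊕ b ≺ c ⇒ ⊢ a ⊕ κ 1 ⊕ b ⊕ κ 1 ≼ c) c<z)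
          (lin (z ∷ o ∷ width l ∷ width r ∷ []) (λ a b c d → a ≺ b ⊕ (c ⊕ d ⊕ κ 2) ⇒ ⊢ a ≺ b ⊕ κ 1 ⊕ c ⊕ κ 1 ⊕ d)
          z<hi)))
    irreflexive : ∀ z → o ≤ z → z < hi → p z ≢ z
    irreflexive z o≤z z<hi pz≡z with position l r o o≤z
    ... | opens refl     = lin (partner (node l r) z z ∷ z ∷ width l ∷ [])
      (λ a b c → a ≐ b ⊕ κ 1 ⊕ c ⇒ a ≐ b ⇒ κ 0 ≼ c ⇒ ⊢⊥) (partner-open l r o) pz≡z 0≤l
    ... | closes refl    = lin (partner (node l r) o (o + + 1 + width l) ∷ o ∷ width l ∷ [])
      (λ a b c → a ≐ b ⇒ a ≐ b ⊕ κ 1 ⊕ c ⇒ κ 0 ≼ c ⇒ ⊢⊥) (partner-close l r o) pz≡z 0≤l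
    ... | inner o<z z<c  = L.irreflexive z (lin (o ∷ z ∷ []) (λ a b → a ≺ b ⇒ ⊢ a ⊕ κ 1 ≼ b) o<z) z<c
      (trans (sym (partner-inner l r o o<z z<c)) pz≡z)
    ... | outer c<z      = R.irreflexive z
      (lin (o ∷ width l ∷ z ∷ []) (λ a b c → a ⊕ κ 1 ⊕ b ≺ c ⇒ ⊢ a ⊕ κ 1 ⊕ b ⊕ κ 1 ≼ c) c<z)
      (lin (z ∷ o ∷ width l ∷ width r ∷ []) (λ a b c d → a ≺ b ⊕ (c ⊕ d ⊕ κ 2) ⇒ ⊢ a ≺ b ⊕ κ 1 ⊕ c ⊕ κ 1 ⊕ d) z<hi)
      (trans (sym (partner-outer l r o c<z)) pz≡z)
    nested : ∀ x y → o ≤ x → x < hi → x < y → y < p x → p y < p x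
    nested x y o≤x x<hi x<y y<px with position l r o o≤x
    ... | opens refl     = lin (partner (node l r) x x ∷ x ∷ width l ∷ p y ∷ [])
      (λ a b c d → a ≐ b ⊕ κ 1 ⊕ c ⇒ d ≺ b ⊕ κ 1 ⊕ c ⇒ ⊢ d ≺ a) (partner-open l r o) (proj₂ (l-closed y x<y y<c))
      where
      y<c : y < c
      y<c = lin (partner (node l r) x x ∷ x ∷ width l ∷ y ∷ [])
        (λ a b c d → a ≐ b ⊕ κ 1 ⊕ c ⇒ d ≺ a ⇒ ⊢ d ≺ b ⊕ κ 1 ⊕ c) (partner-open l r o) y<px
    ... | closes refl    = ⊥-elim (lin (partner (node l r) o (o + + 1 + width l) ∷ o ∷ width l ∷ y ∷ [])
      (λ a b c d → a ≐ b ⇒ b ⊕ κ 1 ⊕ c ≺ d ⇒ d ≺ a ⇒ κ 0 ≼ c ⇒ ⊢⊥) (partner-close l r o) x<y y<px 0≤l)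
    ... | inner o<x x<c  =
      lin (partner l (o + + 1) y ∷ partner l (o + + 1) x ∷ partner (node l r) o x ∷ partner (node l r) o y ∷ [])
      (λ a b c d → a ≺ b ⇒ c ≐ b ⇒ d ≐ a ⇒ ⊢ d ≺ c)
      (L.nested x y (lin (o ∷ x ∷ []) (λ a b → a ≺ b ⇒ ⊢ a ⊕ κ 1 ≼ b) o<x) x<c x<y
      (lin (y ∷ partner (node l r) o x ∷ partner l (o + + 1) x ∷ []) (λ a b c → a ≺ b ⇒ b ≐ c ⇒ ⊢ a ≺ c) y<px ex)) ex
      ey
      where
      ex = partner-inner l r o o<x x<c
      o<y : o < y
      o<y = ℤₚ.<-trans o<x x<y
      y<c : y < c
      y<c = lin (y ∷ partner (node l r) o x ∷ o ∷ width l ∷ [])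
        (λ a b c d → a ≺ b ⇒ b ≺ c ⊕ κ 1 ⊕ d ⇒ ⊢ a ≺ c ⊕ κ 1 ⊕ d) y<px (proj₂ (l-closed x o<x x<c))
      ey = partner-inner l r o o<y y<c
    ... | outer c<x      = lin (partner r (o + + 1 + width l + + 1) y ∷ partner r (o + + 1 + width l + + 1) x ∷
      partner (node l r) o x ∷ partner (node l r) o y ∷ []) (λ a b c d → a ≺ b ⇒ c ≐ b ⇒ d ≐ a ⇒ ⊢ d ≺ c)
      (R.nested x y (lin (o ∷ width l ∷ x ∷ []) (λ a b c → a ⊕ κ 1 ⊕ b ≺ c ⇒ ⊢ a ⊕ κ 1 ⊕ b ⊕ κ 1 ≼ c) c<x)
      (lin (x ∷ o ∷ width l ∷ width r ∷ []) (λ a b c d → a ≺ b ⊕ (c ⊕ d ⊕ κ 2) ⇒ ⊢ a ≺ b ⊕ κ 1 ⊕ c ⊕ κ 1 ⊕ d) x<hi)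
      x<y (lin (y ∷ partner (node l r) o x ∷ partner r (o + + 1 + width l + + 1) x ∷ [])
      (λ a b c → a ≺ b ⇒ b ≐ c ⇒ ⊢ a ≺ c) y<px ex)) ex ey
      where
      ex = partner-outer l r o c<x
      c<y : c < y
      c<y = lin (o ∷ width l ∷ x ∷ y ∷ []) (λ a b c d → a ⊕ κ 1 ⊕ b ≺ c ⇒ c ≺ d ⇒ ⊢ a ⊕ κ 1 ⊕ b ≺ d) c<x x<y
      ey = partner-outer l r o c<y

  Decomposes : (ℤ → ℤ) → ℤ → ℤ → Tree → Set
  Decomposes h lo hi t = lo + width t ≡ hi × (∀ z → lo ≤ z → z < hi → h z ≡ partner t lo z)

  decomposes-node : ∀ {h lo hi c l r} → h lo ≡ c → h c ≡ lo →
    Decomposes h (lo + + 1) c l → Decomposes h (c + + 1) hi r → Decomposes h lo hi (node l r)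
  decomposes-node {h} {lo} {hi} {c} {l} {r} open′ close′ (refl , inside) (c≡ , after) =
    (lin (lo ∷ width l ∷ width r ∷ hi ∷ []) (λ a b c d → a ⊕ κ 1 ⊕ b ⊕ κ 1 ⊕ c ≐ d ⇒ ⊢ a ⊕ (b ⊕ c ⊕ κ 2) ≐ d) c≡) ,
    agree
    where
    agree : ∀ z → lo ≤ z → z < hi → h z ≡ partner (node l r) lo z
    agree z lo≤z z<hi with position l r lo lo≤z
    ... | opens refl   = trans open′ (sym (partner-open l r lo))
    ... | closes refl  = trans close′ (sym (partner-close l r lo))
    ... | inner p q    = trans (inside z (lin (lo ∷ z ∷ []) (λ a b → a ≺ b ⇒ ⊢ a ⊕ κ 1 ≼ b) p) q)
      (sym (partner-inner l r lo p q))
    ... | outer p      = trans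
      (after z (lin (lo ∷ width l ∷ z ∷ []) (λ a b c → a ⊕ κ 1 ⊕ b ≺ c ⇒ ⊢ a ⊕ κ 1 ⊕ b ⊕ κ 1 ≼ c) p) z<hi)
      (sym (partner-outer l r lo p))

  inside-arc : ∀ {h lo hi} → IntervalMatching h lo hi → ∀ x → lo ≤ x → x < hi → IntervalMatching h (x + + 1) (h x)
  inside-arc {h} {lo} {hi} M x lo≤x x<hi = record
    { closed      = λ z p q → (lin (x ∷ h z ∷ []) (λ a b → a ≺ b ⇒ ⊢ a ⊕ κ 1 ≼ b)
      (interval-nestedˡ M x z lo≤x x<hi (lin (x ∷ z ∷ []) (λ a b → a ⊕ κ 1 ≼ b ⇒ ⊢ a ≺ b) p) q)) , nested x z lo≤x
      x<hi (lin (x ∷ z ∷ []) (λ a b → a ⊕ κ 1 ≼ b ⇒ ⊢ a ≺ b) p) q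
    ; involutive  = λ z p q → involutive z (lin (x ∷ z ∷ lo ∷ []) (λ a b c → a ⊕ κ 1 ≼ b ⇒ c ≼ a ⇒ ⊢ c ≼ b) p lo≤x)
      (ℤₚ.<-trans q (proj₂ (closed x lo≤x x<hi)))
    ; irreflexive = λ z p q → irreflexive z (lin (x ∷ z ∷ lo ∷ []) (λ a b c → a ⊕ κ 1 ≼ b ⇒ c ≼ a ⇒ ⊢ c ≼ b) p lo≤x)
      (ℤₚ.<-trans q (proj₂ (closed x lo≤x x<hi)))
    ; nested      = λ y z p q → nested y z (lin (x ∷ y ∷ lo ∷ []) (λ a b c → a ⊕ κ 1 ≼ b ⇒ c ≼ a ⇒ ⊢ c ≼ b) p lo≤x)
      (ℤₚ.<-trans q (proj₂ (closed x lo≤x x<hi)))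
    }
    where open IntervalMatching M

  -- An interval that the matching leaves invariant splits off the arc at its
  -- left end; both remaining parts are invariant again.
  module _ {h lo hi} (M : IntervalMatching h lo hi) (lo<hi : lo < hi) where
    open IntervalMatching M
    private
      lo≤lo : lo ≤ lo
      lo≤lo = ℤₚ.≤-refl
      c-in : lo ≤ h lo × h lo < hi
      c-in = closed lo lo≤lo lo<hi
      lo<c : lo < h lo
      lo<c = ℤₚ.≤∧≢⇒< (proj₁ c-in) (λ e → irreflexive lo lo≤lo lo<hi (sym e))
      hc : h (h lo) ≡ lo
      hc = involutive lo lo≤lo lo<hi

    inside-first : IntervalMatching h (lo + + 1) (h lo)
    inside-first = inside-arc M lo lo≤lo lo<hi

    private
      beyond : ∀ z → h lo + + 1 ≤ z → z < hi → h lo < h z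
      beyond z p q with ℤₚ.<-cmp (h lo) (h z)
      ... | tri< c<hz _ _ = c<hz
      ... | tri≈ _ c≡hz _ =
        ⊥-elim (lin (h lo ∷ z ∷ lo ∷ h (h lo) ∷ h (h z) ∷ [])
        (λ a b c d e → a ⊕ κ 1 ≼ b ⇒ c ≺ a ⇒ d ≐ c ⇒ d ≐ e ⇒ e ≐ b ⇒ ⊢⊥) p lo<c hc (cong h c≡hz)
        (involutive z (lin (h lo ∷ z ∷ lo ∷ []) (λ a b c → a ⊕ κ 1 ≼ b ⇒ c ≺ a ⇒ ⊢ c ≼ b) p lo<c) q))
      ... | tri> _ _ hz<c with lo ≟ h z
      ...   | yes lo≡hz = ⊥-elim (lin (h lo ∷ z ∷ h (h z) ∷ []) (λ a b c → a ⊕ κ 1 ≼ b ⇒ a ≐ c ⇒ c ≐ b ⇒ ⊢⊥) p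
        (cong h lo≡hz) (involutive z (lin (h lo ∷ z ∷ lo ∷ []) (λ a b c → a ⊕ κ 1 ≼ b ⇒ c ≺ a ⇒ ⊢ c ≼ b) p lo<c) q))
      ...   | no lo≢hz  = ⊥-elim (lin (h lo ∷ z ∷ h (h z) ∷ []) (λ a b c → a ⊕ κ 1 ≼ b ⇒ c ≐ b ⇒ c ≺ a ⇒ ⊢⊥) p
        (involutive z lo≤z q) (nested lo (h z) lo≤lo lo<hi lo<hz hz<c))
        where
        lo≤z : lo ≤ z
        lo≤z = lin (h lo ∷ z ∷ lo ∷ []) (λ a b c → a ⊕ κ 1 ≼ b ⇒ c ≺ a ⇒ ⊢ c ≼ b) p lo<c
        lo<hz : lo < h z
        lo<hz = ℤₚ.≤∧≢⇒< (proj₁ (closed z lo≤z q)) lo≢hz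

    after-first : IntervalMatching h (h lo + + 1) hi
    after-first = record
      { closed      = λ z p q → (lin (h lo ∷ h z ∷ []) (λ a b → a ≺ b ⇒ ⊢ a ⊕ κ 1 ≼ b) (beyond z p q)) , proj₂
        (closed z (lin (h lo ∷ z ∷ lo ∷ []) (λ a b c → a ⊕ κ 1 ≼ b ⇒ c ≺ a ⇒ ⊢ c ≼ b) p lo<c) q)
      ; involutive  = λ z p q → involutive z (lin (h lo ∷ z ∷ lo ∷ []) (λ a b c → a ⊕ κ 1 ≼ b ⇒ c ≺ a ⇒ ⊢ c ≼ b) p
        lo<c) q
      ; irreflexive = λ z p q → irreflexive z (lin (h lo ∷ z ∷ lo ∷ []) (λ a b c → a ⊕ κ 1 ≼ b ⇒ c ≺ a ⇒ ⊢ c ≼ b) p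
        lo<c) q
      ; nested      = λ x y p q → nested x y (lin (h lo ∷ x ∷ lo ∷ []) (λ a b c → a ⊕ κ 1 ≼ b ⇒ c ≺ a ⇒ ⊢ c ≼ b) p
        lo<c) q
      }

    first-bounds : lo < h lo × h lo < hi × h (h lo) ≡ lo
    first-bounds = lo<c , proj₂ c-in , hc

  -- The fuel bounds the length of the interval, and both parts that the first arc splits off are
  -- shorter. Besides the tree, this shows that every invariant interval has even length, which
  -- later rules out diameters.
  decompose : ∀ fuel {h lo hi} → lo ≤ hi → hi ≤ lo + + fuel → IntervalMatching h lo hi →
    ∃ (Decomposes h lo hi)
  decompose fuel {h} {lo} {hi} lo≤hi hi≤ M with lo ≟ hi
  ... | yes lo≡hi = leaf , trans (ℤₚ.+-identityʳ lo) lo≡hi , λ z lo≤z z<hi → ⊥-elim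
    (lin (lo ∷ hi ∷ z ∷ []) (λ a b c → a ≐ b ⇒ a ≼ c ⇒ c ≺ b ⇒ ⊢⊥) lo≡hi lo≤z z<hi)
  decompose zero {h} {lo} {hi} lo≤hi hi≤ M | no lo≢hi =
    ⊥-elim (lo≢hi (lin (lo ∷ hi ∷ []) (λ a b → a ≼ b ⇒ b ≼ a ⊕ κ 0 ⇒ ⊢ a ≐ b) lo≤hi hi≤))
  decompose (suc fuel) {h} {lo} {hi} lo≤hi hi≤ M | no lo≢hi =
    let lo<hi = ℤₚ.≤∧≢⇒< lo≤hi lo≢hi
        p , q , hc = first-bounds M lo<hi
        l , inside = decompose fuel {h} {lo + + 1} {h lo} (lin (lo ∷ h lo ∷ []) (λ a b → a ≺ b ⇒ ⊢ a ⊕ κ 1 ≼ b) p)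
          (lin (h lo ∷ hi ∷ lo ∷ + suc fuel ∷ + fuel ∷ [])
          (λ a b c d e → a ≺ b ⇒ b ≼ c ⊕ d ⇒ d ≐ e ⊕ κ 1 ⇒ ⊢ a ≼ c ⊕ κ 1 ⊕ e) q hi≤ (pos-suc fuel))
          (inside-first M lo<hi)
        r , after  = decompose fuel {h} {h lo + + 1} {hi} (lin (h lo ∷ hi ∷ []) (λ a b → a ≺ b ⇒ ⊢ a ⊕ κ 1 ≼ b) q)
          (lin (lo ∷ h lo ∷ hi ∷ + suc fuel ∷ + fuel ∷ [])
          (λ a b c d e → a ≺ b ⇒ c ≼ a ⊕ d ⇒ d ≐ e ⊕ κ 1 ⇒ ⊢ c ≼ b ⊕ κ 1 ⊕ e) p hi≤ (pos-suc fuel))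
          (after-first M lo<hi)
    in node l r , decomposes-node refl hc inside after

  -- The partner of the left end reveals the width of the left subtree. Once these widths agree,
  -- both subtrees occupy the same intervals and the induction applies to each.
  partner-injective : ∀ t t′ o → width t ≡ width t′ →
    (∀ z → o ≤ z → z < o + width t → partner t o z ≡ partner t′ o z) → t ≡ t′
  partner-injective leaf       leaf       o _ _ = refl
  partner-injective leaf       (node l r) o w _ =
    ⊥-elim (lin (width l ∷ width r ∷ []) (λ a b → κ 0 ≐ a ⊕ b ⊕ κ 2 ⇒ κ 0 ≼ a ⇒ κ 0 ≼ b ⇒ ⊢⊥) w (width≥0 l)
    (width≥0 r))
  partner-injective (node l r) leaf       o w _ =
    ⊥-elim (lin (width l ∷ width r ∷ []) (λ a b → a ⊕ b ⊕ κ 2 ≐ κ 0 ⇒ κ 0 ≼ a ⇒ κ 0 ≼ b ⇒ ⊢⊥) w (width≥0 l)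
    (width≥0 r))
  partner-injective (node l r) (node l′ r′) o w agree = cong₂ node l≡ r≡
    where
    0≤l = width≥0 l
    0≤r = width≥0 r
    first : partner (node l r) o o ≡ partner (node l′ r′) o o
    first = agree o ℤₚ.≤-refl
      (lin (width l ∷ width r ∷ o ∷ []) (λ a b c → κ 0 ≼ a ⇒ κ 0 ≼ b ⇒ ⊢ c ≺ c ⊕ (a ⊕ b ⊕ κ 2)) 0≤l 0≤r)
    wl : width l ≡ width l′
    wl = lin (partner (node l r) o o ∷ partner (node l′ r′) o o ∷ o ∷ width l ∷ width l′ ∷ [])
      (λ a b c d e → a ≐ b ⇒ a ≐ c ⊕ κ 1 ⊕ d ⇒ b ≐ c ⊕ κ 1 ⊕ e ⇒ ⊢ d ≐ e) first (partner-open l r o)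
      (partner-open l′ r′ o)
    wr : width r ≡ width r′
    wr = lin (width l ∷ width l′ ∷ width r ∷ width r′ ∷ []) (λ a b c d → a ≐ b ⇒ a ⊕ c ⊕ κ 2 ≐ b ⊕ d ⊕ κ 2 ⇒ ⊢ c ≐ d)
      wl w
    l≡ : l ≡ l′
    l≡ = partner-injective l l′ (o + + 1) wl λ z p q →
      trans (sym (partner-inner l r o (lin (o ∷ z ∷ []) (λ a b → a ⊕ κ 1 ≼ b ⇒ ⊢ a ≺ b) p) q))
        (trans (agree z (lin (o ∷ z ∷ []) (λ a b → a ⊕ κ 1 ≼ b ⇒ ⊢ a ≼ b) p)
          (lin (z ∷ o ∷ width l ∷ width r ∷ []) (λ a b c d → a ≺ b ⊕ κ 1 ⊕ c ⇒ κ 0 ≼ d ⇒ ⊢ a ≺ b ⊕ (c ⊕ d ⊕ κ 2)) q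
          0≤r)) (partner-inner l′ r′ o (lin (o ∷ z ∷ []) (λ a b → a ⊕ κ 1 ≼ b ⇒ ⊢ a ≺ b) p)
          (lin (z ∷ o ∷ width l ∷ width l′ ∷ []) (λ a b c d → a ≺ b ⊕ κ 1 ⊕ c ⇒ c ≐ d ⇒ ⊢ a ≺ b ⊕ κ 1 ⊕ d) q wl)))
    r≡ : r ≡ r′
    r≡ = partner-injective r r′ (o + + 1 + width l + + 1) wr λ z p q →
      trans (sym (partner-outer l r o
        (lin (o ∷ width l ∷ z ∷ []) (λ a b c → a ⊕ κ 1 ⊕ b ⊕ κ 1 ≼ c ⇒ ⊢ a ⊕ κ 1 ⊕ b ≺ c) p)))
        (trans (agree z (lin (o ∷ width l ∷ z ∷ []) (λ a b c → a ⊕ κ 1 ⊕ b ⊕ κ 1 ≼ c ⇒ κ 0 ≼ b ⇒ ⊢ a ≼ c) p 0≤l)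
          (lin (z ∷ o ∷ width l ∷ width r ∷ []) (λ a b c d → a ≺ b ⊕ κ 1 ⊕ c ⊕ κ 1 ⊕ d ⇒ ⊢ a ≺ b ⊕ (c ⊕ d ⊕ κ 2)) q))
          (trans (partner-outer l′ r′ o
            (lin (o ∷ width l ∷ z ∷ width l′ ∷ []) (λ a b c d → a ⊕ κ 1 ⊕ b ⊕ κ 1 ≼ c ⇒ b ≐ d ⇒ ⊢ a ⊕ κ 1 ⊕ d ≺ c) p
            wl))
            (cong (λ u → partner r′ (o + + 1 + u + + 1) z) (sym wl))))

  partner-shift : ∀ t o k z → o ≤ z → z < o + width t → partner t (o + k) (z + k) ≡ partner t o z + k
  partner-shift leaf       o k z p q = ⊥-elim (lin (o ∷ z ∷ []) (λ a b → a ≼ b ⇒ b ≺ a ⊕ κ 0 ⇒ ⊢⊥) p q)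
  partner-shift (node l r) o k z p q with position l r o p
  ... | opens refl   = trans (partner-open l r (z + k)) (lin (partner (node l r) o o ∷ o ∷ width l ∷ k ∷ [])
    (λ a b c d → a ≐ b ⊕ κ 1 ⊕ c ⇒ ⊢ b ⊕ d ⊕ κ 1 ⊕ c ≐ a ⊕ d) (partner-open l r z))
  ... | closes refl  =
    trans (cong (partner (node l r) (o + k)) shift)
      (trans (partner-close l r (o + k)) (cong (_+ k) (sym (partner-close l r o))))
    where
    shift : o + + 1 + width l + k ≡ o + k + + 1 + width l
    shift = lin (o ∷ width l ∷ k ∷ []) (λ a b c → ⊢ a ⊕ κ 1 ⊕ b ⊕ c ≐ a ⊕ c ⊕ κ 1 ⊕ b)
  ... | inner p′ q′  =
    trans (partner-inner l r (o + k) (lin (o ∷ z ∷ k ∷ []) (λ a b c → a ≺ b ⇒ ⊢ a ⊕ c ≺ b ⊕ c) p′)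
      (lin (z ∷ o ∷ width l ∷ k ∷ []) (λ a b c d → a ≺ b ⊕ κ 1 ⊕ c ⇒ ⊢ a ⊕ d ≺ b ⊕ d ⊕ κ 1 ⊕ c) q′))
      (trans (cong (λ u → partner l u (z + k)) shift)
        (trans (partner-shift l (o + + 1) k z (lin (o ∷ z ∷ []) (λ a b → a ≺ b ⇒ ⊢ a ⊕ κ 1 ≼ b) p′) q′)
          (cong (_+ k) (sym (partner-inner l r o p′ q′)))))
    where
    shift : o + k + + 1 ≡ o + + 1 + k
    shift = lin (o ∷ k ∷ []) (λ a b → ⊢ a ⊕ b ⊕ κ 1 ≐ a ⊕ κ 1 ⊕ b)
  ... | outer p′     =
    trans (partner-outer l r (o + k)
      (lin (o ∷ width l ∷ z ∷ k ∷ []) (λ a b c d → a ⊕ κ 1 ⊕ b ≺ c ⇒ ⊢ a ⊕ d ⊕ κ 1 ⊕ b ≺ c ⊕ d) p′))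
      (trans (cong (λ u → partner r u (z + k)) shift)
        (trans (partner-shift r (o + + 1 + width l + + 1) k z
          (lin (o ∷ width l ∷ z ∷ []) (λ a b c → a ⊕ κ 1 ⊕ b ≺ c ⇒ ⊢ a ⊕ κ 1 ⊕ b ⊕ κ 1 ≼ c) p′)
          (lin (z ∷ o ∷ width l ∷ width r ∷ []) (λ a b c d → a ≺ b ⊕ (c ⊕ d ⊕ κ 2) ⇒ ⊢ a ≺ b ⊕ κ 1 ⊕ c ⊕ κ 1 ⊕ d) q))
          (cong (_+ k) (sym (partner-outer l r o p′)))))
    where
    shift : o + k + + 1 + width l + + 1 ≡ o + + 1 + width l + + 1 + k
    shift = lin (o ∷ k ∷ width l ∷ []) (λ a b c → ⊢ a ⊕ b ⊕ κ 1 ⊕ c ⊕ κ 1 ≐ a ⊕ κ 1 ⊕ c ⊕ κ 1 ⊕ b)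

  -- Left ends of the arcs, in increasing order. They will serve as the labels of the matchings of a
  -- component other than its root.
  openings : Tree → ℤ → List ℤ
  openings leaf       o = []
  openings (node l r) o = o ∷ openings l (o + + 1) ++ openings r (o + + 1 + width l + + 1)

  length-openings : ∀ t o → length (openings t o) ≡ size t
  length-openings leaf       o = refl
  length-openings (node l r) o = cong suc (trans (length-++ (openings l _))
    (cong₂ ℕ._+_ (length-openings l _) (length-openings r _)))

  openings-sound : ∀ t o → All (λ a → o ≤ a × a < o + width t × a < partner t o a) (openings t o)
  openings-sound leaf       o = []
  openings-sound (node l r) o =
    (ℤₚ.≤-refl , (lin (width l ∷ width r ∷ o ∷ []) (λ a b c → κ 0 ≼ a ⇒ κ 0 ≼ b ⇒ ⊢ c ≺ c ⊕ (a ⊕ b ⊕ κ 2)) 0≤l 0≤r) ,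
      (lin (partner (node l r) o o ∷ o ∷ width l ∷ []) (λ a b c → a ≐ b ⊕ κ 1 ⊕ c ⇒ κ 0 ≼ c ⇒ ⊢ b ≺ a)
      (partner-open l r o) 0≤l)) ∷
    Allₚ.++⁺
      (All.map (λ {a} (p , q , s) → (lin (o ∷ a ∷ []) (λ a b → a ⊕ κ 1 ≼ b ⇒ ⊢ a ≼ b) p) ,
        (lin (a ∷ o ∷ width l ∷ width r ∷ []) (λ a b c d → a ≺ b ⊕ κ 1 ⊕ c ⇒ κ 0 ≼ d ⇒ ⊢ a ≺ b ⊕ (c ⊕ d ⊕ κ 2)) q 0≤r)
        , (lin (a ∷ partner l (o + + 1) a ∷ partner (node l r) o a ∷ []) (λ a b c → a ≺ b ⇒ c ≐ b ⇒ ⊢ a ≺ c) s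
        (partner-inner l r o {a} (lin (o ∷ a ∷ []) (λ a b → a ⊕ κ 1 ≼ b ⇒ ⊢ a ≺ b) p) q)))
        (openings-sound l (o + + 1)))
      (All.map (λ {a} (p , q , s) → (lin (o ∷ width l ∷ a ∷ []) (λ a b c → a ⊕ κ 1 ⊕ b ⊕ κ 1 ≼ c ⇒ κ 0 ≼ b ⇒ ⊢ a ≼ c)
        p 0≤l) , (lin (a ∷ o ∷ width l ∷ width r ∷ [])
        (λ a b c d → a ≺ b ⊕ κ 1 ⊕ c ⊕ κ 1 ⊕ d ⇒ ⊢ a ≺ b ⊕ (c ⊕ d ⊕ κ 2)) q) ,
        (lin (a ∷ partner r (o + + 1 + width l + + 1) a ∷ partner (node l r) o a ∷ [])
        (λ a b c → a ≺ b ⇒ c ≐ b ⇒ ⊢ a ≺ c) s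
        (partner-outer l r o {a} (lin (o ∷ width l ∷ a ∷ []) (λ a b c → a ⊕ κ 1 ⊕ b ⊕ κ 1 ≼ c ⇒ ⊢ a ⊕ κ 1 ⊕ b ≺ c)
        p)))) (openings-sound r (o + + 1 + width l + + 1)))
    where
    0≤l = width≥0 l
    0≤r = width≥0 r

  openings-complete : ∀ t o a → o ≤ a → a < o + width t → a < partner t o a → a ∈ openings t o
  openings-complete leaf       o a p q s = ⊥-elim (lin (o ∷ a ∷ []) (λ a b → a ≼ b ⇒ b ≺ a ⊕ κ 0 ⇒ ⊢⊥) p q)
  openings-complete (node l r) o a p q s with position l r o p
  ... | opens a≡o   = here a≡o
  ... | closes refl = ⊥-elim (lin (o ∷ width l ∷ partner (node l r) o (o + + 1 + width l) ∷ [])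
    (λ a b c → a ⊕ κ 1 ⊕ b ≺ c ⇒ c ≐ a ⇒ κ 0 ≼ b ⇒ ⊢⊥) s (partner-close l r o) (width≥0 l))
  ... | inner p′ q′ = there
    (∈-++⁺ˡ (openings-complete l (o + + 1) a (lin (o ∷ a ∷ []) (λ a b → a ≺ b ⇒ ⊢ a ⊕ κ 1 ≼ b) p′) q′
    (lin (a ∷ partner (node l r) o a ∷ partner l (o + + 1) a ∷ []) (λ a b c → a ≺ b ⇒ b ≐ c ⇒ ⊢ a ≺ c) s
    (partner-inner l r o p′ q′))))
  ... | outer p′    = there
    (∈-++⁺ʳ _ (openings-complete r (o + + 1 + width l + + 1) a
    (lin (o ∷ width l ∷ a ∷ []) (λ a b c → a ⊕ κ 1 ⊕ b ≺ c ⇒ ⊢ a ⊕ κ 1 ⊕ b ⊕ κ 1 ≼ c) p′)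
    (lin (a ∷ o ∷ width l ∷ width r ∷ []) (λ a b c d → a ≺ b ⊕ (c ⊕ d ⊕ κ 2) ⇒ ⊢ a ≺ b ⊕ κ 1 ⊕ c ⊕ κ 1 ⊕ d) q)
    (lin (a ∷ partner (node l r) o a ∷ partner r (o + + 1 + width l + + 1) a ∷ []) (λ a b c → a ≺ b ⇒ b ≐ c ⇒ ⊢ a ≺ c)
    s (partner-outer l r o p′))))

  openings-sorted : ∀ t o → AllPairs _<_ (openings t o)
  openings-sorted leaf       o = []
  openings-sorted (node l r) o =
    Allₚ.++⁺ (All.map left (openings-sound l (o + + 1)))
             (All.map right (openings-sound r (o + + 1 + width l + + 1)))
    ∷ AllPairsₚ.++⁺ (openings-sorted l _) (openings-sorted r _)
        (All.map (λ s → All.map (across s) (openings-sound r (o + + 1 + width l + + 1)))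
          (openings-sound l (o + + 1)))
    where
    left : ∀ {a} → o + + 1 ≤ a × a < o + + 1 + width l × a < partner l (o + + 1) a → o < a
    left {a} (p , _) = lin (o ∷ a ∷ []) (λ a b → a ⊕ κ 1 ≼ b ⇒ ⊢ a ≺ b) p
    right : ∀ {b w q} → o + + 1 + width l + + 1 ≤ b × b < w × b < q → o < b
    right {b} (p , _) = lin (o ∷ width l ∷ b ∷ []) (λ a b c → a ⊕ κ 1 ⊕ b ⊕ κ 1 ≼ c ⇒ κ 0 ≼ b ⇒ ⊢ a ≺ c) p (width≥0 l)
    across : ∀ {a b u w q q′} → u ≤ a × a < o + + 1 + width l × a < q →
      o + + 1 + width l + + 1 ≤ b × b < w × b < q′ → a < b
    across {a} {b} (_ , q , _) (p , _) = lin (a ∷ o ∷ width l ∷ b ∷ [])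
      (λ a b c d → a ≺ b ⊕ κ 1 ⊕ c ⇒ b ⊕ κ 1 ⊕ c ⊕ κ 1 ≼ d ⇒ ⊢ a ≺ d) q p

  -- Counting trees through ballot numbers

  total : ∀ {k} → Vec Tree k → ℕ
  total []       = 0
  total (t ∷ ts) = size t ℕ.+ total ts

  graft : ∀ {k} → Vec Tree (2 ℕ.+ k) → Vec Tree (suc k)
  graft (l ∷ r ∷ ts) = node l r ∷ ts

  graft-injective : ∀ {k} {ts us : Vec Tree (2 ℕ.+ k)} → graft ts ≡ graft us → ts ≡ us
  graft-injective {ts = _ ∷ _ ∷ _} {_ ∷ _ ∷ _} refl = refl

  -- For single trees, splitting the size between two subtrees gives a convolution. Sequences of k
  -- trees with u nodes in total obey a recurrence with two terms, of the kind of Pascal's rule: the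
  -- first tree is a leaf and is dropped, or it is a node and is replaced by its two subtrees.
  forests : (u k : ℕ) → List (Vec Tree k)
  forests zero    zero    = [ [] ]
  forests (suc u) zero    = []
  forests zero    (suc k) = map (leaf ∷_) (forests zero k)
  forests (suc u) (suc k) = map (leaf ∷_) (forests (suc u) k) ++ map graft (forests u (2 ℕ.+ k))

  total-graft : ∀ {k} (ts : Vec Tree (2 ℕ.+ k)) → total (graft ts) ≡ suc (total ts)
  total-graft (l ∷ r ∷ ts) = cong suc (ℕₚ.+-assoc (size l) (size r) (total ts))

  forests-sound : ∀ u k {ts} → ts ∈ forests u k → total ts ≡ u
  forests-sound zero    zero    (here refl) = refl
  forests-sound zero    (suc k) ts∈ =
    let us , us∈ , eq = ∈-map⁻ (leaf ∷_) ts∈ in trans (cong total eq) (forests-sound zero k us∈)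
  forests-sound (suc u) (suc k) ts∈ =
    [ (λ ts∈ → let us , us∈ , eq = ∈-map⁻ (leaf ∷_) ts∈ in trans (cong total eq) (forests-sound (suc u) k us∈))
    , (λ ts∈ → let us , us∈ , eq = ∈-map⁻ graft ts∈
               in trans (cong total eq) (trans (total-graft us) (cong suc (forests-sound u (2 ℕ.+ k) us∈))))
    ]′ (∈-++⁻ (map (leaf ∷_) (forests (suc u) k)) ts∈)

  forests-complete : ∀ u {k} (ts : Vec Tree k) → total ts ≡ u → ts ∈ forests u k
  forests-complete zero    []                eq = here refl
  forests-complete zero    (leaf ∷ ts)       eq = ∈-map⁺ (leaf ∷_) (forests-complete zero ts eq)
  forests-complete (suc u) (leaf ∷ ts)       eq = ∈-++⁺ˡ (∈-map⁺ (leaf ∷_) (forests-complete (suc u) ts eq))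
  forests-complete (suc u) (node l r ∷ ts)   eq = ∈-++⁺ʳ _ (∈-map⁺ graft (forests-complete u (l ∷ r ∷ ts)
    (trans (sym (ℕₚ.+-assoc (size l) (size r) (total ts))) (ℕₚ.suc-injective eq))))

  forests-unique : ∀ u k → Unique (forests u k)
  forests-unique zero    zero    = [] ∷ []
  forests-unique (suc u) zero    = []
  forests-unique zero    (suc k) = Uniqueₚ.map⁺ (λ { refl → refl }) (forests-unique zero k)
  forests-unique (suc u) (suc k) = Uniqueₚ.++⁺
    (Uniqueₚ.map⁺ (λ { refl → refl }) (forests-unique (suc u) k))
    (Uniqueₚ.map⁺ graft-injective (forests-unique u (2 ℕ.+ k)))
    λ (p , q) → leaf≢graft (proj₂ (proj₂ (∈-map⁻ (leaf ∷_) p))) (proj₂ (proj₂ (∈-map⁻ graft q)))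
    where
    leaf≢graft : ∀ {k} {ts : Vec Tree (suc k)} {us us′} → ts ≡ leaf ∷ us → ts ≡ graft us′ → ⊥
    leaf≢graft {us′ = _ ∷ _ ∷ _} refl ()

  nC0≡1 : ∀ n → n C 0 ≡ 1
  nC0≡1 n = trans (nCk≡nC[n∸k] {0} {n} ℕ.z≤n) (nCn≡1 n)

  pascal : ∀ n k → suc n C suc k ≡ n C k ℕ.+ n C suc k
  pascal n k = sym (nCk+nC[k+1]≡[n+1]C[k+1] n k)

  middle-symmetric : ∀ u → (u ℕ.+ u ℕ.+ 1) C u ≡ (u ℕ.+ u ℕ.+ 1) C suc u
  middle-symmetric u = trans (nCk≡nC[n∸k] (ℕₚ.≤-trans (ℕₚ.m≤m+n u u) (ℕₚ.m≤m+n _ 1)))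
    (cong ((u ℕ.+ u ℕ.+ 1) C_) (trans (cong (ℕ._∸ u) (arrange u)) (ℕₚ.m+n∸m≡n u (suc u))))
    where
    arrange : ∀ u → u ℕ.+ u ℕ.+ 1 ≡ u ℕ.+ suc u
    arrange = ℕ-Ring.solve-∀

  -- The ballot numbers, with the subtraction moved to the other side.
  length-forests : ∀ u k → length (forests (suc u) k) ℕ.+ (u ℕ.+ u ℕ.+ 1 ℕ.+ k) C u ≡ (u ℕ.+ u ℕ.+ 1 ℕ.+ k) C suc u
  length-forests u zero = subst (λ n → n C u ≡ n C suc u) (sym (ℕₚ.+-identityʳ _)) (middle-symmetric u)
  length-forests u (suc k) = goal
    where
    open ≡-Reasoning
    n = u ℕ.+ u ℕ.+ 1 ℕ.+ k
    -- The induction hypothesis for u - 1 and k + 2 has the same upper index 2u + 1 + k; Pascal's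
    -- rule brings it into this form.
    second : ∀ u → length (forests u (2 ℕ.+ k)) ℕ.+ suc (u ℕ.+ u ℕ.+ 1 ℕ.+ k) C u ≡ (u ℕ.+ u ℕ.+ 1 ℕ.+ k) C u ℕ.+
      (u ℕ.+ u ℕ.+ 1 ℕ.+ k) C u
    second zero    = trans (cong₂ ℕ._+_ (leaves (2 ℕ.+ k)) (nC0≡1 (suc (suc k))))
      (sym (cong₂ ℕ._+_ (nC0≡1 (suc k)) (nC0≡1 (suc k))))
      where
      leaves : ∀ k → length (forests zero k) ≡ 1
      leaves zero    = refl
      leaves (suc k) = trans (length-map (leaf ∷_) (forests zero k)) (leaves k)
    second (suc u) = begin
      L ℕ.+ suc M C suc u             ≡⟨ cong (L ℕ.+_) (pascal M u) ⟩
      L ℕ.+ (M C u ℕ.+ M C suc u)     ≡⟨ sym (ℕₚ.+-assoc L _ _) ⟩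
      L ℕ.+ M C u ℕ.+ M C suc u       ≡⟨ cong (ℕ._+ M C suc u) (subst (λ x → L ℕ.+ x C u ≡ x C suc u) (arrange u k)
        (length-forests u (2 ℕ.+ k))) ⟩
      M C suc u ℕ.+ M C suc u         ∎
      where
      L = length (forests (suc u) (2 ℕ.+ k))
      M = suc u ℕ.+ suc u ℕ.+ 1 ℕ.+ k
      arrange : ∀ u k → u ℕ.+ u ℕ.+ 1 ℕ.+ suc (suc k) ≡ suc u ℕ.+ suc u ℕ.+ 1 ℕ.+ k
      arrange = ℕ-Ring.solve-∀
    L₁ = length (forests (suc u) k)
    L₂ = length (forests u (2 ℕ.+ k))
    goal : length (forests (suc u) (suc k)) ℕ.+ (u ℕ.+ u ℕ.+ 1 ℕ.+ suc k) C u ≡ (u ℕ.+ u ℕ.+ 1 ℕ.+ suc k) C suc u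
    goal = begin
      length (forests (suc u) (suc k)) ℕ.+ (u ℕ.+ u ℕ.+ 1 ℕ.+ suc k) C u
        ≡⟨ cong₂ (λ x y → x ℕ.+ y C u) (trans (length-++ (map (leaf ∷_) (forests (suc u) k)))
             (cong₂ ℕ._+_ (length-map (leaf ∷_) (forests (suc u) k)) (length-map graft (forests u (2 ℕ.+ k)))))
               (ℕₚ.+-suc (u ℕ.+ u ℕ.+ 1) k) ⟩
      L₁ ℕ.+ L₂ ℕ.+ suc n C u          ≡⟨ ℕₚ.+-assoc L₁ L₂ _ ⟩
      L₁ ℕ.+ (L₂ ℕ.+ suc n C u)        ≡⟨ cong (L₁ ℕ.+_) (second u) ⟩
      L₁ ℕ.+ (n C u ℕ.+ n C u)         ≡⟨ sym (ℕₚ.+-assoc L₁ _ _) ⟩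
      L₁ ℕ.+ n C u ℕ.+ n C u           ≡⟨ cong (ℕ._+ n C u) (length-forests u k) ⟩
      n C suc u ℕ.+ n C u              ≡⟨ ℕₚ.+-comm (n C suc u) (n C u) ⟩
      n C u ℕ.+ n C suc u              ≡⟨ sym (pascal n u) ⟩
      suc n C suc u                    ≡⟨ cong (_C suc u) (sym (ℕₚ.+-suc (u ℕ.+ u ℕ.+ 1) k)) ⟩
      (u ℕ.+ u ℕ.+ 1 ℕ.+ suc k) C suc u ∎

  absorption : ∀ n k → suc k ℕ.* (suc n C suc k) ≡ suc n ℕ.* (n C k)
  absorption zero    zero    = refl
  absorption zero    (suc k) = ℕₚ.*-zeroʳ (suc (suc k))
  absorption (suc n) zero    = trans (ℕₚ.*-identityˡ _) (trans (nC1≡n (suc (suc n)))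
    (sym (trans (cong (suc (suc n) ℕ.*_) (nC0≡1 (suc n))) (ℕₚ.*-identityʳ _))))
  absorption (suc n) (suc k) = begin
    suc (suc k) ℕ.* (suc (suc n) C suc (suc k))             ≡⟨ cong (suc (suc k) ℕ.*_) (pascal (suc n) (suc k)) ⟩
    suc (suc k) ℕ.* (X ℕ.+ suc n C suc (suc k))             ≡⟨ distribute (suc k) X _ ⟩
    X ℕ.+ suc k ℕ.* X ℕ.+ suc (suc k) ℕ.* (suc n C suc (suc k)) ≡⟨ cong₂ (λ p q → X ℕ.+ p ℕ.+ q) (absorption n k)
      (absorption n (suc k)) ⟩
    X ℕ.+ suc n ℕ.* (n C k) ℕ.+ suc n ℕ.* (n C suc k)       ≡⟨ collect X (suc n) (n C k) (n C suc k) ⟩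
    X ℕ.+ suc n ℕ.* (n C k ℕ.+ n C suc k)                   ≡⟨ cong (λ p → X ℕ.+ suc n ℕ.* p) (sym (pascal n k)) ⟩
    suc (suc n) ℕ.* X                                       ∎
    where
    open ≡-Reasoning
    X = suc n C suc k
    distribute : ∀ k a b → suc k ℕ.* (a ℕ.+ b) ≡ a ℕ.+ k ℕ.* a ℕ.+ suc k ℕ.* b
    distribute = ℕ-Ring.solve-∀
    collect : ∀ x n a b → x ℕ.+ n ℕ.* a ℕ.+ n ℕ.* b ≡ x ℕ.+ n ℕ.* (a ℕ.+ b)
    collect = ℕ-Ring.solve-∀

  trees : ℕ → List Tree
  trees m = map head (forests m 1)

  trees-sound : ∀ m {t} → t ∈ trees m → size t ≡ m
  trees-sound m t∈ with ∈-map⁻ head t∈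
  ... | t ∷ [] , ts∈ , refl = trans (sym (ℕₚ.+-identityʳ (size t))) (forests-sound m 1 ts∈)

  trees-complete : ∀ t → t ∈ trees (size t)
  trees-complete t = ∈-map⁺ head (forests-complete (size t) (t ∷ []) (ℕₚ.+-identityʳ (size t)))

  trees-unique : ∀ m → Unique (trees m)
  trees-unique m = Uniqueₚ.map⁺ (λ { {_ ∷ []} {_ ∷ []} refl → refl }) (forests-unique m 1)

  -- For m > 0 the ballot formula with one tree gives the difference of the binomials of 2m over m
  -- and over m - 1. These are in the ratio m + 1 to m, so multiplication by m + 1 leaves a single
  -- central binomial coefficient and avoids division.
  length-trees : ∀ m → suc m ℕ.* length (trees m) ≡ (2 ℕ.* m) C m
  length-trees zero    = refl
  length-trees (suc u) = ℕₚ.+-cancelʳ-≡ (suc u ℕ.* X) _ _ (begin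
    suc (suc u) ℕ.* length (trees (suc u)) ℕ.+ suc u ℕ.* X  ≡⟨ cong₂ (λ l x → suc (suc u) ℕ.* l ℕ.+ x)
      (length-map head (forests (suc u) 1)) (sym ratio) ⟩
    suc (suc u) ℕ.* L ℕ.+ suc (suc u) ℕ.* (suc n C u)       ≡⟨ sym (ℕₚ.*-distribˡ-+ (suc (suc u)) L _) ⟩
    suc (suc u) ℕ.* (L ℕ.+ suc n C u)                       ≡⟨ cong (suc (suc u) ℕ.*_)
      (subst (λ x → L ℕ.+ x C u ≡ x C suc u) (ℕₚ.+-comm n 1) (length-forests u 1)) ⟩
    X ℕ.+ suc u ℕ.* X                                       ≡⟨ cong (λ x → x C suc u ℕ.+ suc u ℕ.* X) (double u) ⟩
    (2 ℕ.* suc u) C suc u ℕ.+ suc u ℕ.* X                   ∎)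
    where
    open ≡-Reasoning
    n = u ℕ.+ u ℕ.+ 1
    X = suc n C suc u
    L = length (forests (suc u) 1)
    double : ∀ u → suc (u ℕ.+ u ℕ.+ 1) ≡ 2 ℕ.* suc u
    double = ℕ-Ring.solve-∀
    split : ∀ u → suc (u ℕ.+ u ℕ.+ 1) ≡ u ℕ.+ suc (suc u)
    split = ℕ-Ring.solve-∀
    ratio : suc (suc u) ℕ.* (suc n C u) ≡ suc u ℕ.* X
    ratio = begin
      suc (suc u) ℕ.* (suc n C u)             ≡⟨ cong (suc (suc u) ℕ.*_)
        (trans (nCk≡nC[n∸k] (subst (u ℕ.≤_) (sym (split u)) (ℕₚ.m≤m+n u _)))
                                                   (cong (suc n C_) (trans (cong (ℕ._∸ u) (split u))
                                                     (ℕₚ.m+n∸m≡n u (suc (suc u)))))) ⟩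
      suc (suc u) ℕ.* (suc n C suc (suc u))   ≡⟨ absorption n (suc u) ⟩
      suc n ℕ.* (n C suc u)                   ≡⟨ cong (suc n ℕ.*_) (sym (middle-symmetric u)) ⟩
      suc n ℕ.* (n C u)                       ≡⟨ sym (absorption n u) ⟩
      suc u ℕ.* X                             ∎

  -- Juxtaposition of two matchings. A tree of width n joined with itself will give a centrally
  -- symmetric matching of all 2n points.
  join : Tree → Tree → Tree
  join leaf       s = s
  join (node l r) s = node l (join r s)

  width-join : ∀ t s → width (join t s) ≡ width t + width s
  width-join leaf       s = sym (ℤₚ.+-identityˡ (width s))
  width-join (node l r) s = lin (width (join r s) ∷ width r ∷ width s ∷ width l ∷ [])
    (λ a b c d → a ≐ b ⊕ c ⇒ ⊢ d ⊕ a ⊕ κ 2 ≐ d ⊕ b ⊕ κ 2 ⊕ c) (width-join r s)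

  partner-joinˡ : ∀ t s o z → o ≤ z → z < o + width t → partner (join t s) o z ≡ partner t o z
  partner-joinˡ leaf       s o z p q = ⊥-elim (lin (o ∷ z ∷ []) (λ a b → a ≼ b ⇒ b ≺ a ⊕ κ 0 ⇒ ⊢⊥) p q)
  partner-joinˡ (node l r) s o z p q with position l r o p
  ... | opens refl   = trans (partner-open l (join r s) z) (sym (partner-open l r z))
  ... | closes refl  = trans (partner-close l (join r s) o) (sym (partner-close l r o))
  ... | inner p′ q′  = trans (partner-inner l (join r s) o p′ q′) (sym (partner-inner l r o p′ q′))
  ... | outer p′     = trans (partner-outer l (join r s) o p′)
    (trans (partner-joinˡ r s (o + + 1 + width l + + 1) z
      (lin (o ∷ width l ∷ z ∷ []) (λ a b c → a ⊕ κ 1 ⊕ b ≺ c ⇒ ⊢ a ⊕ κ 1 ⊕ b ⊕ κ 1 ≼ c) p′)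
      (lin (z ∷ o ∷ width l ∷ width r ∷ []) (λ a b c d → a ≺ b ⊕ (c ⊕ d ⊕ κ 2) ⇒ ⊢ a ≺ b ⊕ κ 1 ⊕ c ⊕ κ 1 ⊕ d) q))
      (sym (partner-outer l r o p′)))

  partner-joinʳ : ∀ t s o z → o + width t ≤ z → partner (join t s) o z ≡ partner s (o + width t) z
  partner-joinʳ leaf       s o z p = cong (λ u → partner s u z) (sym (ℤₚ.+-identityʳ o))
  partner-joinʳ (node l r) s o z p =
    trans (partner-outer l (join r s) o
      (lin (o ∷ width l ∷ width r ∷ z ∷ []) (λ a b c d → a ⊕ (b ⊕ c ⊕ κ 2) ≼ d ⇒ κ 0 ≼ c ⇒ ⊢ a ⊕ κ 1 ⊕ b ≺ d) p
      (width≥0 r)))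
      (trans (partner-joinʳ r s (o + + 1 + width l + + 1) z
        (lin (o ∷ width l ∷ width r ∷ z ∷ []) (λ a b c d → a ⊕ (b ⊕ c ⊕ κ 2) ≼ d ⇒ ⊢ a ⊕ κ 1 ⊕ b ⊕ κ 1 ⊕ c ≼ d) p))
        (cong (λ u → partner s u z) shift))
    where
    shift : o + + 1 + width l + + 1 + width r ≡ o + (width l + width r + + 2)
    shift = lin (o ∷ width l ∷ width r ∷ []) (λ a b c → ⊢ a ⊕ κ 1 ⊕ b ⊕ κ 1 ⊕ c ≐ a ⊕ (b ⊕ c ⊕ κ 2))

-- Separation by chords in terms of the order on ℤ, and two arithmetic facts

module Crossings where
  open Linear using (lin; _≺_; ⊢_; _⇒_)
  open import Data.Integer using (-[1+_]; -1ℤ; _<_; +<+; -<-)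

  Btw⁺ : ∀ {a b x} → (+ a < + x × + x < + b) ⊎ (+ b < + x × + x < + a) → Btw a b x
  Btw⁺ {a} {b} (inj₁ (+<+ a<x , +<+ x<b)) = ℕₚ.≤-<-trans (ℕₚ.m⊓n≤m a b) a<x , ℕₚ.<-≤-trans x<b (ℕₚ.m≤n⊔m a b)
  Btw⁺ {a} {b} (inj₂ (+<+ b<x , +<+ x<a)) = ℕₚ.≤-<-trans (ℕₚ.m⊓n≤n a b) b<x , ℕₚ.<-≤-trans x<a (ℕₚ.m≤m⊔n a b)

  Btw⁻ : ∀ {a b x} → Btw a b x → (+ a < + x × + x < + b) ⊎ (+ b < + x × + x < + a)
  Btw⁻ {a} {b} (p , q) with ℕₚ.≤-total a b
  ... | inj₁ a≤b = inj₁ (+<+ (subst (ℕ._< _) (ℕₚ.m≤n⇒m⊓n≡m a≤b) p) , +<+ (subst (_ ℕ.<_) (ℕₚ.m≤n⇒m⊔n≡n a≤b) q))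
  ... | inj₂ b≤a = inj₂ (+<+ (subst (ℕ._< _) (ℕₚ.m≥n⇒m⊓n≡n b≤a) p) , +<+ (subst (_ ℕ.<_) (ℕₚ.m≥n⇒m⊔n≡m b≤a) q))

  Out⁺ : ∀ {a b x} → (+ x < + a × + x < + b) ⊎ (+ a < + x × + b < + x) → Out a b x
  Out⁺ (inj₁ (+<+ x<a , +<+ x<b)) = inj₁ (ℕₚ.⊓-pres-m< x<a x<b)
  Out⁺ (inj₂ (+<+ a<x , +<+ b<x)) = inj₂ (ℕₚ.⊔-pres-<m a<x b<x)

  Out⁻ : ∀ {a b x} → Out a b x → (+ x < + a × + x < + b) ⊎ (+ a < + x × + b < + x)
  Out⁻ {a} {b} (inj₁ x<) = inj₁ (+<+ (ℕₚ.<-≤-trans x< (ℕₚ.m⊓n≤m a b)) , +<+ (ℕₚ.<-≤-trans x< (ℕₚ.m⊓n≤n a b)))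
  Out⁻ {a} {b} (inj₂ <x) = inj₂ (+<+ (ℕₚ.≤-<-trans (ℕₚ.m≤m⊔n a b) <x) , +<+ (ℕₚ.≤-<-trans (ℕₚ.m≤n⊔m a b) <x))

  Cross-sym : ∀ {a b c d} → Cross a b c d → Cross c d a b
  Cross-sym {a} {b} {c} {d} (inj₁ (p , q)) with Btw⁻ {a} {b} {c} p | Out⁻ {a} {b} {d} q
  ... | inj₁ p | inj₁ q = inj₁ (Btw⁺ {c} {d} {a} (inj₂ ((proj₁ q) , (proj₁ p))) , Out⁺ {c} {d} {b}
    (inj₂ ((proj₂ p) , (proj₂ q))))
  ... | inj₁ p | inj₂ q = inj₂ (Out⁺ {c} {d} {a} (inj₁ ((proj₁ p) , (proj₁ q))) , Btw⁺ {c} {d} {b}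
    (inj₁ ((proj₂ p) , (proj₂ q))))
  ... | inj₂ p | inj₁ q = inj₂ (Out⁺ {c} {d} {a} (inj₂ ((proj₂ p) , (proj₁ q))) , Btw⁺ {c} {d} {b}
    (inj₂ ((proj₂ q) , (proj₁ p))))
  ... | inj₂ p | inj₂ q = inj₁ (Btw⁺ {c} {d} {a} (inj₁ ((proj₂ p) , (proj₁ q))) , Out⁺ {c} {d} {b}
    (inj₁ ((proj₁ p) , (proj₂ q))))
  Cross-sym {a} {b} {c} {d} (inj₂ (q , p)) with Btw⁻ {a} {b} {d} p | Out⁻ {a} {b} {c} q
  ... | inj₁ p | inj₁ q = inj₁ (Btw⁺ {c} {d} {a} (inj₁ ((proj₁ q) , (proj₁ p))) , Out⁺ {c} {d} {b}
    (inj₂ ((proj₂ q) , (proj₂ p))))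
  ... | inj₁ p | inj₂ q = inj₂ (Out⁺ {c} {d} {a} (inj₁ ((proj₁ q) , (proj₁ p))) , Btw⁺ {c} {d} {b}
    (inj₂ ((proj₂ p) , (proj₂ q))))
  ... | inj₂ p | inj₁ q = inj₂ (Out⁺ {c} {d} {a} (inj₂ ((proj₁ q) , (proj₂ p))) , Btw⁺ {c} {d} {b}
    (inj₁ ((proj₂ q) , (proj₁ p))))
  ... | inj₂ p | inj₂ q = inj₁ (Btw⁺ {c} {d} {a} (inj₂ ((proj₂ p) , (proj₁ q))) , Out⁺ {c} {d} {b}
    (inj₁ ((proj₂ q) , (proj₁ p))))

  Btw-swap : ∀ {a b x} → Btw a b x → Btw b a x
  Btw-swap {a} {b} {x} p = Btw⁺ {b} {a} {x} ([ inj₂ , inj₁ ]′ (Btw⁻ {a} {b} {x} p))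

  Out-swap : ∀ {a b x} → Out a b x → Out b a x
  Out-swap {a} {b} {x} p = Out⁺ {b} {a} {x} ([ (λ (q , s) → inj₁ (s , q)) , (λ (q , s) → inj₂ (s , q)) ]′
    (Out⁻ {a} {b} {x} p))

  odd≢even : ∀ s m → suc (s ℕ.+ s) ≢ m ℕ.+ m
  odd≢even zero    (suc m) eq with trans eq (ℕₚ.+-suc (suc m) m)
  ... | ()
  odd≢even (suc s) (suc m) eq = odd≢even s m (ℕₚ.suc-injective (ℕₚ.suc-injective
    (trans (cong suc (cong suc (sym (ℕₚ.+-suc s s)))) (trans eq (cong suc (ℕₚ.+-suc m m))))))

  zero-or-one : ∀ s → -1ℤ < s → s < + 2 → s ≡ + 0 ⊎ s ≡ + 1
  zero-or-one (+ 0) p q = inj₁ refl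
  zero-or-one (+ 1) p q = inj₂ refl
  zero-or-one (+ suc (suc k)) p (+<+ (s≤s (s≤s ())))
  zero-or-one -[1+ k ] (-<- ()) q

-- H is a variable rather than + n so that H + H does not compute.
module Matchings (n m : ℕ) (n≡m+m : n ≡ m ℕ.+ m) (1≤m : 1 ℕ.≤ m) (H : ℤ) (H≡n : H ≡ + n) where
  open Linear using (lin; κ; _⊕_; _⊖_; _≼_; _≺_; _≐_; ⊢_; ⊢⊥; _⇒_)
  open IntervalMatchings
  open Crossings
  open import Data.Fin using (zero; suc; toℕ; fromℕ<; funToFin; finToFun) renaming (_≟_ to _≟ᶠ_)
  open import Data.Fin.Properties
    using (¬∀⟶∃¬; finToFun-funToFin; injective⇒≤; toℕ-injective; toℕ<n; toℕ-fromℕ<)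
  open import Data.Integer
    using (-1ℤ; -_; _+_; _-_; _*_; _≤_; _<_; _≟_; _<?_; _≤?_; +≤+; +<+; -<+; NonNegative)
  open import Data.Integer.DivMod using (_%ℕ_; _/ℕ_; n%ℕd<d; a≡a%ℕn+[a/ℕn]*n)
  open import Data.Vec.Properties using (lookup∘tabulate; tabulate∘lookup; tabulate-cong; ≡-dec)

  -- Residues modulo 2n and their lifts

  private
    2n≡ : 2 ℕ.* n ≡ n ℕ.+ n
    2n≡ = cong (n ℕ.+_) (ℕₚ.+-identityʳ n)

    N≡ : + (2 ℕ.* n) ≡ H + H
    N≡ = trans (cong +_ 2n≡) (cong₂ _+_ (sym H≡n) (sym H≡n))

    1≤n : 1 ℕ.≤ n
    1≤n = subst (1 ℕ.≤_) (sym n≡m+m) (ℕₚ.≤-trans 1≤m (ℕₚ.m≤m+n m m))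

    instance
      2n-nonZero : ℕ.NonZero (2 ℕ.* n)
      2n-nonZero = ℕ.>-nonZero (ℕₚ.≤-trans 1≤n (ℕₚ.m≤m+n n _))

  0<H : + 0 < H
  0<H = subst (+ 0 <_) (sym H≡n) (+<+ 1≤n)

  private
    instance
      N-nonNeg : NonNegative (H + H)
      N-nonNeg = subst NonNegative N≡ _

  abstract
    r : Pt n → ℤ
    r i = + toℕ i

    0≤r : ∀ i → + 0 ≤ r i
    0≤r i = +≤+ z≤n

    r<N : ∀ i → r i < H + H
    r<N i = subst (r i <_) N≡ (+<+ (toℕ<n i))

    r-injective : ∀ {i j} → r i ≡ r j → i ≡ j
    r-injective eq = toℕ-injective (ℤₚ.+-injective eq)

    r-Btw⁺ : ∀ {i j k} → (r i < r k × r k < r j) ⊎ (r j < r k × r k < r i) → Btw (toℕ i) (toℕ j) (toℕ k)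
    r-Btw⁺ = Btw⁺

    r-Btw⁻ : ∀ {i j k} → Btw (toℕ i) (toℕ j) (toℕ k) → (r i < r k × r k < r j) ⊎ (r j < r k × r k < r i)
    r-Btw⁻ = Btw⁻

    r-Out⁺ : ∀ {i j k} → (r k < r i × r k < r j) ⊎ (r i < r k × r j < r k) → Out (toℕ i) (toℕ j) (toℕ k)
    r-Out⁺ = Out⁺

    r-Out⁻ : ∀ {i j k} → Out (toℕ i) (toℕ j) (toℕ k) → (r k < r i × r k < r j) ⊎ (r i < r k × r j < r k)
    r-Out⁻ = Out⁻

    r-InArc⁺ : ∀ {i j} → (r i ≤ r j × r j < r i + H) ⊎ (r i ≤ r j + (H + H) × r j + (H + H) < r i + H) → InArc n
      (toℕ i) (toℕ j)
    r-InArc⁺ {i} {j} (inj₁ (p , q)) = inj₁ (ℤₚ.drop‿+≤+ p , ℤₚ.drop‿+<+ (subst (λ h → r j < r i + h) H≡n q))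
    r-InArc⁺ {i} {j} (inj₂ (p , q)) = inj₂ (ℤₚ.drop‿+≤+ (subst (λ h → r i ≤ r j + h) (sym N≡) p) ,
      ℤₚ.drop‿+<+ (subst₂ (λ h h′ → r j + h < r i + h′) (sym N≡) H≡n q))

    r-InArc⁻ : ∀ {k j} → InArc n k (toℕ j) → (+ k ≤ r j × r j < + k + H) ⊎ (+ k ≤ r j + (H + H) × r j + (H + H) < + k
      + H)
    r-InArc⁻ {k} {j} (inj₁ (p , q)) = inj₁ (+≤+ p , subst (λ h → r j < + k + h) (sym H≡n) (+<+ q))
    r-InArc⁻ {k} {j} (inj₂ (p , q)) = inj₂ (subst (λ h → + k ≤ r j + h) N≡ (+≤+ p) ,
      subst₂ (λ h h′ → r j + h < + k + h′) N≡ (sym H≡n) (+<+ q))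

    r-Antipodal⁺ : ∀ {i j} → (r i + H ≡ r j) ⊎ (r j + H ≡ r i) → Antipodal n (toℕ i) (toℕ j)
    r-Antipodal⁺ {i} {j} (inj₁ e) = inj₁ (ℤₚ.+-injective (subst (λ h → r i + h ≡ r j) H≡n e))
    r-Antipodal⁺ {i} {j} (inj₂ e) = inj₂ (ℤₚ.+-injective (subst (λ h → r j + h ≡ r i) H≡n e))

    r-Antipodal⁻ : ∀ {i j} → Antipodal n (toℕ i) (toℕ j) → (r i + H ≡ r j) ⊎ (r j + H ≡ r i)
    r-Antipodal⁻ {i} {j} (inj₁ e) = inj₁ (subst (λ h → r i + h ≡ r j) (sym H≡n) (cong +_ e))
    r-Antipodal⁻ {i} {j} (inj₂ e) = inj₂ (subst (λ h → r j + h ≡ r i) (sym H≡n) (cong +_ e))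

  private
    s*N-bounds : ∀ s → + 0 < s * (H + H) + (H + H) → s * (H + H) < (H + H) + (H + H) → s ≡ + 0 ⊎ s ≡ + 1
    s*N-bounds s p q = zero-or-one s
      (ℤₚ.*-cancelʳ-<-nonNeg (H + H) (subst (_< s * (H + H)) (sym (ℤₚ.-1*i≡-i (H + H))) (neg-< p)))
      (ℤₚ.*-cancelʳ-<-nonNeg (H + H) (subst (s * (H + H) <_) (sym (double (H + H))) q))
      where
      double : ∀ x → + 2 * x ≡ x + x
      double = solve-∀
      neg-< : ∀ {x y} → + 0 < x + y → - y < x
      neg-< {x} {y} 0< = subst₂ _<_ (ℤₚ.+-identityˡ _)
        (trans (ℤₚ.+-assoc x y (- y)) (trans (cong (_+_ x) (ℤₚ.+-inverseʳ y)) (ℤₚ.+-identityʳ x)))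
        (ℤₚ.+-monoˡ-< (- y) 0<)

  abstract
    π : ℤ → Pt n
    π z = fromℕ< (n%ℕd<d z (2 ℕ.* n))

    private
      quot : ℤ → ℤ
      quot z = z /ℕ (2 ℕ.* n)

      division : ∀ z → z ≡ r (π z) + quot z * (H + H)
      division z = trans (a≡a%ℕn+[a/ℕn]*n z (2 ℕ.* n))
        (cong₂ (λ x y → + x + quot z * y) (sym (toℕ-fromℕ< (n%ℕd<d z (2 ℕ.* n)))) N≡)

      difference : ∀ a b s t N → (b + t * N) - (a + s * N) ≡ b - a + (t - s) * N
      difference = solve-∀

      π-difference : ∀ x y → ∃ λ s → y - x ≡ r (π y) - r (π x) + s * (H + H)
      π-difference x y = quot y - quot x ,
        trans (cong₂ _-_ (division y) (division x)) (difference (r (π x)) (r (π y)) (quot x) (quot y) (H + H))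

    -- The left side lies in [0, 2H) and a difference of residues lies strictly between -2H and 2H.
    -- Of all multiples of the period, only 0 and 2H can make up the discrepancy.
    wrap : ∀ {x y} → x ≤ y → y < x + (H + H) → (y - x ≡ r (π y) - r (π x)) ⊎ (y - x ≡ r (π y) - r (π x) + (H + H))
    wrap {x} {y} x≤y y<x+N = go (π-difference x y)
      where
      go : (∃ λ s → y - x ≡ r (π y) - r (π x) + s * (H + H)) →
        (y - x ≡ r (π y) - r (π x)) ⊎ (y - x ≡ r (π y) - r (π x) + (H + H))
      go (s , eq) = [ (λ { refl → inj₁ (trans eq (lin (r (π y) ∷ r (π x) ∷ []) (λ a b → ⊢ a ⊖ b ⊕ κ 0 ≐ a ⊖ b))) })
                    , (λ { refl → inj₂ (trans eq (lin (+ 1 * (H + H) ∷ H ∷ r (π y) ∷ r (π x) ∷ [])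
                      (λ a b c d → a ≐ b ⊕ b ⇒ ⊢ c ⊖ d ⊕ a ≐ c ⊖ d ⊕ (b ⊕ b)) (ℤₚ.*-identityˡ (H + H)))) }) ]′
        (s*N-bounds s (lin (y ∷ x ∷ r (π y) ∷ r (π x) ∷ s * (H + H) ∷ H ∷ [])
          (λ a b c d e f → a ⊖ b ≐ c ⊖ d ⊕ e ⇒ b ≼ a ⇒ c ≺ f ⊕ f ⇒ κ 0 ≼ d ⇒ ⊢ κ 0 ≺ e ⊕ (f ⊕ f)) eq x≤y (r<N (π y))
          (0≤r (π x))) (lin (y ∷ x ∷ r (π y) ∷ r (π x) ∷ s * (H + H) ∷ H ∷ [])
          (λ a b c d e f → a ⊖ b ≐ c ⊖ d ⊕ e ⇒ a ≺ b ⊕ (f ⊕ f) ⇒ κ 0 ≼ c ⇒ d ≺ f ⊕ f ⇒ ⊢ e ≺ f ⊕ f ⊕ (f ⊕ f)) eq y<x+N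
          (0≤r (π y)) (r<N (π x))))

    π-congruent : ∀ {x y} s → y ≡ x + s * (H + H) → π y ≡ π x
    π-congruent {x} {y} s y≡ = go (π-difference x y)
      where
      factor : ∀ x y s a t N → y ≡ x + s * N → y - x ≡ a + t * N → a ≡ (s - t) * N
      factor x .(x + s * N) s a t N refl eq = trans (lemma a t N) (trans (cong (_- t * N) (sym eq)) (lemma′ x s t N))
        where
        lemma : ∀ a t N → a ≡ a + t * N - t * N
        lemma = solve-∀
        lemma′ : ∀ x s t N → x + s * N - x - t * N ≡ (s - t) * N
        lemma′ = solve-∀
      go : (∃ λ t → y - x ≡ r (π y) - r (π x) + t * (H + H)) → π y ≡ π x
      go (t , eq) = r-injective
        ([ (λ s-t≡0 → (lin (r (π y) ∷ r (π x) ∷ (s - t) * (H + H) ∷ []) (λ a b c → a ⊖ b ≐ c ⇒ c ≐ κ 0 ⇒ ⊢ a ≐ b) diff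
        (trans (cong (_* (H + H)) s-t≡0) (ℤₚ.*-zeroˡ (H + H)))))
                                 , (λ s-t≡1 → ⊥-elim (lin (r (π y) ∷ r (π x) ∷ (s - t) * (H + H) ∷ H ∷ [])
                                   (λ a b c d → a ⊖ b ≐ c ⇒ c ≐ d ⊕ d ⇒ a ≺ d ⊕ d ⇒ κ 0 ≼ b ⇒ ⊢⊥) diff
                                   (trans (cong (_* (H + H)) s-t≡1) (ℤₚ.*-identityˡ (H + H))) (r<N (π y))
                                   (0≤r (π x)))) ]′
          (s*N-bounds (s - t) (lin (r (π y) ∷ r (π x) ∷ (s - t) * (H + H) ∷ H ∷ [])
            (λ a b c d → a ⊖ b ≐ c ⇒ b ≺ d ⊕ d ⇒ κ 0 ≼ a ⇒ ⊢ κ 0 ≺ c ⊕ (d ⊕ d)) diff (r<N (π x)) (0≤r (π y)))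
            (lin (r (π y) ∷ r (π x) ∷ (s - t) * (H + H) ∷ H ∷ [])
            (λ a b c d → a ⊖ b ≐ c ⇒ a ≺ d ⊕ d ⇒ κ 0 ≼ b ⇒ κ 0 ≺ d ⇒ ⊢ c ≺ d ⊕ d ⊕ (d ⊕ d)) diff (r<N (π y))
            (0≤r (π x)) 0<H)))
        where
        diff : r (π y) - r (π x) ≡ (s - t) * (H + H)
        diff = factor x y s (r (π y) - r (π x)) t (H + H) y≡ eq

    π-shift : ∀ {x y} k → π x ≡ π y → π (x + k) ≡ π (y + k)
    π-shift {x} {y} k eq with π-difference y x
    ... | s , d = π-congruent {y + k} {x + k} s (shift x y k s (r (π x)) (r (π y)) (H + H) d (cong r eq))
      where
      shift : ∀ x y k s a b N → x - y ≡ a - b + s * N → a ≡ b → x + k ≡ y + k + s * N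
      shift x y k s a .a N d refl = trans (lemma x y k) (trans (cong (λ u → u + (y + k)) d) (lemma′ y k s a N))
        where
        lemma : ∀ x y k → x + k ≡ x - y + (y + k)
        lemma = solve-∀
        lemma′ : ∀ y k s a N → a - a + s * N + (y + k) ≡ y + k + s * N
        lemma′ = solve-∀

    π-r : ∀ i → π (r i) ≡ i
    π-r i = toℕ-injective (trans (toℕ-fromℕ< (n%ℕd<d (r i) (2 ℕ.* n))) (m<n⇒m%n≡m (toℕ<n i)))

    rep : ℤ → Pt n → ℤ
    rep lo i = lo + + ((r i - lo) %ℕ (2 ℕ.* n))

    rep≥ : ∀ lo i → lo ≤ rep lo i
    rep≥ lo i = ℤₚ.i≤i+j lo (+ ((r i - lo) %ℕ (2 ℕ.* n)))

    rep< : ∀ lo i → rep lo i < lo + (H + H)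
    rep< lo i = ℤₚ.+-monoʳ-< lo (subst (+ ((r i - lo) %ℕ (2 ℕ.* n)) <_) N≡ (+<+ (n%ℕd<d (r i - lo) (2 ℕ.* n))))

    π-rep : ∀ lo i → π (rep lo i) ≡ i
    π-rep lo i = trans (sym (π-congruent {rep lo i} {r i} q (shift (r i) lo (+ ((r i - lo) %ℕ (2 ℕ.* n))) q (H + H)
      (trans (a≡a%ℕn+[a/ℕn]*n (r i - lo) (2 ℕ.* n)) (cong (λ N → + ((r i - lo) %ℕ (2 ℕ.* n)) + q * N) N≡))))) (π-r i)
      where
      q : ℤ
      q = (r i - lo) /ℕ (2 ℕ.* n)
      shift : ∀ i lo a q N → i - lo ≡ a + q * N → i ≡ lo + a + q * N
      shift i lo a q N eq = trans (lemma i lo) (trans (cong (_+_ lo) eq) (lemma′ lo a q N))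
        where
        lemma : ∀ i lo → i ≡ lo + (i - lo)
        lemma = solve-∀
        lemma′ : ∀ lo a q N → lo + (a + q * N) ≡ lo + a + q * N
        lemma′ = solve-∀

  π-+N : ∀ x → π (x + (H + H)) ≡ π x
  π-+N x = π-congruent (+ 1) (cong (_+_ x) (sym (ℤₚ.*-identityˡ (H + H))))

  π-injective : ∀ {x y} → π x ≡ π y → x - y < H + H → y - x < H + H → x ≡ y
  π-injective {x} {y} eq p q with ℤₚ.≤-total x y
  ... | inj₁ x≤y = [ (λ w → (lin (y ∷ x ∷ r (π y) ∷ r (π x) ∷ []) (λ a b c d → a ⊖ b ≐ c ⊖ d ⇒ d ≐ c ⇒ ⊢ b ≐ a) w
    (cong r eq))) , (λ w → ⊥-elim (lin (y ∷ x ∷ r (π y) ∷ r (π x) ∷ H ∷ [])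
    (λ a b c d e → a ⊖ b ≐ c ⊖ d ⊕ (e ⊕ e) ⇒ d ≐ c ⇒ a ⊖ b ≺ e ⊕ e ⇒ ⊢⊥) w (cong r eq) q)) ]′
    (wrap x≤y (lin (y ∷ x ∷ H ∷ []) (λ a b c → a ⊖ b ≺ c ⊕ c ⇒ ⊢ a ≺ b ⊕ (c ⊕ c)) q))
  ... | inj₂ y≤x = [ (λ w → (lin (x ∷ y ∷ r (π x) ∷ r (π y) ∷ []) (λ a b c d → a ⊖ b ≐ c ⊖ d ⇒ c ≐ d ⇒ ⊢ a ≐ b) w
    (cong r eq))) , (λ w → ⊥-elim (lin (x ∷ y ∷ r (π x) ∷ r (π y) ∷ H ∷ [])
    (λ a b c d e → a ⊖ b ≐ c ⊖ d ⊕ (e ⊕ e) ⇒ c ≐ d ⇒ a ⊖ b ≺ e ⊕ e ⇒ ⊢⊥) w (cong r eq) p)) ]′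
    (wrap y≤x (lin (x ∷ y ∷ H ∷ []) (λ a b c → a ⊖ b ≺ c ⊕ c ⇒ ⊢ a ≺ b ⊕ (c ⊕ c)) p))

  r-π : ∀ z → + 0 ≤ z → z < H + H → r (π z) ≡ z
  r-π z p q = π-injective (π-r (π z)) (lin (r (π z) ∷ H ∷ z ∷ []) (λ a b c → a ≺ b ⊕ b ⇒ κ 0 ≼ c ⇒ ⊢ a ⊖ c ≺ b ⊕ b)
    (r<N (π z)) p) (lin (r (π z) ∷ z ∷ H ∷ []) (λ a b c → κ 0 ≼ a ⇒ b ≺ c ⊕ c ⇒ ⊢ b ⊖ a ≺ c ⊕ c) (0≤r (π z)) q)

  -- The lift of a noncrossing matching

  -- Projection to residues keeps the cyclic order. By `wrap`, each of `q` and `s` passes the end of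
  -- the residue range or does not, and `q` cannot pass it without `s`; the three remaining
  -- combinations are the three rotations.
  cyclic₃ : ∀ {p q s} → p < q → q < s → s < p + (H + H) →
    (r (π p) < r (π q) × r (π q) < r (π s)) ⊎ (r (π s) < r (π p) × r (π p) < r (π q)) ⊎
      (r (π q) < r (π s) × r (π s) < r (π p))
  cyclic₃ {p} {q} {s} p<q q<s s<p+N with wrap {p} {q} (ℤₚ.<⇒≤ p<q)
    (lin (q ∷ s ∷ p ∷ H ∷ []) (λ a b c d → a ≺ b ⇒ b ≺ c ⊕ (d ⊕ d) ⇒ ⊢ a ≺ c ⊕ (d ⊕ d)) q<s s<p+N) | wrap {p} {s}
    (lin (p ∷ q ∷ s ∷ []) (λ a b c → a ≺ b ⇒ b ≺ c ⇒ ⊢ a ≼ c) p<q q<s) s<p+N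
  ... | inj₁ u | inj₁ w =
    inj₁ ((lin (q ∷ p ∷ r (π q) ∷ r (π p) ∷ []) (λ a b c d → a ⊖ b ≐ c ⊖ d ⇒ b ≺ a ⇒ ⊢ d ≺ c) u p<q) ,
    (lin (q ∷ p ∷ r (π q) ∷ r (π p) ∷ s ∷ r (π s) ∷ [])
    (λ a b c d e f → a ⊖ b ≐ c ⊖ d ⇒ e ⊖ b ≐ f ⊖ d ⇒ a ≺ e ⇒ ⊢ c ≺ f) u w q<s))
  ... | inj₁ u | inj₂ w =
    inj₂ (inj₁ ((lin (s ∷ p ∷ r (π s) ∷ r (π p) ∷ H ∷ [])
    (λ a b c d e → a ⊖ b ≐ c ⊖ d ⊕ (e ⊕ e) ⇒ a ≺ b ⊕ (e ⊕ e) ⇒ ⊢ c ≺ d) w s<p+N) ,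
    (lin (q ∷ p ∷ r (π q) ∷ r (π p) ∷ []) (λ a b c d → a ⊖ b ≐ c ⊖ d ⇒ b ≺ a ⇒ ⊢ d ≺ c) u p<q)))
  ... | inj₂ u | inj₁ w = ⊥-elim (lin (q ∷ p ∷ r (π q) ∷ r (π p) ∷ H ∷ s ∷ r (π s) ∷ [])
    (λ a b c d e f g → a ⊖ b ≐ c ⊖ d ⊕ (e ⊕ e) ⇒ f ⊖ b ≐ g ⊖ d ⇒ a ≺ f ⇒ g ≺ e ⊕ e ⇒ κ 0 ≼ c ⇒ ⊢⊥) u w q<s (r<N (π s))
    (0≤r (π q)))
  ... | inj₂ u | inj₂ w =
    inj₂ (inj₂ ((lin (q ∷ p ∷ r (π q) ∷ r (π p) ∷ H ∷ s ∷ r (π s) ∷ [])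
    (λ a b c d e f g → a ⊖ b ≐ c ⊖ d ⊕ (e ⊕ e) ⇒ f ⊖ b ≐ g ⊖ d ⊕ (e ⊕ e) ⇒ a ≺ f ⇒ ⊢ c ≺ g) u w q<s) ,
    (lin (s ∷ p ∷ r (π s) ∷ r (π p) ∷ H ∷ []) (λ a b c d e → a ⊖ b ≐ c ⊖ d ⊕ (e ⊕ e) ⇒ a ≺ b ⊕ (e ⊕ e) ⇒ ⊢ c ≺ d) w
    s<p+N)))

  cyclic₄ : ∀ {p q s t} → p < q → q < s → s < t → t < p + (H + H) →
    (r (π p) < r (π q) × r (π q) < r (π s) × r (π s) < r (π t)) ⊎
    (r (π t) < r (π p) × r (π p) < r (π q) × r (π q) < r (π s)) ⊎
    (r (π s) < r (π t) × r (π t) < r (π p) × r (π p) < r (π q)) ⊎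
    (r (π q) < r (π s) × r (π s) < r (π t) × r (π t) < r (π p))
  cyclic₄ {p} {q} {s} {t} p<q q<s s<t t<p+N with cyclic₃ p<q q<s
    (lin (s ∷ t ∷ p ∷ H ∷ []) (λ a b c d → a ≺ b ⇒ b ≺ c ⊕ (d ⊕ d) ⇒ ⊢ a ≺ c ⊕ (d ⊕ d)) s<t t<p+N) | cyclic₃ {p} {s}
    {t} (ℤₚ.<-trans p<q q<s) s<t t<p+N
  ... | inj₁ u        | inj₁ w        = inj₁ (proj₁ u , proj₂ u , proj₂ w)
  ... | inj₁ u        | inj₂ (inj₁ w) = inj₂ (inj₁ (proj₁ w , proj₁ u , proj₂ u))
  ... | inj₁ u        | inj₂ (inj₂ w) = ⊥-elim (lin (r (π p) ∷ r (π q) ∷ r (π s) ∷ r (π t) ∷ [])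
    (λ a b c d → a ≺ b ⇒ b ≺ c ⇒ c ≺ d ⇒ d ≺ a ⇒ ⊢⊥) (proj₁ u) (proj₂ u) (proj₁ w) (proj₂ w))
  ... | inj₂ (inj₁ u) | inj₁ w        = ⊥-elim (ℤₚ.<-asym (proj₁ u) (proj₁ w))
  ... | inj₂ (inj₁ u) | inj₂ (inj₁ w) = ⊥-elim (ℤₚ.<-asym (proj₁ u) (proj₂ w))
  ... | inj₂ (inj₁ u) | inj₂ (inj₂ w) = inj₂ (inj₂ (inj₁ (proj₁ w , proj₂ w , proj₂ u)))
  ... | inj₂ (inj₂ u) | inj₁ w        = ⊥-elim (ℤₚ.<-asym (proj₂ u) (proj₁ w))
  ... | inj₂ (inj₂ u) | inj₂ (inj₁ w) = ⊥-elim (ℤₚ.<-asym (proj₂ u) (proj₂ w))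
  ... | inj₂ (inj₂ u) | inj₂ (inj₂ w) = inj₂ (inj₂ (inj₂ (proj₁ u , proj₁ w , proj₂ w)))

  -- Whichever of the four rotations the residues form, exactly one of `q` and `t` falls between the
  -- residues of `p` and `s`.
  alternating-cross : ∀ {p q s t} → p < q → q < s → s < t → t < p + (H + H) →
    Cross (toℕ (π p)) (toℕ (π s)) (toℕ (π q)) (toℕ (π t))
  alternating-cross {p} {q} {s} {t} p<q q<s s<t t<p+N with cyclic₄ p<q q<s s<t t<p+N
  ... | inj₁ (u , w , x)               = inj₁ (r-Btw⁺ {π p} {π s} {π q} (inj₁ (u , w)) , r-Out⁺ {π p} {π s} {π t}
    (inj₂ ((lin (r (π p) ∷ r (π q) ∷ r (π s) ∷ r (π t) ∷ []) (λ a b c d → a ≺ b ⇒ b ≺ c ⇒ c ≺ d ⇒ ⊢ a ≺ d) u w x) ,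
    x)))
  ... | inj₂ (inj₁ (u , w , x))        = inj₁ (r-Btw⁺ {π p} {π s} {π q} (inj₁ (w , x)) , r-Out⁺ {π p} {π s} {π t}
    (inj₁ (u , (lin (r (π t) ∷ r (π p) ∷ r (π q) ∷ r (π s) ∷ []) (λ a b c d → a ≺ b ⇒ b ≺ c ⇒ c ≺ d ⇒ ⊢ a ≺ d) u w
    x))))
  ... | inj₂ (inj₂ (inj₁ (u , w , x))) =
    inj₂ (r-Out⁺ {π p} {π s} {π q}
    (inj₂ (x , (lin (r (π s) ∷ r (π t) ∷ r (π p) ∷ r (π q) ∷ []) (λ a b c d → a ≺ b ⇒ b ≺ c ⇒ c ≺ d ⇒ ⊢ a ≺ d) u w
    x))) , r-Btw⁺ {π p} {π s} {π t} (inj₂ (u , w)))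
  ... | inj₂ (inj₂ (inj₂ (u , w , x))) =
    inj₂ (r-Out⁺ {π p} {π s} {π q}
    (inj₁ ((lin (r (π q) ∷ r (π s) ∷ r (π t) ∷ r (π p) ∷ []) (λ a b c d → a ≺ b ⇒ b ≺ c ⇒ c ≺ d ⇒ ⊢ a ≺ d) u w x) ,
    u)) , r-Btw⁺ {π p} {π s} {π t} (inj₂ (w , x)))

  -- Points on one and the same side of the arc from x to y are either all
  -- Btw or all Out, depending on whether the arc contains the step from 2n - 1 to 0.
  beyond-Btw : ∀ {x y p} → x < y → y < p → p < x + (H + H) →
    Btw (toℕ (π x)) (toℕ (π y)) (toℕ (π p)) → r (π y) < r (π x)
  beyond-Btw {x} {y} {p} x<y y<p p<x+N b with cyclic₃ x<y y<p p<x+N | r-Btw⁻ {π x} {π y} {π p} b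
  ... | inj₁ u        | inj₁ w = ⊥-elim (ℤₚ.<-asym (proj₂ u) (proj₂ w))
  ... | inj₁ u        | inj₂ w = ℤₚ.<-trans (proj₁ w) (proj₂ w)
  ... | inj₂ (inj₁ u) | inj₁ w = ⊥-elim (ℤₚ.<-asym (proj₁ u) (proj₁ w))
  ... | inj₂ (inj₁ u) | inj₂ w = ℤₚ.<-trans (proj₁ w) (proj₂ w)
  ... | inj₂ (inj₂ u) | _      = ℤₚ.<-trans (proj₁ u) (proj₂ u)

  beyond-Out : ∀ {x y p} → x < y → y < p → p < x + (H + H) →
    Out (toℕ (π x)) (toℕ (π y)) (toℕ (π p)) → r (π x) < r (π y)
  beyond-Out {x} {y} {p} x<y y<p p<x+N b with cyclic₃ x<y y<p p<x+N | r-Out⁻ {π x} {π y} {π p} b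
  ... | inj₁ u        | _      = proj₁ u
  ... | inj₂ (inj₁ u) | _      = proj₂ u
  ... | inj₂ (inj₂ u) | inj₁ w = ⊥-elim (ℤₚ.<-asym (proj₁ u) (proj₂ w))
  ... | inj₂ (inj₂ u) | inj₂ w = ⊥-elim (ℤₚ.<-asym (proj₂ u) (proj₁ w))

  -- A crossing needs one of `s` and `t` to be `Btw` and the other to be `Out`. As both lie beyond
  -- the arc from `p` to `q`, these force opposite orders of the residues of `p` and `q`.
  parallel-¬cross : ∀ {p q s t} → p < q → q < s → s < t → t < p + (H + H) →
    ¬ Cross (toℕ (π p)) (toℕ (π q)) (toℕ (π s)) (toℕ (π t))
  parallel-¬cross {p} {q} {s} {t} p<q q<s s<t t<p+N (inj₁ (b , o)) =
    (ℤₚ.<-asym (beyond-Btw {p} {q} {s} p<q q<s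
      (lin (s ∷ t ∷ p ∷ H ∷ []) (λ a b c d → a ≺ b ⇒ b ≺ c ⊕ (d ⊕ d) ⇒ ⊢ a ≺ c ⊕ (d ⊕ d)) s<t t<p+N) b)
      (beyond-Out {p} {q} {t} p<q (ℤₚ.<-trans q<s s<t) t<p+N o))
  parallel-¬cross {p} {q} {s} {t} p<q q<s s<t t<p+N (inj₂ (o , b)) =
    (ℤₚ.<-asym (beyond-Btw {p} {q} {t} p<q (ℤₚ.<-trans q<s s<t) t<p+N b)
      (beyond-Out {p} {q} {s} p<q q<s
      (lin (s ∷ t ∷ p ∷ H ∷ []) (λ a b c d → a ≺ b ⇒ b ≺ c ⊕ (d ⊕ d) ⇒ ⊢ a ≺ c ⊕ (d ⊕ d)) s<t t<p+N) o))

  abstract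
    -- The matching as an involution of [0, 2H). The lift is an involution only once diameters are
    -- excluded, and their exclusion already rests on decomposing a matching of an interval.
    flat : Config n → ℤ → ℤ
    flat v z = r (lookup v (π z))

    flat≡ : ∀ v z → flat v z ≡ r (lookup v (π z))
    flat≡ v z = refl

  flat-matching : ∀ v → IsNCMatching n v → IntervalMatching (flat v) (+ 0) (H + H)
  flat-matching v (perfect , noncrossing) = record
    { closed      = λ z _ _ → closed z
    ; involutive  = involutive
    ; irreflexive = λ z p q eq → proj₂ (perfect (π z))
      (r-injective (trans (sym (flat≡ v z)) (trans eq (sym (r-π z p q)))))
    ; nested      = nested
    }
    where
    closed : ∀ z → + 0 ≤ flat v z × flat v z < H + H
    closed z = (lin (flat v z ∷ r (lookup v (π z)) ∷ []) (λ a b → a ≐ b ⇒ κ 0 ≼ b ⇒ ⊢ κ 0 ≼ a) (flat≡ v z)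
      (0≤r (lookup v (π z)))) , (lin (flat v z ∷ r (lookup v (π z)) ∷ H ∷ [])
      (λ a b c → a ≐ b ⇒ b ≺ c ⊕ c ⇒ ⊢ a ≺ c ⊕ c) (flat≡ v z) (r<N (lookup v (π z))))
    involutive : ∀ z → + 0 ≤ z → z < H + H → flat v (flat v z) ≡ z
    involutive z p q = trans (flat≡ v (flat v z))
      (trans (cong (λ i → r (lookup v i)) (trans (cong π (flat≡ v z)) (π-r _)))
      (trans (cong r (proj₁ (perfect (π z)))) (r-π z p q)))
    nested : ∀ x y → + 0 ≤ x → x < H + H → x < y → y < flat v x → flat v y < flat v x
    nested x y 0≤x x<N x<y y<vx with ℤₚ.<-cmp (flat v y) (flat v x)
    ... | tri< vy<vx _ _ = vy<vx
    ... | tri≈ _ vy≡vx _ = ⊥-elim (lin (x ∷ y ∷ flat v (flat v x) ∷ flat v (flat v y) ∷ [])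
      (λ a b c d → a ≺ b ⇒ c ≐ a ⇒ d ≐ b ⇒ d ≐ c ⇒ ⊢⊥) x<y (involutive x 0≤x x<N)
      (involutive y (lin (x ∷ y ∷ []) (λ a b → κ 0 ≼ a ⇒ a ≺ b ⇒ ⊢ κ 0 ≼ b) 0≤x x<y)
      (lin (y ∷ flat v x ∷ H ∷ []) (λ a b c → a ≺ b ⇒ b ≺ c ⊕ c ⇒ ⊢ a ≺ c ⊕ c) y<vx (proj₂ (closed x))))
      (cong (flat v) vy≡vx))
    ... | tri> _ _ vx<vy = ⊥-elim (noncrossing (π x) (π y)
        (inj₁ (r-Btw⁺ {π x} {lookup v (π x)} {π y}
          (inj₁ ((lin (r (π x) ∷ x ∷ r (π y) ∷ y ∷ []) (λ a b c d → a ≐ b ⇒ c ≐ d ⇒ b ≺ d ⇒ ⊢ a ≺ c) rx ry x<y) ,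
          (lin (r (π y) ∷ y ∷ flat v x ∷ r (lookup v (π x)) ∷ []) (λ a b c d → a ≐ b ⇒ b ≺ c ⇒ c ≐ d ⇒ ⊢ a ≺ d) ry
          y<vx fx))) ,
               r-Out⁺ {π x} {lookup v (π x)} {lookup v (π y)}
                 (inj₂ ((lin (r (π x) ∷ x ∷ y ∷ flat v x ∷ flat v y ∷ r (lookup v (π y)) ∷ [])
                 (λ a b c d e f → a ≐ b ⇒ b ≺ c ⇒ c ≺ d ⇒ d ≺ e ⇒ e ≐ f ⇒ ⊢ a ≺ f) rx x<y y<vx vx<vy fy) ,
                 (lin (flat v x ∷ flat v y ∷ r (lookup v (π x)) ∷ r (lookup v (π y)) ∷ [])
                 (λ a b c d → a ≺ b ⇒ a ≐ c ⇒ b ≐ d ⇒ ⊢ c ≺ d) vx<vy fx fy))))))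
      where
      fx = flat≡ v x
      fy = flat≡ v y
      rx : r (π x) ≡ x
      rx = r-π x 0≤x x<N
      ry : r (π y) ≡ y
      ry = r-π y (lin (x ∷ y ∷ []) (λ a b → κ 0 ≼ a ⇒ a ≺ b ⇒ ⊢ κ 0 ≼ b) 0≤x x<y)
        (lin (y ∷ flat v x ∷ H ∷ []) (λ a b c → a ≺ b ⇒ b ≺ c ⊕ c ⇒ ⊢ a ≺ c ⊕ c) y<vx (proj₂ (closed x)))

  -- The points strictly inside an arc are matched among themselves, so an
  -- arc has odd length, whereas n is even.
  no-diameter : ∀ v → IsNCMatching n v → ∀ i → r (lookup v i) ≢ r i + H
  no-diameter v V i eq =
    let t , sum , _ = decompose n (lin (flat v (r i) ∷ r (lookup v i) ∷ r i ∷ H ∷ [])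
          (λ a b c d → a ≐ b ⇒ b ≐ c ⊕ d ⇒ κ 0 ≺ d ⇒ ⊢ c ⊕ κ 1 ≼ a) fi eq 0<H)
          (lin (flat v (r i) ∷ r (lookup v i) ∷ r i ∷ H ∷ + n ∷ [])
          (λ a b c d e → a ≐ b ⇒ b ≐ c ⊕ d ⇒ d ≐ e ⇒ ⊢ a ≼ c ⊕ κ 1 ⊕ e) fi eq H≡n) M in parity t sum
    where
    fi : flat v (r i) ≡ r (lookup v i)
    fi = trans (flat≡ v (r i)) (cong (λ j → r (lookup v j)) (π-r i))
    M : IntervalMatching (flat v) (r i + + 1) (flat v (r i))
    M = inside-arc (flat-matching v V) (r i) (0≤r i) (r<N i)
    H≡m+m : H ≡ + m + + m
    H≡m+m = trans H≡n (cong +_ n≡m+m)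
    parity : ∀ t → r i + + 1 + width t ≢ flat v (r i)
    parity t sum = odd≢even (size t) m (ℤₚ.+-injective
      (lin (r i ∷ width t ∷ flat v (r i) ∷ + size t ∷ r (lookup v i) ∷ H ∷ + m ∷ + suc (size t ℕ.+ size t) ∷ +
        (size t ℕ.+ size t) ∷ + (m ℕ.+ m) ∷ []) (λ a b c d e f g h i j → a ⊕ κ 1 ⊕ b ≐ c ⇒ b ≐ d ⊕ d ⇒ c ≐ e ⇒ e ≐ a ⊕
        f ⇒ f ≐ g ⊕ g ⇒ h ≐ i ⊕ κ 1 ⇒ i ≐ d ⊕ d ⇒ j ≐ g ⊕ g ⇒ ⊢ h ≐ j) sum (width≡ t) fi eq H≡m+m
        (pos-suc (size t ℕ.+ size t)) (ℤₚ.pos-+ (size t) (size t)) (ℤₚ.pos-+ m m)))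

  abstract
    -- The partner is chosen in the window of length 2H centred at z. The left end z - H stands for
    -- the antipode, which is never the partner; this makes the choice symmetric and `lf v` an
    -- involution.
    lf : Config n → ℤ → ℤ
    lf v z = rep (z - H) (lookup v (π z))

    π-lf : ∀ v z → π (lf v z) ≡ lookup v (π z)
    π-lf v z = π-rep (z - H) (lookup v (π z))

    lf≥ : ∀ v z → z - H ≤ lf v z
    lf≥ v z = rep≥ (z - H) _

    lf< : ∀ v z → lf v z < z + H
    lf< v z = lin (rep (z - H) (lookup v (π z)) ∷ z ∷ H ∷ []) (λ a b c → a ≺ b ⊖ c ⊕ (c ⊕ c) ⇒ ⊢ a ≺ b ⊕ c)
      (rep< (z - H) (lookup v (π z)))

  lf-unique : ∀ v {y z} → π y ≡ lookup v (π z) → z - H ≤ y → y < z + H → lf v z ≡ y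
  lf-unique v {y} {z} eq p q = π-injective (trans (π-lf v z) (sym eq))
    (lin (lf v z ∷ z ∷ H ∷ y ∷ []) (λ a b c d → a ≺ b ⊕ c ⇒ b ⊖ c ≼ d ⇒ ⊢ a ⊖ d ≺ c ⊕ c) (lf< v z) p)
    (lin (z ∷ H ∷ lf v z ∷ y ∷ []) (λ a b c d → a ⊖ b ≼ c ⇒ d ≺ a ⊕ b ⇒ ⊢ d ⊖ c ≺ b ⊕ b) (lf≥ v z) q)

  π-translate : ∀ {x y} → π x ≡ π y → ∀ z → π (z + (y - x)) ≡ π z
  π-translate {x} {y} eq z =
    trans (cong π {z + (y - x)} {y + (z - x)} (lin (z ∷ y ∷ x ∷ []) (λ a b c → ⊢ a ⊕ (b ⊖ c) ≐ b ⊕ (a ⊖ c))))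
      (trans (π-shift (z - x) (sym eq)) (cong π {x + (z - x)} {z} (lin (x ∷ z ∷ []) (λ a b → ⊢ a ⊕ (b ⊖ a) ≐ b))))

  -- Periodicity, phrased with `y - x` in place of a multiple of the period: in this form it is a
  -- linear fact about any two congruent points.
  lf-shift : ∀ v {x y} → π x ≡ π y → lf v y ≡ lf v x + (y - x)
  lf-shift v {x} {y} eq = lf-unique v
    (trans (π-translate eq (lf v x)) (trans (π-lf v x) (cong (lookup v) eq)))
    (lin (x ∷ H ∷ lf v x ∷ y ∷ []) (λ a b c d → a ⊖ b ≼ c ⇒ ⊢ d ⊖ b ≼ c ⊕ (d ⊖ a)) (lf≥ v x))
      (lin (lf v x ∷ x ∷ H ∷ y ∷ []) (λ a b c d → a ≺ b ⊕ c ⇒ ⊢ a ⊕ (d ⊖ b) ≺ d ⊕ c) (lf< v x))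

  lf-+N : ∀ v z → lf v (z + (H + H)) ≡ lf v z + (H + H)
  lf-+N v z = lin (lf v (z + (H + H)) ∷ lf v z ∷ z ∷ H ∷ [])
    (λ a b c d → a ≐ b ⊕ (c ⊕ (d ⊕ d) ⊖ c) ⇒ ⊢ a ≐ b ⊕ (d ⊕ d)) (lf-shift v {z} {z + (H + H)} (sym (π-+N z)))

  module Lifted (v : Config n) (V : IsNCMatching n v) where

    lf≢-H : ∀ z → lf v z ≢ z - H
    lf≢-H z eq = [ (λ w → no-diameter v V (lookup v (π z)) (trans (cong r (proj₁ (proj₁ V (π z))))
      (lin (z ∷ lf v z ∷ r (π z) ∷ r (π (lf v z)) ∷ r (lookup v (π z)) ∷ H ∷ [])
      (λ a b c d e f → a ⊖ b ≐ c ⊖ d ⇒ d ≐ e ⇒ b ≐ a ⊖ f ⇒ ⊢ c ≐ e ⊕ f) w rv eq)))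
                 , (λ w → no-diameter v V (π z)
                   (lin (z ∷ lf v z ∷ r (π z) ∷ r (π (lf v z)) ∷ H ∷ r (lookup v (π z)) ∷ [])
                   (λ a b c d e f → a ⊖ b ≐ c ⊖ d ⊕ (e ⊕ e) ⇒ d ≐ f ⇒ b ≐ a ⊖ e ⇒ ⊢ f ≐ c ⊕ e) w rv eq)) ]′
                 (wrap {lf v z} {z} (lin (lf v z ∷ z ∷ H ∷ []) (λ a b c → a ≐ b ⊖ c ⇒ κ 0 ≺ c ⇒ ⊢ a ≼ b) eq 0<H)
                   (lin (lf v z ∷ z ∷ H ∷ []) (λ a b c → a ≐ b ⊖ c ⇒ κ 0 ≺ c ⇒ ⊢ b ≺ a ⊕ (c ⊕ c)) eq 0<H))
      where
      rv : r (π (lf v z)) ≡ r (lookup v (π z))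
      rv = cong r (π-lf v z)

    lf> : ∀ z → z - H < lf v z
    lf> z = ℤₚ.≤∧≢⇒< (lf≥ v z) (λ eq → lf≢-H z (sym eq))

    involutive : ∀ z → lf v (lf v z) ≡ z
    involutive z = lf-unique v (sym (trans (cong (lookup v) (π-lf v z)) (proj₁ (proj₁ V (π z)))))
      (lin (lf v z ∷ z ∷ H ∷ []) (λ a b c → a ≺ b ⊕ c ⇒ ⊢ a ⊖ c ≼ b) (lf< v z))
      (lin (z ∷ H ∷ lf v z ∷ []) (λ a b c → a ⊖ b ≺ c ⇒ ⊢ a ≺ c ⊕ b) (lf> z))

    irreflexive : ∀ z → lf v z ≢ z
    irreflexive z eq = proj₂ (proj₁ V (π z)) (trans (sym (π-lf v z)) (cong π eq))

    unique : ∀ {y z} → π y ≡ lookup v (π z) → z - H ≤ y → y ≤ z + H → lf v z ≡ y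
    unique {y} {z} eq p q = π-injective (trans (π-lf v z) (sym eq))
      (lin (lf v z ∷ z ∷ H ∷ y ∷ []) (λ a b c d → a ≺ b ⊕ c ⇒ b ⊖ c ≼ d ⇒ ⊢ a ⊖ d ≺ c ⊕ c) (lf< v z) p)
      (lin (z ∷ H ∷ lf v z ∷ y ∷ []) (λ a b c d → a ⊖ b ≺ c ⇒ d ≼ a ⊕ b ⇒ ⊢ d ⊖ c ≺ b ⊕ b) (lf> z) q)

    -- A violation would give `x < y < lf v x < lf v y`. As both arcs are shorter than H, these four
    -- alternating points fit into one period, and the edges would cross.
    nested : ∀ {x y} → x < y → y < lf v x → lf v y < lf v x
    nested {x} {y} x<y y<fx with ℤₚ.<-cmp (lf v y) (lf v x)
    ... | tri< fy<fx _ _ = fy<fx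
    ... | tri≈ _ fy≡fx _ = ⊥-elim (lin (x ∷ y ∷ lf v (lf v y) ∷ lf v (lf v x) ∷ [])
      (λ a b c d → a ≺ b ⇒ c ≐ d ⇒ d ≐ a ⇒ c ≐ b ⇒ ⊢⊥) x<y (cong (lf v) fy≡fx) (involutive x) (involutive y))
    ... | tri> _ _ fx<fy = ⊥-elim (proj₂ V (π x) (π y)
      (subst₂ (λ i j → Cross (toℕ (π x)) (toℕ i) (toℕ (π y)) (toℕ j)) (π-lf v x) (π-lf v y)
        (alternating-cross x<y y<fx fx<fy (lin (y ∷ lf v x ∷ x ∷ H ∷ lf v y ∷ [])
          (λ a b c d e → a ≺ b ⇒ b ≺ c ⊕ d ⇒ e ≺ a ⊕ d ⇒ ⊢ e ≺ c ⊕ (d ⊕ d)) y<fx (lf< v x) (lf< v y)))))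

    nestedˡ : ∀ {x y} → x < y → y < lf v x → x < lf v y
    nestedˡ {x} {y} x<y y<fx with ℤₚ.<-cmp x (lf v y)
    ... | tri< x<fy _ _ = x<fy
    ... | tri≈ _ x≡fy _ = ⊥-elim (lin (y ∷ lf v x ∷ lf v (lf v y) ∷ []) (λ a b c → a ≺ b ⇒ b ≐ c ⇒ c ≐ a ⇒ ⊢⊥) y<fx
      (cong (lf v) x≡fy) (involutive y))
    ... | tri> _ _ fy<x = ⊥-elim (lin (y ∷ lf v x ∷ lf v (lf v y) ∷ []) (λ a b c → a ≺ b ⇒ c ≐ a ⇒ b ≺ c ⇒ ⊢⊥) y<fx
      (involutive y) (nested fy<x (lin (x ∷ y ∷ lf v (lf v y) ∷ []) (λ a b c → a ≺ b ⇒ c ≐ b ⇒ ⊢ a ≺ c) x<y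
      (involutive y))))

  -- Reconnecting two edges

  Cross-swapʳ : ∀ {a b c d} → Cross a b c d → Cross a b d c
  Cross-swapʳ (inj₁ (p , q)) = inj₂ (q , p)
  Cross-swapʳ (inj₂ (p , q)) = inj₁ (q , p)

  Cross-swapˡ : ∀ {a b c d} → Cross a b c d → Cross b a c d
  Cross-swapˡ {a} {b} {c} {d} x = Cross-sym {c} {d} {b} {a}
    (Cross-swapʳ {c} {d} {a} {b} (Cross-sym {a} {b} {c} {d} x))

  ¬Btw-endpoint : ∀ a b → ¬ Btw a b a
  ¬Btw-endpoint a b p = [ (λ q → (ℤₚ.<-irrefl refl (proj₁ q))) , (λ q → (ℤₚ.<-irrefl refl (proj₂ q))) ]′
    (Btw⁻ {a} {b} {a} p)

  ¬Out-endpoint : ∀ a b → ¬ Out a b a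
  ¬Out-endpoint a b p = [ (λ q → (ℤₚ.<-irrefl refl (proj₁ q))) , (λ q → (ℤₚ.<-irrefl refl (proj₁ q))) ]′
    (Out⁻ {a} {b} {a} p)

  ¬Cross-endpoint : ∀ a b d → ¬ Cross a b a d
  ¬Cross-endpoint a b d (inj₁ (p , _)) = ¬Btw-endpoint a b p
  ¬Cross-endpoint a b d (inj₂ (p , _)) = ¬Out-endpoint a b p

  Corners : (a b c d : Pt n) → List ℕ
  Corners a b c d = toℕ a ∷ toℕ b ∷ toℕ c ∷ toℕ d ∷ []

  -- An edge crossing a segment between two corners has corners on both sides. In this way emptiness
  -- of the quadrilateral protects the new edges from the remaining ones.
  Cross⇒MeetsHull : ∀ {x y i j ks} → i ∈ ks → j ∈ ks → Cross x y i j → MeetsHull x y ks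
  Cross⇒MeetsHull i∈ j∈ (inj₁ (p , q)) = lose i∈ p , lose j∈ q
  Cross⇒MeetsHull i∈ j∈ (inj₂ (p , q)) = lose j∈ q , lose i∈ p

  module Surgery (v : Config n) (V : IsNCMatching n v) (a b c d : Pt n)
    (va : lookup v a ≡ b) (vc : lookup v c ≡ d) (c≢a : c ≢ a) (c≢b : c ≢ b)
    (empty : EmptyQuad n v a b c d) (uncrossed : ¬ Cross (toℕ a) (toℕ c) (toℕ b) (toℕ d)) where

    private
      back : ∀ i → lookup v (lookup v i) ≡ i
      back i = proj₁ (proj₁ V i)
      v-injective : ∀ {i j} → lookup v i ≡ lookup v j → i ≡ j
      v-injective {i} {j} eq = trans (sym (back i)) (trans (cong (lookup v) eq) (back j))
      vb : lookup v b ≡ a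
      vb = trans (cong (lookup v) (sym va)) (back a)
      vd : lookup v d ≡ c
      vd = trans (cong (lookup v) (sym vc)) (back c)
      a≢b : a ≢ b
      a≢b eq = proj₂ (proj₁ V a) (trans va (sym eq))
      c≢d : c ≢ d
      c≢d eq = proj₂ (proj₁ V c) (trans vc (sym eq))
      d≢a : d ≢ a
      d≢a eq = c≢b (v-injective (trans vc (trans eq (sym vb))))
      d≢b : d ≢ b
      d≢b eq = c≢a (v-injective (trans vc (trans eq (sym va))))

    reconnect : Pt n → Pt n
    reconnect x =
      if does (x ≟ᶠ a) then c else
      if does (x ≟ᶠ c) then a else
      if does (x ≟ᶠ b) then d else
      if does (x ≟ᶠ d) then b else lookup v x

    w : Config n
    w = tabulate reconnect

    private
      wa′ : reconnect a ≡ c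
      wa′ rewrite dec-true (a ≟ᶠ a) refl = refl
      wc′ : reconnect c ≡ a
      wc′ rewrite dec-false (c ≟ᶠ a) c≢a | dec-true (c ≟ᶠ c) refl = refl
      wb′ : reconnect b ≡ d
      wb′ rewrite dec-false (b ≟ᶠ a) (λ e → a≢b (sym e)) | dec-false (b ≟ᶠ c) (λ e → c≢b (sym e)) | dec-true (b ≟ᶠ b)
        refl = refl
      wd′ : reconnect d ≡ b
      wd′ rewrite dec-false (d ≟ᶠ a) d≢a | dec-false (d ≟ᶠ c) (λ e → c≢d (sym e)) | dec-false (d ≟ᶠ b) d≢b | dec-true
        (d ≟ᶠ d) refl = refl
      wx′ : ∀ x → x ≢ a → x ≢ b → x ≢ c → x ≢ d → reconnect x ≡ lookup v x
      wx′ x p q s t rewrite dec-false (x ≟ᶠ a) p | dec-false (x ≟ᶠ c) s | dec-false (x ≟ᶠ b) q | dec-false (x ≟ᶠ d) t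
        = refl

    wa : lookup w a ≡ c
    wa = trans (lookup∘tabulate reconnect a) wa′
    wc : lookup w c ≡ a
    wc = trans (lookup∘tabulate reconnect c) wc′
    wb : lookup w b ≡ d
    wb = trans (lookup∘tabulate reconnect b) wb′
    wd : lookup w d ≡ b
    wd = trans (lookup∘tabulate reconnect d) wd′
    wx : ∀ x → x ≢ a → x ≢ b → x ≢ c → x ≢ d → lookup w x ≡ lookup v x
    wx x p q s t = trans (lookup∘tabulate reconnect x) (wx′ x p q s t)

    private
      data Edge : Pt n → Pt n → Set where
        ac : Edge a c
        ca : Edge c a
        bd : Edge b d
        db : Edge d b

      edge : ∀ i → Edge i (lookup w i) ⊎ (i ≢ a × i ≢ b × i ≢ c × i ≢ d)
      edge i with i ≟ᶠ a | i ≟ᶠ b | i ≟ᶠ c | i ≟ᶠ d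
      ... | yes refl | _        | _        | _        = inj₁ (subst (Edge a) (sym wa) ac)
      ... | no _     | yes refl | _        | _        = inj₁ (subst (Edge b) (sym wb) bd)
      ... | no _     | no _     | yes refl | _        = inj₁ (subst (Edge c) (sym wc) ca)
      ... | no _     | no _     | no _     | yes refl = inj₁ (subst (Edge d) (sym wd) db)
      ... | no p     | no q     | no s     | no t     = inj₂ (p , q , s , t)

      edge-∈ : ∀ {i j} → Edge i j → toℕ i ∈ Corners a b c d × toℕ j ∈ Corners a b c d
      edge-∈ ac = here refl , there (there (here refl))
      edge-∈ ca = there (there (here refl)) , here refl
      edge-∈ bd = there (here refl) , there (there (there (here refl)))
      edge-∈ db = there (there (there (here refl))) , there (here refl)

      edges-uncrossed : ∀ {i j k l} → Edge i j → Edge k l → ¬ Cross (toℕ i) (toℕ j) (toℕ k) (toℕ l)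
      edges-uncrossed ac ac x = ¬Cross-endpoint (toℕ a) (toℕ c) (toℕ c) x
      edges-uncrossed ac ca x = ¬Cross-endpoint (toℕ a) (toℕ c) (toℕ c) (Cross-swapʳ {toℕ a} {toℕ c} x)
      edges-uncrossed ca ac x = ¬Cross-endpoint (toℕ c) (toℕ a) (toℕ a) (Cross-swapʳ {toℕ c} {toℕ a} x)
      edges-uncrossed ca ca x = ¬Cross-endpoint (toℕ c) (toℕ a) (toℕ a) x
      edges-uncrossed bd bd x = ¬Cross-endpoint (toℕ b) (toℕ d) (toℕ d) x
      edges-uncrossed bd db x = ¬Cross-endpoint (toℕ b) (toℕ d) (toℕ d) (Cross-swapʳ {toℕ b} {toℕ d} x)
      edges-uncrossed db bd x = ¬Cross-endpoint (toℕ d) (toℕ b) (toℕ b) (Cross-swapʳ {toℕ d} {toℕ b} x)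
      edges-uncrossed db db x = ¬Cross-endpoint (toℕ d) (toℕ b) (toℕ b) x
      edges-uncrossed ac bd x = uncrossed x
      edges-uncrossed ac db x = uncrossed (Cross-swapʳ {toℕ a} {toℕ c} x)
      edges-uncrossed ca bd x = uncrossed (Cross-swapˡ {toℕ c} {toℕ a} x)
      edges-uncrossed ca db x = uncrossed (Cross-swapʳ {toℕ a} {toℕ c} (Cross-swapˡ {toℕ c} {toℕ a} x))
      edges-uncrossed bd ac x = uncrossed (Cross-sym {toℕ b} {toℕ d} x)
      edges-uncrossed bd ca x = uncrossed (Cross-sym {toℕ b} {toℕ d} (Cross-swapʳ {toℕ b} {toℕ d} x))
      edges-uncrossed db ac x = uncrossed (Cross-sym {toℕ b} {toℕ d} (Cross-swapˡ {toℕ d} {toℕ b} x))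
      edges-uncrossed db ca x =
        uncrossed (Cross-sym {toℕ b} {toℕ d} (Cross-swapʳ {toℕ b} {toℕ d} (Cross-swapˡ {toℕ d} {toℕ b} x)))

      noncrossing : NonCrossing n w
      noncrossing i j x with edge i | edge j
      ... | inj₁ e | inj₁ f = edges-uncrossed e f x
      ... | inj₂ (p , q , s , t) | inj₁ f = empty i p q s t
        (subst (λ k → MeetsHull (toℕ i) (toℕ k) (Corners a b c d)) (wx i p q s t)
          (Cross⇒MeetsHull (proj₁ (edge-∈ f)) (proj₂ (edge-∈ f)) x))
      ... | inj₁ e | inj₂ (p , q , s , t) = empty j p q s t
        (subst (λ k → MeetsHull (toℕ j) (toℕ k) (Corners a b c d)) (wx j p q s t)
          (Cross⇒MeetsHull (proj₁ (edge-∈ e)) (proj₂ (edge-∈ e)) (Cross-sym {toℕ i} {toℕ (lookup w i)} {toℕ j}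
            {toℕ (lookup w j)} x)))
      ... | inj₂ (p , q , s , t) | inj₂ (p′ , q′ , s′ , t′) = proj₂ V i j
        (subst₂ (λ k l → Cross (toℕ i) (toℕ k) (toℕ j) (toℕ l)) (wx i p q s t) (wx j p′ q′ s′ t′) x)

      perfect : IsPerfectMatching n w
      perfect i with i ≟ᶠ a | i ≟ᶠ b | i ≟ᶠ c | i ≟ᶠ d
      ... | yes refl | _        | _        | _        = trans (cong (lookup w) wa) wc , λ e → c≢a (trans (sym wa) e)
      ... | no _     | yes refl | _        | _        = trans (cong (lookup w) wb) wd , λ e → d≢b (trans (sym wb) e)
      ... | no _     | no _     | yes refl | _        = trans (cong (lookup w) wc) wa , λ e → c≢a (trans (sym e) wc)
      ... | no _     | no _     | no _     | yes refl = trans (cong (lookup w) wd) wb , λ e → d≢b (trans (sym e) wd)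
      ... | no p     | no q     | no s     | no t     =
        trans (cong (lookup w) eq)
          (trans (wx _ (λ e → q (v-injective (trans e (sym vb)))) (λ e → p (v-injective (trans e (sym va))))
          (λ e → t (v-injective (trans e (sym vd)))) (λ e → s (v-injective (trans e (sym vc))))) (back i)) ,
        λ e → proj₂ (proj₁ V i) (trans (sym eq) e)
        where eq = wx i p q s t

    surgery : IsNCMatching n w
    surgery = perfect , noncrossing

  -- Exposed points and centred flips

  Exposed : Config n → ℤ → Set
  Exposed v z = ∀ x → x < z → z < lf v x → ⊥

  -- Gap b lies between the points b - 1 and b.
  Free : Config n → ℤ → Set
  Free v b = ∀ x → x < b → b ≤ lf v x → ⊥

  module Exposure (v : Config n) (V : IsNCMatching n v) where
    open Lifted v V

    exposed-shift : ∀ {y z} → π y ≡ π z → Exposed v z → Exposed v y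
    exposed-shift {y} {z} eq ez x x<y y<fx =
      ez (x + (z - y)) (lin (x ∷ y ∷ z ∷ []) (λ a b c → a ≺ b ⇒ ⊢ a ⊕ (c ⊖ b) ≺ c) x<y)
        (lin (y ∷ lf v x ∷ lf v (x + (z - y)) ∷ x ∷ z ∷ [])
        (λ a b c d e → a ≺ b ⇒ c ≐ b ⊕ (d ⊕ (e ⊖ a) ⊖ d) ⇒ ⊢ e ≺ c) y<fx
        (lf-shift v {x} {x + (z - y)} (sym (π-translate eq x))))

    free⇒exposed : ∀ {b} → Free v b → Exposed v b
    free⇒exposed {b} fb x p q = fb x p (ℤₚ.<⇒≤ q)

    free⇒exposed′ : ∀ {z} → Free v (z + + 1) → Exposed v z
    free⇒exposed′ {z} fz x p q = fz x (lin (x ∷ z ∷ []) (λ a b → a ≺ b ⇒ ⊢ a ≺ b ⊕ κ 1) p)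
      (lin (z ∷ lf v x ∷ []) (λ a b → a ≺ b ⇒ ⊢ a ⊕ κ 1 ≼ b) q)

    free⇒opens : ∀ {b} → Free v b → b < lf v b
    free⇒opens {b} fb with ℤₚ.<-cmp b (lf v b)
    ... | tri< b<fb _ _ = b<fb
    ... | tri≈ _ b≡fb _ = ⊥-elim (irreflexive b (sym b≡fb))
    ... | tri> _ _ fb<b =
      ⊥-elim (fb (lf v b) fb<b (lin (lf v (lf v b) ∷ b ∷ []) (λ a b → a ≐ b ⇒ ⊢ b ≼ a) (involutive b)))

    free⇒closes : ∀ {z} → Free v (z + + 1) → lf v z < z
    free⇒closes {z} fz with ℤₚ.<-cmp (lf v z) z
    ... | tri< p _ _ = p
    ... | tri≈ _ e _ = ⊥-elim (irreflexive z e)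
    ... | tri> _ _ p = ⊥-elim (fz z (lin (z ∷ []) (λ a → ⊢ a ≺ a ⊕ κ 1))
      (lin (z ∷ lf v z ∷ []) (λ a b → a ≺ b ⇒ ⊢ a ⊕ κ 1 ≼ b) p))

    opens⇒free : ∀ {a} → a < lf v a → Exposed v a → Free v a
    opens⇒free {a} a<fa ea x x<a a≤fx with a ≟ lf v x
    ... | yes a≡fx = lin (a ∷ lf v a ∷ x ∷ lf v (lf v x) ∷ []) (λ a b c d → a ≺ b ⇒ c ≺ a ⇒ b ≐ d ⇒ d ≐ c ⇒ ⊢⊥) a<fa
      x<a (cong (lf v) a≡fx) (involutive x)
    ... | no a≢fx  = ea x x<a (ℤₚ.≤∧≢⇒< a≤fx a≢fx)

    closes⇒free : ∀ {a} → lf v a < a → Exposed v a → Free v (a + + 1)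
    closes⇒free {a} fa<a ea x x<a+1 a+1≤fx with x ≟ a
    ... | yes refl = lin (lf v a ∷ a ∷ []) (λ a b → a ≺ b ⇒ b ⊕ κ 1 ≼ a ⇒ ⊢⊥) fa<a a+1≤fx
    ... | no x≢a   = ea x (ℤₚ.≤∧≢⇒< {x} {a} (lin (x ∷ a ∷ []) (λ a b → a ≺ b ⊕ κ 1 ⇒ ⊢ a ≼ b) x<a+1) x≢a)
      (lin (a ∷ lf v x ∷ []) (λ a b → a ⊕ κ 1 ≼ b ⇒ ⊢ a ≺ b) a+1≤fx)

    exposed-partner : ∀ {a} → Exposed v a → Exposed v (lf v a)
    exposed-partner {a} ea x x<b b<fx with ℤₚ.<-cmp x a
    ... | tri≈ _ refl _ = ℤₚ.<-irrefl refl b<fx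
    ... | tri> _ _ a<x  = ℤₚ.<-asym b<fx (nested a<x x<b)
    ... | tri< x<a _ _ with ℤₚ.<-cmp a (lf v x)
    ...   | tri< a<fx _ _  = ea x x<a a<fx
    ...   | tri≈ _ refl _  = lin (x ∷ lf v (lf v x) ∷ []) (λ a b → a ≺ b ⇒ b ≐ a ⇒ ⊢⊥) x<b (involutive x)
    ...   | tri> _ _ fx<a  = lin (lf v x ∷ a ∷ lf v (lf v a) ∷ []) (λ a b c → a ≺ b ⇒ c ≐ b ⇒ c ≺ a ⇒ ⊢⊥) fx<a
      (involutive a) (nested x<b b<fx)

    -- The leftmost arc over a gap is exposed, and it starts less than H before the gap.
    cover : ∀ b → Free v b ⊎ (∃ λ p → p < b × b ≤ lf v p × Exposed v p)
    cover b = search n (b - H)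
      (λ y y< b≤ → (lin (y ∷ b ∷ H ∷ lf v y ∷ []) (λ a b c d → a ≺ b ⊖ c ⇒ b ≼ d ⇒ d ≺ a ⊕ c ⇒ ⊢⊥) y< b≤ (lf< v y)))
      (lin (H ∷ + n ∷ b ∷ []) (λ a b c → a ≐ b ⇒ ⊢ c ≼ c ⊖ a ⊕ b) H≡n)
      where
      search : ∀ k lo → (∀ y → y < lo → b ≤ lf v y → ⊥) → b ≤ lo + + k →
        Free v b ⊎ (∃ λ p → p < b × b ≤ lf v p × Exposed v p)
      search zero    lo none b≤lo = inj₁ λ x x<b b≤fx → none x
        (lin (x ∷ b ∷ lo ∷ []) (λ a b c → a ≺ b ⇒ b ≼ c ⊕ κ 0 ⇒ ⊢ a ≺ c) x<b b≤lo) b≤fx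
      search (suc k) lo none b≤ with lo <? b | b ≤? lf v lo
      ... | no lo≮b  | _         = inj₁ λ x x<b b≤fx → none x (ℤₚ.<-≤-trans x<b (ℤₚ.≮⇒≥ lo≮b)) b≤fx
      ... | yes lo<b | yes b≤flo = inj₂ (lo , lo<b , b≤flo , λ y y<lo lo<fy → none y y<lo
        (lin (b ∷ lf v lo ∷ lf v y ∷ []) (λ a b c → a ≼ b ⇒ b ≺ c ⇒ ⊢ a ≼ c) b≤flo (nested y<lo lo<fy)))
      ... | yes lo<b | no b≰flo  = search k (lo + + 1) none′
        (lin (b ∷ lo ∷ + suc k ∷ + k ∷ []) (λ a b c d → a ≼ b ⊕ c ⇒ c ≐ d ⊕ κ 1 ⇒ ⊢ a ≼ b ⊕ κ 1 ⊕ d) b≤ (pos-suc k))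
        where
        none′ : ∀ y → y < lo + + 1 → b ≤ lf v y → ⊥
        none′ y y<lo+1 b≤fy with y ≟ lo
        ... | yes refl = b≰flo b≤fy
        ... | no y≢lo  = none y (ℤₚ.≤∧≢⇒< {y} {lo} (lin (y ∷ lo ∷ []) (λ a b → a ≺ b ⊕ κ 1 ⇒ ⊢ a ≼ b) y<lo+1) y≢lo)
          b≤fy

  -- Corners in cyclic order within one period, with the old arcs from `a` to `b` and from `c` to
  -- `d`. The last two inequalities are the centre condition: no step between consecutive corners
  -- exceeds half the circle, the old arcs being shorter than that anyway.
  record Quad (v : Config n) (a b c d : ℤ) : Set where
    field
      a<b : a < b
      b<c : b < c
      c<d : c < d
      d<a : d < a + (H + H)
      va  : lf v a ≡ b
      vc  : lf v c ≡ d
      ea  : Exposed v a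
      ec  : Exposed v c
      bc≤ : c ≤ b + H
      -- This says a + 2H ≤ d + H: d is followed by the next copy of a.
      da≤ : a + H ≤ d

  record Flip (v w : Config n) (a b c d : ℤ) : Set where
    field
      quad  : Quad v a b c d
      wb    : lf w b ≡ c
      wd    : lf w d ≡ a + (H + H)
      other : ∀ z → π z ≢ π a → π z ≢ π b → π z ≢ π c → π z ≢ π d → lf w z ≡ lf v z
    open Quad quad public

  Beyond : ℤ → ℤ → ℕ → Set
  Beyond x y k = ∃ λ p → y < p × p < x + (H + H) × toℕ (π p) ≡ k

  ¬MeetsHull : ∀ {x y ks} → x < y → All (Beyond x y) ks → ¬ MeetsHull (toℕ (π x)) (toℕ (π y)) ks
  ¬MeetsHull {x} {y} x<y all (btw , out) with All.lookupAny all btw | All.lookupAny all out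
  ... | (p , y<p , p<x , ep) , b | (q , y<q , q<x , eq) , o =
    (ℤₚ.<-asym (beyond-Btw x<y y<p p<x (subst (Btw (toℕ (π x)) (toℕ (π y))) (sym ep) b))
      (beyond-Out x<y y<q q<x (subst (Out (toℕ (π x)) (toℕ (π y))) (sym eq) o)))

  MeetsHull-swap : ∀ {x y ks} → MeetsHull x y ks → MeetsHull y x ks
  MeetsHull-swap {x} {y} (btw , out) = Any.map (λ {k} → Btw-swap {x} {y} {k}) btw , Any.map
    (λ {k} → Out-swap {x} {y} {k}) out

  in-window : ∀ {k i} → InArc n k (toℕ i) → ∃ λ z → π z ≡ i × + k ≤ z × z < + k + H
  in-window {k} {i} p with r-InArc⁻ {k} {i} p
  ... | inj₁ (q , s) = r i , π-r i , q , s
  ... | inj₂ (q , s) = r i + (H + H) , trans (π-+N (r i)) (π-r i) , q , s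

  window-InArc : ∀ {x q} → x ≤ q → q < x + H → InArc n (toℕ (π x)) (toℕ (π q))
  window-InArc {x} {q} x≤q q<x+H with wrap x≤q
    (lin (q ∷ x ∷ H ∷ []) (λ a b c → a ≺ b ⊕ c ⇒ κ 0 ≺ c ⇒ ⊢ a ≺ b ⊕ (c ⊕ c)) q<x+H 0<H)
  ... | inj₁ e = r-InArc⁺ {π x} {π q}
    (inj₁ ((lin (q ∷ x ∷ r (π q) ∷ r (π x) ∷ []) (λ a b c d → a ⊖ b ≐ c ⊖ d ⇒ b ≼ a ⇒ ⊢ d ≼ c) e x≤q) ,
    (lin (q ∷ x ∷ r (π q) ∷ r (π x) ∷ H ∷ []) (λ a b c d e → a ⊖ b ≐ c ⊖ d ⇒ a ≺ b ⊕ e ⇒ ⊢ c ≺ d ⊕ e) e q<x+H)))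
  ... | inj₂ e = r-InArc⁺ {π x} {π q}
    (inj₂ ((lin (q ∷ x ∷ r (π q) ∷ r (π x) ∷ H ∷ [])
    (λ a b c d e → a ⊖ b ≐ c ⊖ d ⊕ (e ⊕ e) ⇒ b ≼ a ⇒ ⊢ d ≼ c ⊕ (e ⊕ e)) e x≤q) ,
    (lin (q ∷ x ∷ r (π q) ∷ r (π x) ∷ H ∷ [])
    (λ a b c d e → a ⊖ b ≐ c ⊖ d ⊕ (e ⊕ e) ⇒ a ≺ b ⊕ e ⇒ ⊢ c ⊕ (e ⊕ e) ≺ d ⊕ e) e q<x+H)))

  -- Lifts into one semicircle keep their differences, so that going once
  -- around a, b, c, d within it would add up to 2H = 0.
  window-difference : ∀ {k p q p′ q′} → π p′ ≡ π p → π q′ ≡ π q → p < q → q ≤ p + H →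
    k ≤ p′ × p′ < k + H → k ≤ q′ × q′ < k + H → q′ - p′ ≡ q - p
  window-difference {k} {p} {q} {p′} {q′} ep eq p<q q≤p+H wp wq = lin (p′ ∷ q ∷ p ∷ q′ ∷ [])
    (λ a b c d → a ⊕ (b ⊖ c) ≐ d ⇒ ⊢ d ⊖ a ≐ b ⊖ c) e
    where
    lift : π (p′ + (q - p)) ≡ π q′
    lift = trans (cong π {p′ + (q - p)} {q + (p′ - p)}
      (lin (p′ ∷ q ∷ p ∷ []) (λ a b c → ⊢ a ⊕ (b ⊖ c) ≐ b ⊕ (a ⊖ c)))) (trans (π-translate (sym ep) q) (sym eq))
    e : p′ + (q - p) ≡ q′
    e = π-injective lift (lin (p′ ∷ k ∷ H ∷ q′ ∷ q ∷ p ∷ [])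
      (λ a b c d e f → a ≺ b ⊕ c ⇒ b ≼ d ⇒ e ≼ f ⊕ c ⇒ ⊢ a ⊕ (e ⊖ f) ⊖ d ≺ c ⊕ c) (proj₂ wp) (proj₁ wq) q≤p+H)
      (lin (k ∷ p′ ∷ q′ ∷ H ∷ p ∷ q ∷ [])
      (λ a b c d e f → a ≼ b ⇒ c ≺ a ⊕ d ⇒ e ≺ f ⇒ κ 0 ≺ d ⇒ ⊢ c ⊖ (b ⊕ (f ⊖ e)) ≺ d ⊕ d) (proj₁ wp) (proj₂ wq) p<q
      0<H)

  module QuadFacts {v : Config n} {a b c d : ℤ} (V : IsNCMatching n v) (Q : Quad v a b c d) where
    open Quad Q
    open Lifted v V
    open Exposure v V

    b<a+H : b < a + H
    b<a+H = lin (lf v a ∷ b ∷ a ∷ H ∷ []) (λ a b c d → a ≐ b ⇒ a ≺ c ⊕ d ⇒ ⊢ b ≺ c ⊕ d) va (lf< v a)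

    d<c+H : d < c + H
    d<c+H = lin (lf v c ∷ d ∷ c ∷ H ∷ []) (λ a b c d → a ≐ b ⇒ a ≺ c ⊕ d ⇒ ⊢ b ≺ c ⊕ d) vc (lf< v c)

    vb : lf v b ≡ a
    vb = trans (cong (lf v) (sym va)) (involutive a)

    vd : lf v d ≡ c
    vd = trans (cong (lf v) (sym vc)) (involutive c)

    eb : Exposed v b
    eb = subst (Exposed v) va (exposed-partner ea)

    ed : Exposed v d
    ed = subst (Exposed v) vc (exposed-partner ec)

    lookup-π : ∀ {x y} → lf v x ≡ y → lookup v (π x) ≡ π y
    lookup-π {x} eq = trans (sym (π-lf v x)) (cong π eq)

    private
      beyond : ∀ {x y q} → lf v x ≡ y → x < y → Exposed v q → π q ≢ π x → π q ≢ π y → Beyond x y (toℕ (π q))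
      beyond {x} {y} {q} vx x<y eq q≢x q≢y with ℤₚ.<-cmp (rep x (π q)) y
      ... | tri> _ _ y<q′ = rep x (π q) , y<q′ , rep< x (π q) , cong toℕ (π-rep x (π q))
      ... | tri≈ _ q′≡y _ = ⊥-elim (q≢y (trans (sym (π-rep x (π q))) (cong π q′≡y)))
      ... | tri< q′<y _ _ = ⊥-elim (exposed-shift (π-rep x (π q)) eq x
        (ℤₚ.≤∧≢⇒< (rep≥ x (π q)) (λ x≡q′ → q≢x (trans (sym (π-rep x (π q))) (cong π (sym x≡q′)))))
        (lin (rep x (π q) ∷ y ∷ lf v x ∷ []) (λ a b c → a ≺ b ⇒ c ≐ b ⇒ ⊢ a ≺ c) q′<y vx))

      separated : ∀ {x y} → lf v x ≡ y → x < y → π a ≢ π x → π a ≢ π y → π b ≢ π x → π b ≢ π y →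
        π c ≢ π x → π c ≢ π y → π d ≢ π x → π d ≢ π y →
        ¬ MeetsHull (toℕ (π x)) (toℕ (π y)) (Corners (π a) (π b) (π d) (π c))
      separated vx x<y ax ay bx by cx cy dx dy = ¬MeetsHull x<y
        (beyond vx x<y ea ax ay ∷ beyond vx x<y eb bx by ∷ beyond vx x<y ed dx dy ∷ beyond vx x<y ec cx cy ∷ [])

      π-partner : ∀ i → π (lf v (r i)) ≡ lookup v i
      π-partner i = trans (π-lf v (r i)) (cong (lookup v) (π-r i))

      avoids : ∀ {i p q} → i ≢ q → lookup v p ≡ q → p ≢ π (lf v (r i))
      avoids {i} {p} {q} i≢q vp e =
        i≢q (trans (sym (proj₁ (proj₁ V i))) (trans (cong (lookup v) (sym (trans e (π-partner i)))) vp))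

    -- All corners are exposed, so none lies under another arc. Lifted into the period that starts
    -- at the left end of such an arc, all of them lie beyond its right end, hence on one side of
    -- it.
    quad-empty : EmptyQuad n v (π a) (π b) (π d) (π c)
    quad-empty i i≢a i≢b i≢d i≢c meets with ℤₚ.<-cmp (r i) (lf v (r i))
    ... | tri≈ _ e _ = irreflexive (r i) (sym e)
    ... | tri< i<y _ _ = separated {r i} {lf v (r i)} refl i<y
        (λ e → i≢a (sym (trans e (π-r i)))) (avoids i≢b (lookup-π va))
        (λ e → i≢b (sym (trans e (π-r i)))) (avoids i≢a (lookup-π vb))
        (λ e → i≢c (sym (trans e (π-r i)))) (avoids i≢d (lookup-π vc))
        (λ e → i≢d (sym (trans e (π-r i)))) (avoids i≢c (lookup-π vd))
        (subst₂ (λ j k → MeetsHull (toℕ j) (toℕ k) _) (sym (π-r i)) (sym (π-partner i)) meets)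
    ... | tri> _ _ y<i = separated {lf v (r i)} {r i} (involutive (r i)) y<i
        (avoids i≢b (lookup-π va)) (λ e → i≢a (sym (trans e (π-r i))))
        (avoids i≢a (lookup-π vb)) (λ e → i≢b (sym (trans e (π-r i))))
        (avoids i≢d (lookup-π vc)) (λ e → i≢c (sym (trans e (π-r i))))
        (avoids i≢c (lookup-π vd)) (λ e → i≢d (sym (trans e (π-r i))))
        (subst₂ (λ j k → MeetsHull (toℕ j) (toℕ k) _) (sym (π-partner i)) (sym (π-r i))
          (MeetsHull-swap {toℕ i} {toℕ (lookup v i)} meets))

    quad-centred : ContainsCentre n (π a) (π b) (π d) (π c)
    quad-centred (k , _ , ia , ib , id , ic) =
      let a′ , ea , wa = in-window {k} ia
          b′ , eb , wb = in-window {k} ib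
          c′ , ec , wc = in-window {k} ic
          d′ , ed , wd = in-window {k} id
          ab = window-difference {+ k} {a} {b} {a′} {b′} ea eb a<b
            (lin (b ∷ a ∷ H ∷ []) (λ a b c → a ≺ b ⊕ c ⇒ ⊢ a ≼ b ⊕ c) b<a+H) wa wb
          bc = window-difference {+ k} {b} {c} {b′} {c′} eb ec b<c bc≤ wb wc
          cd = window-difference {+ k} {c} {d} {c′} {d′} ec ed c<d
            (lin (d ∷ c ∷ H ∷ []) (λ a b c → a ≺ b ⊕ c ⇒ ⊢ a ≼ b ⊕ c) d<c+H) wc wd
          da = window-difference {+ k} {d} {a + (H + H)} {d′} {a′} ed (trans ea (sym (π-+N a))) d<a
            (lin (a ∷ H ∷ d ∷ []) (λ a b c → a ⊕ b ≼ c ⇒ ⊢ a ⊕ (b ⊕ b) ≼ c ⊕ b) da≤) wd wa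
      in (lin (b′ ∷ a′ ∷ b ∷ a ∷ c′ ∷ c ∷ d′ ∷ d ∷ H ∷ []) (λ a b c d e f g h i → a ⊖ b ≐ c ⊖ d ⇒ e ⊖ a ≐ f ⊖ c ⇒ g ⊖
           e ≐ h ⊖ f ⇒ b ⊖ g ≐ d ⊕ (i ⊕ i) ⊖ h ⇒ κ 0 ≺ i ⇒ ⊢⊥) ab bc cd da 0<H)

    private
      d≢a : π d ≢ π a
      d≢a e = ℤₚ.<-irrefl (sym
        (π-injective {d} {a} e (lin (d ∷ a ∷ H ∷ []) (λ a b c → a ≺ b ⊕ (c ⊕ c) ⇒ ⊢ a ⊖ b ≺ c ⊕ c) d<a)
        (lin (a ∷ b ∷ c ∷ d ∷ H ∷ []) (λ a b c d e → a ≺ b ⇒ b ≺ c ⇒ c ≺ d ⇒ κ 0 ≺ e ⇒ ⊢ a ⊖ d ≺ e ⊕ e) a<b b<c c<d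
        0<H))) (lin (a ∷ b ∷ c ∷ d ∷ []) (λ a b c d → a ≺ b ⇒ b ≺ c ⇒ c ≺ d ⇒ ⊢ a ≺ d) a<b b<c c<d)
      d≢b : π d ≢ π b
      d≢b e = ℤₚ.<-irrefl (sym
        (π-injective {d} {b} e (lin (d ∷ a ∷ H ∷ b ∷ []) (λ a b c d → a ≺ b ⊕ (c ⊕ c) ⇒ b ≺ d ⇒ ⊢ a ⊖ d ≺ c ⊕ c) d<a
        a<b) (lin (b ∷ c ∷ d ∷ H ∷ []) (λ a b c d → a ≺ b ⇒ b ≺ c ⇒ κ 0 ≺ d ⇒ ⊢ a ⊖ c ≺ d ⊕ d) b<c c<d 0<H)))
        (ℤₚ.<-trans b<c c<d)
      uncrossed : ¬ Cross (toℕ (π a)) (toℕ (π d)) (toℕ (π b)) (toℕ (π c))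
      uncrossed x = parallel-¬cross {b} {c} {d} {a + (H + H)} b<c c<d d<a
        (lin (a ∷ b ∷ H ∷ []) (λ a b c → a ≺ b ⇒ ⊢ a ⊕ (c ⊕ c) ≺ b ⊕ (c ⊕ c)) a<b)
        (Cross-swapʳ {toℕ (π b)} {toℕ (π c)} (Cross-sym {toℕ (π (a + (H + H)))} {toℕ (π d)}
          (subst (λ i → Cross (toℕ i) (toℕ (π d)) (toℕ (π b)) (toℕ (π c))) (sym (π-+N a)) x)))
      -- The corners of a `Quad` are in cyclic order, whereas `CenteredFlip` joins the first to the
      -- third and the second to the fourth of its points; hence `d` precedes `c`.
      module S = Surgery v V (π a) (π b) (π d) (π c) (lookup-π va) (lookup-π vd) d≢a d≢b quad-empty uncrossed

    flip : ∃ λ w → HEdge n v w × Flip v w a b c d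
    flip = S.w , (V , S.surgery ,
        (π a , π b , π d , π c , lookup-π va , lookup-π vd , d≢a , d≢b , quad-empty , quad-centred , uncrossed , S.wa
          , S.wc , S.wb , S.wd , S.wx)) ,
      record { quad = Q ; wb = wb ; wd = wd ; other = other }
      where
      module W = Lifted S.w S.surgery
      wb : lf S.w b ≡ c
      wb = W.unique (sym S.wb) (lin (b ∷ c ∷ H ∷ []) (λ a b c → a ≺ b ⇒ κ 0 ≺ c ⇒ ⊢ a ⊖ c ≼ b) b<c 0<H) bc≤
      wd : lf S.w d ≡ a + (H + H)
      wd = W.unique (trans (π-+N a) (sym S.wc))
        (lin (d ∷ a ∷ H ∷ []) (λ a b c → a ≺ b ⊕ (c ⊕ c) ⇒ κ 0 ≺ c ⇒ ⊢ a ⊖ c ≼ b ⊕ (c ⊕ c)) d<a 0<H)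
        (lin (a ∷ H ∷ d ∷ []) (λ a b c → a ⊕ b ≼ c ⇒ ⊢ a ⊕ (b ⊕ b) ≼ c ⊕ b) da≤)
      other : ∀ z → π z ≢ π a → π z ≢ π b → π z ≢ π c → π z ≢ π d → lf S.w z ≡ lf v z
      other z za zb zc zd = W.unique (trans (π-lf v z) (sym (S.wx (π z) za zb zd zc))) (lf≥ v z)
        (lin (lf v z ∷ z ∷ H ∷ []) (λ a b c → a ≺ b ⊕ c ⇒ ⊢ a ≼ b ⊕ c) (lf< v z))

  EmptyQuad-⊆ : ∀ v {a b c d a′ b′ c′ d′} → Corners a′ b′ c′ d′ ⊆ Corners a b c d →
    (∀ x → x ≢ a′ → x ≢ b′ → x ≢ c′ → x ≢ d′ → x ≢ a × x ≢ b × x ≢ c × x ≢ d) →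
    EmptyQuad n v a b c d → EmptyQuad n v a′ b′ c′ d′
  EmptyQuad-⊆ v sub off empty x p q s t (btw , out) =
    let p′ , q′ , s′ , t′ = off x p q s t in empty x p′ q′ s′ t′ (Any-resp-⊆ sub btw , Any-resp-⊆ sub out)

  module _ {v : Config n} (V : IsNCMatching n v) where
    open Lifted v V
    open Exposure v V

    -- An arc over a corner of an empty quadrilateral would be over the whole
    -- quadrilateral, which would then lie in an open semicircle.
    corner-exposed : ∀ {p p′ q q′ z} → π z ≡ p → lookup v p ≡ p′ → lookup v q ≡ q′ →
      EmptyQuad n v p p′ q q′ → ContainsCentre n p p′ q q′ → Exposed v z
    corner-exposed {p} {p′} {q} {q′} {z} πz vp vq empty centred x x<z z<y = contradiction
      where
      y<x+H : lf v x < x + H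
      y<x+H = lf< v x
      back : ∀ {i j} → lookup v i ≡ j → lookup v j ≡ i
      back {i} e = trans (cong (lookup v) (sym e)) (proj₁ (proj₁ V i))
      partner-of : ∀ {i j} → π x ≡ i → lookup v i ≡ j → π (lf v x) ≡ j
      partner-of e e′ = trans (π-lf v x) (trans (cong (lookup v) e) e′)
      Inside : Pt n → Set
      Inside i = ∃ λ k → x ≤ k × k ≤ lf v x × π k ≡ i
      inArc : ∀ {i} → Inside i → InArc n (toℕ (π x)) (toℕ i)
      inArc (k , x≤k , k≤y , e) = subst (λ i → InArc n (toℕ (π x)) (toℕ i)) e
        (window-InArc x≤k (lin (k ∷ lf v x ∷ x ∷ H ∷ []) (λ a b c d → a ≼ b ⇒ b ≺ c ⊕ d ⇒ ⊢ a ≺ c ⊕ d) k≤y y<x+H))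
      all-inside : Inside p → Inside p′ → Inside q → Inside q′ → ⊥
      all-inside ip ip′ iq iq′ = centred (toℕ (π x) , toℕ<n (π x) , inArc ip , inArc ip′ , inArc iq , inArc iq′)
      inside-p : Inside p
      inside-p = z , (ℤₚ.<⇒≤ x<z) , (ℤₚ.<⇒≤ z<y) , πz
      inside-p′ : Inside p′
      inside-p′ = lf v z , (ℤₚ.<⇒≤ (nestedˡ x<z z<y)) , (ℤₚ.<⇒≤ (nested x<z z<y)) , trans (π-lf v z)
        (trans (cong (lookup v) πz) vp)
      inside-x : ∀ {i} → π x ≡ i → Inside i
      inside-x e = x , ℤₚ.≤-refl , (lin (x ∷ z ∷ lf v x ∷ []) (λ a b c → a ≺ b ⇒ b ≺ c ⇒ ⊢ a ≼ c) x<z z<y) , e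
      inside-y : ∀ {i} → π (lf v x) ≡ i → Inside i
      inside-y e = lf v x , (lin (x ∷ z ∷ lf v x ∷ []) (λ a b c → a ≺ b ⇒ b ≺ c ⇒ ⊢ a ≼ c) x<z z<y) , ℤₚ.≤-refl , e
      module _ (x≢p : π x ≢ p) (x≢p′ : π x ≢ p′) (x≢q : π x ≢ q) (x≢q′ : π x ≢ q′) where
        inside : ∀ {i} → toℕ i ∈ Corners p p′ q q′ → Inside i
        inside {i} i∈ with ℤₚ.≤-total (rep x i) (lf v x)
        ... | inj₁ k≤y = rep x i , rep≥ x i , k≤y , π-rep x i
        ... | inj₂ y≤k with rep x i ≟ lf v x
        ...   | yes k≡y = rep x i , rep≥ x i , (lin (rep x i ∷ lf v x ∷ []) (λ a b → a ≐ b ⇒ ⊢ a ≼ b) k≡y) , π-rep x i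
        ...   | no k≢y  = ⊥-elim (empty (π x) x≢p x≢p′ x≢q x≢q′
          (subst (λ j → MeetsHull (toℕ (π x)) (toℕ j) (Corners p p′ q q′)) (π-lf v x)
            (Cross⇒MeetsHull {toℕ (π x)} {toℕ (π (lf v x))} (here refl) i∈
              (subst₂ (λ j k → Cross (toℕ (π x)) (toℕ (π (lf v x))) (toℕ j) (toℕ k)) πz (π-rep x i)
                (alternating-cross x<z z<y (ℤₚ.≤∧≢⇒< y≤k (λ e → k≢y (sym e))) (rep< x i))))))
      contradiction : ⊥
      contradiction with π x ≟ᶠ p | π x ≟ᶠ p′ | π x ≟ᶠ q | π x ≟ᶠ q′
      ... | yes e | _ | _ | _ = lin (x ∷ z ∷ []) (λ a b → a ≺ b ⇒ a ≐ b ⇒ ⊢⊥) x<z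
        (π-injective {x} {z} (trans e (sym πz)) (lin (x ∷ z ∷ H ∷ []) (λ a b c → a ≺ b ⇒ κ 0 ≺ c ⇒ ⊢ a ⊖ b ≺ c ⊕ c)
        x<z 0<H) (lin (z ∷ lf v x ∷ x ∷ H ∷ []) (λ a b c d → a ≺ b ⇒ b ≺ c ⊕ d ⇒ κ 0 ≺ d ⇒ ⊢ a ⊖ c ≺ d ⊕ d) z<y y<x+H
        0<H))
      ... | no _ | yes e | _ | _ = lin (z ∷ lf v x ∷ []) (λ a b → a ≺ b ⇒ b ≐ a ⇒ ⊢⊥) z<y
        (π-injective {lf v x} {z} (trans (partner-of e (back vp)) (sym πz))
        (lin (x ∷ z ∷ lf v x ∷ H ∷ []) (λ a b c d → a ≺ b ⇒ c ≺ a ⊕ d ⇒ κ 0 ≺ d ⇒ ⊢ c ⊖ b ≺ d ⊕ d) x<z y<x+H 0<H)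
        (lin (z ∷ lf v x ∷ H ∷ []) (λ a b c → a ≺ b ⇒ κ 0 ≺ c ⇒ ⊢ a ⊖ b ≺ c ⊕ c) z<y 0<H))
      ... | no _ | no _ | yes e | _ = all-inside inside-p inside-p′ (inside-x e) (inside-y (partner-of e vq))
      ... | no _ | no _ | no _ | yes e = all-inside inside-p inside-p′ (inside-y (partner-of e (back vq)))
        (inside-x e)
      ... | no e₁ | no e₂ | no e₃ | no e₄ = all-inside inside-p inside-p′
        (inside e₁ e₂ e₃ e₄ (there (there (here refl)))) (inside e₁ e₂ e₃ e₄ (there (there (there (here refl)))))

  module _ {v w : Config n} (V : IsNCMatching n v) (W : IsNCMatching n w) where
    open Lifted v V
    open Exposure v V

    private
      rotate-⊆ : ∀ {a b c d} → Corners c d a b ⊆ Corners a b c d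
      rotate-⊆ (here e)                         = there (there (here e))
      rotate-⊆ (there (here e))                 = there (there (there (here e)))
      rotate-⊆ (there (there (here e)))         = here e
      rotate-⊆ (there (there (there (here e)))) = there (here e)

      swap-⊆ : ∀ {a b c d} → Corners b a d c ⊆ Corners a b c d
      swap-⊆ (here e)                         = there (here e)
      swap-⊆ (there (here e))                 = here e
      swap-⊆ (there (there (here e)))         = there (there (there (here e)))
      swap-⊆ (there (there (there (here e)))) = there (there (here e))

      module _ (a b c d : Pt n) (va : lookup v a ≡ b) (vc : lookup v c ≡ d) (c≢a : c ≢ a) (c≢b : c ≢ b)
        (empty : EmptyQuad n v a b c d) (centred : ContainsCentre n a b c d)
        (uncrossed : ¬ Cross (toℕ a) (toℕ c) (toℕ b) (toℕ d))
        (wc : lookup w c ≡ a) (wb : lookup w b ≡ d)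
        (wx : ∀ x → x ≢ a → x ≢ b → x ≢ c → x ≢ d → lookup w x ≡ lookup v x)
        (A : ℤ) (πA : π A ≡ a) (A<fA : A < lf v A) where
        πB : π (lf v A) ≡ b
        πB = trans (π-lf v A) (trans (cong (lookup v) πA) va)
        πC : π (rep A c) ≡ c
        πC = π-rep A c
        πD : π (lf v (rep A c)) ≡ d
        πD = trans (π-lf v (rep A c)) (trans (cong (lookup v) πC) vc)
        d≢a : d ≢ a
        d≢a e = c≢b (trans (sym (proj₁ (proj₁ V c))) (trans (cong (lookup v) (trans vc e)) va))
        d≢b : d ≢ b
        d≢b e = c≢a (trans (sym (proj₁ (proj₁ V c))) (trans (cong (lookup v) (trans vc (trans e (sym va))))
          (proj₁ (proj₁ V a))))
        eA : Exposed v A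
        eA = corner-exposed V πA va vc empty centred
        eC : Exposed v (rep A c)
        eC = corner-exposed V πC vc va
          (EmptyQuad-⊆ v {a} {b} {c} {d} {c} {d} {a} {b} rotate-⊆ (λ x p q s t → s , t , p , q) empty)
          (λ (k , k< , ic , id , ia , ib) → centred (k , k< , ia , ib , ic , id))
        eA+N : Exposed v (A + (H + H))
        eA+N = exposed-shift (π-+N A) eA
        B<C : lf v A < rep A c
        B<C with ℤₚ.<-cmp (lf v A) (rep A c)
        ... | tri< p _ _ = p
        ... | tri≈ _ e _ = ⊥-elim (c≢b (trans (sym πC) (trans (cong π (sym e)) πB)))
        ... | tri> _ _ p = ⊥-elim (eC A (ℤₚ.≤∧≢⇒< (rep≥ A c) (λ e → c≢a (trans (sym πC) (trans (cong π (sym e)) πA))))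
          p)
        -- Write B for `lf v A`, C for `rep A c` and D for `lf v C`. If the arc opened at C, then A,
        -- B, C, D would follow in this cyclic order and the new edges A C and B D would cross,
        -- unless the arc passed over the next copy of A, which is exposed.
        D<C : lf v (rep A c) < rep A c
        D<C with ℤₚ.<-cmp (lf v (rep A c)) (rep A c)
        ... | tri< p _ _ = p
        ... | tri≈ _ e _ = ⊥-elim (irreflexive (rep A c) e)
        ... | tri> _ _ C<D with ℤₚ.<-cmp (lf v (rep A c)) (A + (H + H))
        ...   | tri< D<A+N _ _ = ⊥-elim (uncrossed (subst₂ (λ i j → Cross (toℕ i) (toℕ c) (toℕ j) (toℕ d)) πA πB
                  (subst₂ (λ i j → Cross (toℕ (π A)) (toℕ i) (toℕ (π (lf v A))) (toℕ j)) πC πD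
                    (alternating-cross A<fA B<C C<D D<A+N))))
        ...   | tri≈ _ e _     = ⊥-elim (d≢a (trans (sym πD) (trans (cong π e) (trans (π-+N A) πA))))
        ...   | tri> _ _ A+N<D = ⊥-elim (eA+N (rep A c) (rep< A c) A+N<D)
        B<D : lf v A < lf v (rep A c)
        B<D with ℤₚ.<-cmp (lf v A) (lf v (rep A c))
        ... | tri< p _ _ = p
        ... | tri≈ _ e _ = ⊥-elim (d≢b (trans (sym πD) (trans (cong π (sym e)) πB)))
        ... | tri> _ _ p = ⊥-elim
          (exposed-partner eA (lf v (rep A c)) p (lin (lf v A ∷ rep A c ∷ lf v (lf v (rep A c)) ∷ [])
          (λ a b c → a ≺ b ⇒ c ≐ b ⇒ ⊢ a ≺ c) B<C (involutive (rep A c))))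
        window : ∀ {x y i j} → π x ≡ i → π y ≡ j → x ≤ y → y < x + H → InArc n (toℕ i) (toℕ j)
        window refl refl = window-InArc
        -- Otherwise D, C and the next copies of A and B would all lie in [D, D + H), an open
        -- semicircle. `CA≤` is the same argument for [A, A + H).
        BD≤ : lf v (rep A c) ≤ lf v A + H
        BD≤ = ℤₚ.≮⇒≥ λ p → centred (toℕ d , toℕ<n d ,
          window πD (trans (π-+N A) πA) (lin (lf v (rep A c) ∷ rep A c ∷ A ∷ H ∷ [])
            (λ a b c d → a ≺ b ⇒ b ≺ c ⊕ (d ⊕ d) ⇒ ⊢ a ≼ c ⊕ (d ⊕ d)) D<C (rep< A c))
            (lin (lf v A ∷ H ∷ lf v (rep A c) ∷ A ∷ []) (λ a b c d → a ⊕ b ≺ c ⇒ d ≺ a ⇒ ⊢ d ⊕ (b ⊕ b) ≺ c ⊕ b) p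
            A<fA) ,
          window πD (trans (π-+N (lf v A)) πB) (lin (lf v (rep A c) ∷ rep A c ∷ A ∷ H ∷ lf v A ∷ [])
            (λ a b c d e → a ≺ b ⇒ b ≺ c ⊕ (d ⊕ d) ⇒ c ≺ e ⇒ ⊢ a ≼ e ⊕ (d ⊕ d)) D<C (rep< A c) A<fA)
            (lin (lf v A ∷ H ∷ lf v (rep A c) ∷ []) (λ a b c → a ⊕ b ≺ c ⇒ ⊢ a ⊕ (b ⊕ b) ≺ c ⊕ b) p) ,
          window πD πC (ℤₚ.<⇒≤ D<C) (lin (rep A c ∷ H ∷ lf v (rep A c) ∷ []) (λ a b c → a ⊖ b ≺ c ⇒ ⊢ a ≺ c ⊕ b)
            (lf> (rep A c))) ,
          window πD πD ℤₚ.≤-refl (lin (H ∷ lf v (rep A c) ∷ []) (λ a b → κ 0 ≺ a ⇒ ⊢ b ≺ b ⊕ a) 0<H))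
        CA≤ : A + H ≤ rep A c
        CA≤ = ℤₚ.≮⇒≥ λ p → centred (toℕ a , toℕ<n a ,
          window πA πA ℤₚ.≤-refl (lin (H ∷ A ∷ []) (λ a b → κ 0 ≺ a ⇒ ⊢ b ≺ b ⊕ a) 0<H) ,
          window πA πB (ℤₚ.<⇒≤ A<fA) (lf< v A) ,
          window πA πC (rep≥ A c) p ,
          window πA πD (lin (A ∷ lf v A ∷ lf v (rep A c) ∷ []) (λ a b c → a ≺ b ⇒ b ≺ c ⇒ ⊢ a ≼ c) A<fA B<D)
            (lin (lf v (rep A c) ∷ rep A c ∷ A ∷ H ∷ []) (λ a b c d → a ≺ b ⇒ b ≺ c ⊕ d ⇒ ⊢ a ≺ c ⊕ d) D<C p))
        module W = Lifted w W

        flip-of : Flip v w A (lf v A) (lf v (rep A c)) (rep A c)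
        flip-of = record
          { quad = record
              { a<b = A<fA ; b<c = B<D ; c<d = D<C ; d<a = rep< A c ; va = refl ; vc = involutive (rep A c)
              ; ea = eA ; ec = exposed-partner eC ; bc≤ = BD≤ ; da≤ = CA≤ }
          ; wb = W.unique (trans πD (trans (sym wb) (cong (lookup w) (sym πB))))
            (lin (lf v A ∷ lf v (rep A c) ∷ H ∷ []) (λ a b c → a ≺ b ⇒ κ 0 ≺ c ⇒ ⊢ a ⊖ c ≼ b) B<D 0<H) BD≤
          ; wd = W.unique (trans (π-+N A) (trans πA (trans (sym wc) (cong (lookup w) (sym πC)))))
            (lin (rep A c ∷ A ∷ H ∷ []) (λ a b c → a ≺ b ⊕ (c ⊕ c) ⇒ κ 0 ≺ c ⇒ ⊢ a ⊖ c ≼ b ⊕ (c ⊕ c)) (rep< A c) 0<H)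
            (lin (A ∷ H ∷ rep A c ∷ []) (λ a b c → a ⊕ b ≼ c ⇒ ⊢ a ⊕ (b ⊕ b) ≼ c ⊕ b) CA≤)
          ; other = λ z za zb zd zc → W.unique (trans (π-lf v z) (sym (wx (π z)
              (λ e → za (trans e (sym πA))) (λ e → zb (trans e (sym πB))) (λ e → zc (trans e (sym πC)))
                (λ e → zd (trans e (sym πD))))))
              (lf≥ v z) (lin (lf v z ∷ z ∷ H ∷ []) (λ a b c → a ≺ b ⊕ c ⇒ ⊢ a ≼ b ⊕ c) (lf< v z))
          }

    -- The lifted quadrilateral starts at whichever end of the edge `a b` opens its arc. If this is
    -- `b`, then `a` and `b`, and likewise `c` and `d`, exchange their roles, which leaves the pair
    -- of new edges the same.
    flip-from : CenteredFlip n v w → ∃ λ a → ∃ λ b → ∃ λ c → ∃ λ d → Flip v w a b c d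
    flip-from (a , b , c , d , va , vc , c≢a , c≢b , empty , centred , uncrossed , wa , wc , wb , wd , wx)
      with ℤₚ.<-cmp (r a) (lf v (r a))
    ... | tri< p _ _ = _ , _ , _ , _ ,
        flip-of a b c d va vc c≢a c≢b empty centred uncrossed wc wb wx (r a) (π-r a) p
    ... | tri≈ _ e _ = ⊥-elim (irreflexive (r a) (sym e))
    ... | tri> _ _ p = _ , _ , _ , _ ,
        flip-of b a d c vb vd (λ e → d≢b′ e) (λ e → d≢a′ e)
          (EmptyQuad-⊆ v {a} {b} {c} {d} {b} {a} {d} {c} swap-⊆ (λ x p q s t → q , p , t , s) empty)
          (λ (k , k< , ib , ia , id , ic) → centred (k , k< , ia , ib , ic , id))
          (λ x → uncrossed (Cross-sym {toℕ b} {toℕ d} x))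
          wd wa (λ x p q s t → wx x q p t s)
          (lf v (r a)) (trans (π-lf v (r a)) (trans (cong (lookup v) (π-r a)) va))
            (lin (lf v (r a) ∷ r a ∷ lf v (lf v (r a)) ∷ []) (λ a b c → a ≺ b ⇒ c ≐ b ⇒ ⊢ a ≺ c) p (involutive (r a)))
      where
      vb : lookup v b ≡ a
      vb = trans (cong (lookup v) (sym va)) (proj₁ (proj₁ V a))
      vd : lookup v d ≡ c
      vd = trans (cong (lookup v) (sym vc)) (proj₁ (proj₁ V c))
      d≢a′ : d ≢ a
      d≢a′ e = c≢b (trans (sym vd) (trans (cong (lookup v) e) va))
      d≢b′ : d ≢ b
      d≢b′ e = c≢a (trans (sym vd) (trans (cong (lookup v) e) vb))

  HEdge⇒Flip : ∀ {v w} → HEdge n v w → ∃ λ a → ∃ λ b → ∃ λ c → ∃ λ d → Flip v w a b c d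
  HEdge⇒Flip (V , W , e) = flip-from V W e

  -- The same quadrilateral read with `b` and `c` exchanged. The crossing condition of the reverse
  -- flip says that the old edges do not cross, and this holds in `v`.
  HEdge-sym : ∀ {v w} → HEdge n v w → HEdge n w v
  HEdge-sym {v} {w} (V , W , a , b , c , d , va , vc , c≢a , c≢b , empty , centred , uncrossed , wa , wc , wb , wd ,
    wx) =
    W , V , a , c , b , d , wa , wb , (λ e → a≢b (sym e)) , (λ e → c≢b (sym e)) ,
    empty′ ,
    (λ (k , k< , ia , ic , ib , id) → centred (k , k< , ia , ib , ic , id)) ,
    (λ x → proj₂ V a c (subst₂ (λ i j → Cross (toℕ a) (toℕ i) (toℕ c) (toℕ j)) (sym va) (sym vc) x)) ,
    va , vb , vc , vd ,
    λ x p q s t → sym (wx x p s q t)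
    where
    vb : lookup v b ≡ a
    vb = trans (cong (lookup v) (sym va)) (proj₁ (proj₁ V a))
    vd : lookup v d ≡ c
    vd = trans (cong (lookup v) (sym vc)) (proj₁ (proj₁ V c))
    a≢b : a ≢ b
    a≢b e = proj₂ (proj₁ V a) (trans va (sym e))
    middle-⊆ : Corners a c b d ⊆ Corners a b c d
    middle-⊆ (here e)                         = here e
    middle-⊆ (there (here e))                 = there (there (here e))
    middle-⊆ (there (there (here e)))         = there (here e)
    middle-⊆ (there (there (there (here e)))) = there (there (there (here e)))
    empty′ : EmptyQuad n w a c b d
    empty′ x p q s t (btw , out) = empty x p s q t (subst (λ i → MeetsHull (toℕ x) (toℕ i) (Corners a b c d))
      (wx x p s q t)
      (Any-resp-⊆ middle-⊆ btw , Any-resp-⊆ middle-⊆ out))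

  -- Asymmetric components contain cycles

  congruent-gap : ∀ {x y} → π x ≡ π y → x < y → x + (H + H) ≤ y
  congruent-gap {x} {y} e x<y = ℤₚ.≮⇒≥ λ y< → (lin (x ∷ y ∷ []) (λ a b → a ≺ b ⇒ a ≐ b ⇒ ⊢⊥) x<y
    (π-injective {x} {y} e (lin (x ∷ y ∷ H ∷ []) (λ a b c → a ≺ b ⇒ κ 0 ≺ c ⇒ ⊢ a ⊖ b ≺ c ⊕ c) x<y 0<H)
    (lin (y ∷ x ∷ H ∷ []) (λ a b c → a ≺ b ⊕ (c ⊕ c) ⇒ ⊢ a ⊖ b ≺ c ⊕ c) y<)))

  π-distinct : ∀ {x y} → x < y → y < x + (H + H) → π x ≢ π y
  π-distinct {x} {y} x<y y< e = lin (x ∷ H ∷ y ∷ []) (λ a b c → a ⊕ (b ⊕ b) ≼ c ⇒ c ≺ a ⊕ (b ⊕ b) ⇒ ⊢⊥)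
    (congruent-gap e x<y) y<

  module FlipFacts {v w : Config n} {a b c d : ℤ} (V : IsNCMatching n v) (W : IsNCMatching n w) (F : Flip v w a b c d)
    where
    open Flip F
    open QuadFacts V quad using (eb; ed)
    private
      module W = Lifted w W

    wc : lf w c ≡ b
    wc = trans (cong (lf w) (sym wb)) (W.involutive b)

    wa : lf w a ≡ d - (H + H)
    wa = lin (lf w (a + (H + H)) ∷ lf w a ∷ H ∷ lf w (lf w d) ∷ d ∷ [])
      (λ a b c d e → a ≐ b ⊕ (c ⊕ c) ⇒ d ≐ a ⇒ d ≐ e ⇒ ⊢ b ≐ e ⊖ (c ⊕ c)) (lf-+N w a) (cong (lf w) wd)
      (W.involutive d)

    data View (z : ℤ) : Set where
      at-a : π z ≡ π a → lf w z ≡ z + (d - (H + H) - a) → View z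
      at-b : π z ≡ π b → lf w z ≡ z + (c - b) → View z
      at-c : π z ≡ π c → lf w z ≡ z + (b - c) → View z
      at-d : π z ≡ π d → lf w z ≡ z + (a + (H + H) - d) → View z
      off  : π z ≢ π a → π z ≢ π b → π z ≢ π c → π z ≢ π d → lf w z ≡ lf v z → View z

    view : ∀ z → View z
    view z with π z ≟ᶠ π a | π z ≟ᶠ π b | π z ≟ᶠ π c | π z ≟ᶠ π d
    ... | yes e | _ | _ | _ =
      at-a e (lin (lf w z ∷ lf w a ∷ z ∷ a ∷ d ∷ H ∷ [])
      (λ a b c d e f → a ≐ b ⊕ (c ⊖ d) ⇒ b ≐ e ⊖ (f ⊕ f) ⇒ ⊢ a ≐ c ⊕ (e ⊖ (f ⊕ f) ⊖ d)) (lf-shift w (sym e)) wa)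
    ... | no _ | yes e | _ | _ =
      at-b e (lin (lf w z ∷ lf w b ∷ z ∷ b ∷ c ∷ []) (λ a b c d e → a ≐ b ⊕ (c ⊖ d) ⇒ b ≐ e ⇒ ⊢ a ≐ c ⊕ (e ⊖ d))
      (lf-shift w (sym e)) wb)
    ... | no _ | no _ | yes e | _ =
      at-c e (lin (lf w z ∷ lf w c ∷ z ∷ c ∷ b ∷ []) (λ a b c d e → a ≐ b ⊕ (c ⊖ d) ⇒ b ≐ e ⇒ ⊢ a ≐ c ⊕ (e ⊖ d))
      (lf-shift w (sym e)) wc)
    ... | no _ | no _ | no _ | yes e =
      at-d e (lin (lf w z ∷ lf w d ∷ z ∷ d ∷ a ∷ H ∷ [])
      (λ a b c d e f → a ≐ b ⊕ (c ⊖ d) ⇒ b ≐ e ⊕ (f ⊕ f) ⇒ ⊢ a ≐ c ⊕ (e ⊕ (f ⊕ f) ⊖ d)) (lf-shift w (sym e)) wd)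
    ... | no p | no q | no s | no t = off p q s t (other z p q s t)

    -- An arc of `w` over `b` would be an unchanged one, which exposure in `v` excludes, or a
    -- translate of one of the new arcs [b, c] and [d, a + 2H], none of which has `b` in its
    -- interior.
    wb-exposed : Exposed w b
    wb-exposed x x<b b<wx with view x
    ... | at-a e p = lin (lf w x ∷ x ∷ d ∷ H ∷ a ∷ b ∷ [])
      (λ a b c d e f → a ≐ b ⊕ (c ⊖ (d ⊕ d) ⊖ e) ⇒ c ≺ e ⊕ (d ⊕ d) ⇒ b ≺ f ⇒ f ≺ a ⇒ ⊢⊥) p d<a x<b b<wx
    ... | at-b e p = lin (lf w x ∷ x ∷ c ∷ b ∷ H ∷ d ∷ a ∷ [])
      (λ a b c d e f g → a ≐ b ⊕ (c ⊖ d) ⇒ b ⊕ (e ⊕ e) ≼ d ⇒ d ≺ a ⇒ c ≺ f ⇒ f ≺ g ⊕ (e ⊕ e) ⇒ g ≺ d ⇒ ⊢⊥) p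
      (congruent-gap e x<b) b<wx c<d d<a a<b
    ... | at-c e p = lin (lf w x ∷ x ∷ b ∷ c ∷ []) (λ a b c d → a ≐ b ⊕ (c ⊖ d) ⇒ c ≺ d ⇒ b ≺ c ⇒ c ≺ a ⇒ ⊢⊥) p b<c
      x<b b<wx
    ... | at-d e p = lin (lf w x ∷ x ∷ a ∷ H ∷ d ∷ b ∷ [])
      (λ a b c d e f → a ≐ b ⊕ (c ⊕ (d ⊕ d) ⊖ e) ⇒ b ⊕ (d ⊕ d) ≼ e ⇒ f ≺ a ⇒ c ≺ f ⇒ ⊢⊥) p
      (congruent-gap e (lin (x ∷ b ∷ c ∷ d ∷ []) (λ a b c d → a ≺ b ⇒ b ≺ c ⇒ c ≺ d ⇒ ⊢ a ≺ d) x<b b<c c<d)) b<wx a<b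
    ... | off _ _ _ _ p = eb x x<b (lin (b ∷ lf w x ∷ lf v x ∷ []) (λ a b c → a ≺ b ⇒ b ≐ c ⇒ ⊢ a ≺ c) b<wx p)

    wd-exposed : Exposed w d
    wd-exposed x x<d d<wx with view x
    ... | at-a e p = lin (lf w x ∷ x ∷ d ∷ H ∷ a ∷ [])
      (λ a b c d e → a ≐ b ⊕ (c ⊖ (d ⊕ d) ⊖ e) ⇒ c ≺ e ⊕ (d ⊕ d) ⇒ b ≺ c ⇒ c ≺ a ⇒ ⊢⊥) p d<a x<d d<wx
    ... | at-b e p = lin (b ∷ H ∷ x ∷ d ∷ a ∷ [])
      (λ a b c d e → a ⊕ (b ⊕ b) ≼ c ⇒ c ≺ d ⇒ d ≺ e ⊕ (b ⊕ b) ⇒ e ≺ a ⇒ ⊢⊥)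
      (congruent-gap (sym e)
      (lin (lf w x ∷ x ∷ c ∷ b ∷ d ∷ []) (λ a b c d e → a ≐ b ⊕ (c ⊖ d) ⇒ e ≺ a ⇒ c ≺ e ⇒ ⊢ d ≺ b) p d<wx c<d)) x<d
      d<a a<b
    ... | at-c e p = lin (lf w x ∷ x ∷ b ∷ c ∷ d ∷ []) (λ a b c d e → a ≐ b ⊕ (c ⊖ d) ⇒ c ≺ d ⇒ b ≺ e ⇒ e ≺ a ⇒ ⊢⊥) p
      b<c x<d d<wx
    ... | at-d e p = lin (lf w x ∷ x ∷ a ∷ H ∷ d ∷ b ∷ c ∷ [])
      (λ a b c d e f g → a ≐ b ⊕ (c ⊕ (d ⊕ d) ⊖ e) ⇒ b ⊕ (d ⊕ d) ≼ e ⇒ e ≺ a ⇒ c ≺ f ⇒ f ≺ g ⇒ g ≺ e ⇒ ⊢⊥) p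
      (congruent-gap e x<d) d<wx a<b b<c c<d
    ... | off _ _ _ _ p = ed x x<d (lin (d ∷ lf w x ∷ lf v x ∷ []) (λ a b c → a ≺ b ⇒ b ≐ c ⇒ ⊢ a ≺ c) d<wx p)

  -- The gap is written e + 1 to have e and e + 1 as its neighbouring points; `x` opens an arc over
  -- the opposite gap.
  NonSym : Config n → Set
  NonSym v = ∃ λ e → Free v (e + + 1) × ∃ λ x → x < e + + 1 + H × e + + 1 + H ≤ lf v x

  module _ {v : Config n} (V : IsNCMatching n v) where
    open Lifted v V
    open Exposure v V

    -- The two arcs next to a free gap both face the arc over the opposite gap,
    -- and either of these two flips leaves a free gap opposite a covered one.
    nonSym-flips : NonSym v → ∃ λ w₁ → ∃ λ w₂ → HEdge n v w₁ × NonSym w₁ × HEdge n v w₂ × NonSym w₂ × w₁ ≢ w₂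
    nonSym-flips (e , free , x , x< , ≤fx) with cover (e + + 1 + H)
    ... | inj₁ free′ = ⊥-elim (free′ x x< ≤fx)
    ... | inj₂ (c , c< , ≤d , ec) =
      let w₁ , edge₁ , F₁ = QuadFacts.flip V quad₁
          w₂ , edge₂ , F₂ = QuadFacts.flip V quad₂
      in w₁ , w₂ , edge₁ , nonSym₁ edge₁ F₁ , edge₂ , nonSym₂ edge₂ F₂ , distinct F₁ F₂
      where
      p<e : lf v e < e
      p<e = free⇒closes free
      e<q : e + + 1 < lf v (e + + 1)
      e<q = free⇒opens free
      d<c+H : lf v c < c + H
      d<c+H = lf< v c
      q<c : lf v (e + + 1) < c
      q<c with ℤₚ.<-cmp (lf v (e + + 1)) c
      ... | tri< p _ _ = p
      ... | tri≈ _ q≡c _ = ⊥-elim (lin (e ∷ H ∷ lf v c ∷ lf v (lf v (e + + 1)) ∷ [])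
        (λ a b c d → a ⊕ κ 1 ⊕ b ≼ c ⇒ κ 0 ≺ b ⇒ d ≐ c ⇒ d ≐ a ⊕ κ 1 ⇒ ⊢⊥) ≤d 0<H (cong (lf v) q≡c)
        (involutive (e + + 1)))
      ... | tri> _ _ c<q = ⊥-elim
        (ec (e + + 1) (lin (e ∷ H ∷ lf v c ∷ c ∷ []) (λ a b c d → a ⊕ κ 1 ⊕ b ≼ c ⇒ c ≺ d ⊕ b ⇒ ⊢ a ⊕ κ 1 ≺ d) ≤d
        d<c+H) c<q)
      d<p+N : lf v c < lf v e + (H + H)
      d<p+N with ℤₚ.<-cmp (lf v c) (lf v e + (H + H))
      ... | tri< p _ _ = p
      ... | tri≈ _ d≡ _ = ⊥-elim (lin (c ∷ e ∷ H ∷ lf v (lf v c) ∷ lf v (lf v e + (H + H)) ∷ lf v (lf v e) ∷ [])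
        (λ a b c d e f → a ≺ b ⊕ κ 1 ⊕ c ⇒ κ 0 ≺ c ⇒ d ≐ e ⇒ d ≐ a ⇒ e ≐ f ⊕ (c ⊕ c) ⇒ f ≐ b ⇒ ⊢⊥) c< 0<H
        (cong (lf v) d≡) (involutive c) (lf-+N v (lf v e)) (involutive e))
      ... | tri> _ _ p = ⊥-elim (exposed-shift (π-+N (lf v e)) (exposed-partner (free⇒exposed′ free)) c
        (lin (c ∷ e ∷ H ∷ lf v e ∷ []) (λ a b c d → a ≺ b ⊕ κ 1 ⊕ c ⇒ b ⊖ c ≺ d ⇒ ⊢ a ≺ d ⊕ (c ⊕ c)) c< (lf> e)) p)
      quad₁ : Quad v (lf v e) e c (lf v c)
      quad₁ = record
        { a<b = p<e ; b<c = (lin (e ∷ H ∷ lf v c ∷ c ∷ []) (λ a b c d → a ⊕ κ 1 ⊕ b ≼ c ⇒ c ≺ d ⊕ b ⇒ ⊢ a ≺ d) ≤d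
          d<c+H) ; c<d = (lin (c ∷ e ∷ H ∷ lf v c ∷ []) (λ a b c d → a ≺ b ⊕ κ 1 ⊕ c ⇒ b ⊕ κ 1 ⊕ c ≼ d ⇒ ⊢ a ≺ d) c<
          ≤d) ; d<a = d<p+N ; va = involutive e ; vc = refl
        ; ea = exposed-partner (free⇒exposed′ free) ; ec = ec ; bc≤ =
          (lin (c ∷ e ∷ H ∷ []) (λ a b c → a ≺ b ⊕ κ 1 ⊕ c ⇒ ⊢ a ≼ b ⊕ c) c<) ; da≤ =
          (lin (lf v e ∷ e ∷ H ∷ lf v c ∷ []) (λ a b c d → a ≺ b ⇒ b ⊕ κ 1 ⊕ c ≼ d ⇒ ⊢ a ⊕ c ≼ d) p<e ≤d) }
      quad₂ : Quad v (e + + 1) (lf v (e + + 1)) c (lf v c)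
      quad₂ = record
        { a<b = e<q ; b<c = q<c ; c<d =
          (lin (c ∷ e ∷ H ∷ lf v c ∷ []) (λ a b c d → a ≺ b ⊕ κ 1 ⊕ c ⇒ b ⊕ κ 1 ⊕ c ≼ d ⇒ ⊢ a ≺ d) c< ≤d) ; d<a =
          (lin (c ∷ e ∷ H ∷ lf v c ∷ []) (λ a b c d → a ≺ b ⊕ κ 1 ⊕ c ⇒ d ≺ a ⊕ c ⇒ ⊢ d ≺ b ⊕ κ 1 ⊕ (c ⊕ c)) c< d<c+H)
          ; va = refl ; vc = refl
        ; ea = free⇒exposed free ; ec = ec ; bc≤ =
          (lin (c ∷ e ∷ H ∷ lf v (e + + 1) ∷ []) (λ a b c d → a ≺ b ⊕ κ 1 ⊕ c ⇒ b ⊕ κ 1 ≺ d ⇒ ⊢ a ≼ d ⊕ c) c< e<q) ;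
          da≤ = ≤d }
      -- With p = `lf v e` and d = `lf v c`, the new arcs are [e, c] and [d, p + 2H]. Gap d is free
      -- because the second arc opens there. The gap opposite to it lies under the first arc, which
      -- is used in its translate by 2H.
      nonSym₁ : ∀ {w} → HEdge n v w → Flip v w (lf v e) e c (lf v c) → NonSym w
      nonSym₁ {w} (_ , W , _) F = lf v c - + 1 , subst (Free w) (lin (lf v c ∷ []) (λ a → ⊢ a ≐ a ⊖ κ 1 ⊕ κ 1))
        (Exposure.opens⇒free w W (lin (lf w (lf v c) ∷ lf v e ∷ H ∷ lf v c ∷ [])
        (λ a b c d → a ≐ b ⊕ (c ⊕ c) ⇒ d ≺ b ⊕ (c ⊕ c) ⇒ ⊢ d ≺ a) (Flip.wd F) d<p+N) (FlipFacts.wd-exposed V W F)) ,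
        e + (H + H) , (lin (e ∷ H ∷ lf v c ∷ []) (λ a b c → a ⊕ κ 1 ⊕ b ≼ c ⇒ ⊢ a ⊕ (b ⊕ b) ≺ c ⊖ κ 1 ⊕ κ 1 ⊕ b) ≤d) ,
          (lin (lf w (e + (H + H)) ∷ lf w e ∷ H ∷ c ∷ lf v c ∷ [])
          (λ a b c d e → a ≐ b ⊕ (c ⊕ c) ⇒ b ≐ d ⇒ e ≺ d ⊕ c ⇒ ⊢ e ⊖ κ 1 ⊕ κ 1 ⊕ c ≼ a) (lf-+N w e) (Flip.wb F) d<c+H)
      -- With q = `lf v (e + 1)` and d = `lf v c`, the new arcs are [q, c] and [d, e + 1 + 2H]. Gap
      -- c + 1 is free because the first arc closes just before it, and the opposite gap lies under
      -- the second arc.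
      nonSym₂ : ∀ {w} → HEdge n v w → Flip v w (e + + 1) (lf v (e + + 1)) c (lf v c) → NonSym w
      nonSym₂ {w} (_ , W , _) F = c , Exposure.closes⇒free w W (lin (lf w c ∷ lf v (e + + 1) ∷ c ∷ [])
        (λ a b c → a ≐ b ⇒ b ≺ c ⇒ ⊢ a ≺ c) (FlipFacts.wc V W F) q<c)
          (subst (Exposed w) (Flip.wb F) (Exposure.exposed-partner w W (FlipFacts.wb-exposed V W F))) ,
        lf v c , (lin (lf v c ∷ c ∷ H ∷ []) (λ a b c → a ≺ b ⊕ c ⇒ ⊢ a ≺ b ⊕ κ 1 ⊕ c) d<c+H) ,
          (lin (lf w (lf v c) ∷ e ∷ H ∷ c ∷ [])
          (λ a b c d → a ≐ b ⊕ κ 1 ⊕ (c ⊕ c) ⇒ d ≺ b ⊕ κ 1 ⊕ c ⇒ ⊢ d ⊕ κ 1 ⊕ c ≼ a) (Flip.wd F) c<)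
      -- The point `e` tells the results apart: the first flip joins it to `c`, the second leaves it
      -- joined to `lf v e`.
      distinct : ∀ {w₁ w₂} → Flip v w₁ (lf v e) e c (lf v c) → Flip v w₂ (e + + 1) (lf v (e + + 1)) c (lf v c) → w₁ ≢
        w₂
      distinct {w₁} F₁ F₂ refl =
        (lin (lf w₁ e ∷ c ∷ lf v c ∷ H ∷ e ∷ lf v e ∷ [])
        (λ a b c d e f → a ≐ b ⇒ c ≺ b ⊕ d ⇒ e ⊕ κ 1 ⊕ d ≼ c ⇒ f ≺ e ⇒ a ≐ f ⇒ ⊢⊥) (Flip.wb F₁) d<c+H ≤d p<e
        (Flip.other F₂ e (π-distinct (lin (e ∷ []) (λ a → ⊢ a ≺ a ⊕ κ 1))
        (lin (H ∷ e ∷ []) (λ a b → κ 0 ≺ a ⇒ ⊢ b ⊕ κ 1 ≺ b ⊕ (a ⊕ a)) 0<H))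
        (π-distinct (lin (e ∷ lf v (e + + 1) ∷ []) (λ a b → a ⊕ κ 1 ≺ b ⇒ ⊢ a ≺ b) e<q)
        (lin (lf v (e + + 1) ∷ e ∷ H ∷ []) (λ a b c → a ≺ b ⊕ κ 1 ⊕ c ⇒ κ 0 ≺ c ⇒ ⊢ a ≺ b ⊕ (c ⊕ c)) (lf< v (e + + 1))
        0<H))
          (π-distinct (lin (e ∷ H ∷ lf v c ∷ c ∷ []) (λ a b c d → a ⊕ κ 1 ⊕ b ≼ c ⇒ c ≺ d ⊕ b ⇒ ⊢ a ≺ d) ≤d d<c+H)
            (lin (c ∷ e ∷ H ∷ []) (λ a b c → a ≺ b ⊕ κ 1 ⊕ c ⇒ κ 0 ≺ c ⇒ ⊢ a ≺ b ⊕ (c ⊕ c)) c< 0<H))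
            (π-distinct (lin (e ∷ H ∷ lf v c ∷ []) (λ a b c → a ⊕ κ 1 ⊕ b ≼ c ⇒ κ 0 ≺ b ⇒ ⊢ a ≺ c) ≤d 0<H)
            (lin (lf v c ∷ lf v e ∷ H ∷ e ∷ []) (λ a b c d → a ≺ b ⊕ (c ⊕ c) ⇒ b ≺ d ⇒ ⊢ a ≺ d ⊕ (c ⊕ c)) d<p+N
            p<e))))

  -- Finiteness, and extracting a cycle from a long walk

  Config-ext : {v w : Config n} → (∀ i → lookup v i ≡ lookup w i) → v ≡ w
  Config-ext {v} {w} eq = trans (sym (tabulate∘lookup v)) (trans (tabulate-cong eq) (tabulate∘lookup w))

  _≟ᶜ_ : (v w : Config n) → Dec (v ≡ w)
  _≟ᶜ_ = ≡-dec _≟ᶠ_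

  open DecMembership _≟ᶜ_ using (_∈?_)

  lookup-injective : {A : Set} {xs : List A} → Unique xs → ∀ i j → List.lookup xs i ≡ List.lookup xs j → i ≡ j
  lookup-injective (_ ∷ _)      zero    zero    _  = refl
  lookup-injective (x∉ ∷ _)     zero    (suc j) eq = ⊥-elim (All.lookup x∉ (∈-lookup j) eq)
  lookup-injective (x∉ ∷ _)     (suc i) zero    eq = ⊥-elim (All.lookup x∉ (∈-lookup i) (sym eq))
  lookup-injective (_ ∷ unique) (suc i) (suc j) eq = cong suc (lookup-injective unique i j eq)

  configs : ℕ
  configs = (2 ℕ.* n) ℕ.^ (2 ℕ.* n)

  unique-bounded : {xs : List (Config n)} → Unique xs → length xs ℕ.≤ configs
  unique-bounded {xs} unique = injective⇒≤ {f = λ i → funToFin (lookup (List.lookup xs i))} λ {i} {j} eq →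
    lookup-injective unique i j (Config-ext λ k →
      trans (sym (finToFun-funToFin (lookup (List.lookup xs i)) k))
        (trans (cong (λ f → finToFun f k) eq) (finToFun-funToFin (lookup (List.lookup xs j)) k)))

  HEdge⇒≢ : ∀ {v w} → HEdge n v w → w ≢ v
  HEdge⇒≢ (_ , _ , a , b , c , d , va , _ , _ , c≢b , _ , _ , _ , wa , _) w≡v =
    c≢b (trans (sym wa) (trans (cong (λ u → lookup u a) w≡v) va))

  module _ {A : Set} where
    -- Walks are stored with the newest vertex first. When the next vertex is an earlier one, the
    -- segment back to it closes up to a cycle.
    upTo : {xs : List A} {w : A} → w ∈ xs → List A
    upTo {x ∷ _} (here _)   = [ x ]
    upTo {x ∷ _} (there w∈) = x ∷ upTo w∈

    All-upTo : {P : A → Set} {xs : List A} {w : A} (w∈ : w ∈ xs) → All P xs → All P (upTo w∈)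
    All-upTo (here _)   (p ∷ _)  = p ∷ []
    All-upTo (there w∈) (p ∷ ps) = p ∷ All-upTo w∈ ps

    Unique-upTo : {xs : List A} {w : A} (w∈ : w ∈ xs) → Unique xs → Unique (upTo w∈)
    Unique-upTo (here _)   (_ ∷ _)  = [] ∷ []
    Unique-upTo (there w∈) (p ∷ ps) = All-upTo w∈ p ∷ Unique-upTo w∈ ps

    Linked-upTo : {R : A → A → Set} {x z w : A} {xs : List A} (w∈ : w ∈ xs) →
      Linked R (x ∷ xs) → R w z → Linked R (x ∷ upTo w∈ ++ [ z ])
    Linked-upTo (here refl) (p ∷ _)  q = p ∷ q ∷ [-]
    Linked-upTo (there w∈)  (p ∷ ps) q = p ∷ Linked-upTo w∈ ps q

    -- Not returning to the immediate predecessor `y` is what gives the closed walk at least three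
    -- vertices.
    2≤length-upTo : {y w : A} {ys : List A} (w∈ : w ∈ y ∷ ys) → w ≢ y → 2 ℕ.≤ length (upTo w∈)
    2≤length-upTo (here w≡y)                w≢y = ⊥-elim (w≢y w≡y)
    2≤length-upTo (there {xs = _ ∷ _} (here _))  w≢y = s≤s (s≤s z≤n)
    2≤length-upTo (there {xs = _ ∷ _} (there _)) w≢y = s≤s (s≤s z≤n)

  -- A walk that never turns back can be continued within NonSym; as there are
  -- finitely many matchings, it eventually meets itself.
  module _ (v₀ : Config n) where
    private
      walk : ∀ fuel x y ys → configs ℕ.< fuel ℕ.+ length (x ∷ y ∷ ys) → NonSym x → Unique (x ∷ y ∷ ys) →
        Linked (HEdge n) (x ∷ y ∷ ys) → All (Reach n v₀) (x ∷ y ∷ ys) → ComponentHasCycle n v₀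
      walk zero x y ys long _ unique _ _ = ⊥-elim (ℕₚ.<⇒≱ long (unique-bounded unique))
      walk (suc fuel) x y ys long nonSym unique linked@((X , _) ∷ _) reached@(rx ∷ _) =
        let w₁ , w₂ , e₁ , n₁ , e₂ , n₂ , w₁≢w₂ = nonSym-flips X nonSym in choose w₁ w₂ e₁ n₁ e₂ n₂ w₁≢w₂
        where
        extend : ∀ w → HEdge n x w → NonSym w → w ≢ y → ComponentHasCycle n v₀
        extend w e nonSym-w w≢y with w ∈? (y ∷ ys)
        ... | yes w∈ = x ∷ upTo w∈ , (2≤length-upTo w∈ w≢y , Unique-upTo (there w∈) unique , Linked-upTo w∈ linked
          (HEdge-sym {x} {w} e)) ,
                       All-upTo (there w∈) reached
        ... | no w∉  = walk fuel w x (y ∷ ys) (subst (configs ℕ.<_) (sym (ℕₚ.+-suc fuel _)) long) nonSym-w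
                       ((HEdge⇒≢ {x} {w} e ∷ All.tabulate (λ u∈ w≡u → w∉ (subst (_∈ y ∷ ys) (sym w≡u) u∈))) ∷ unique)
                       (HEdge-sym {x} {w} e ∷ linked) ((rx ◅◅ e ◅ ε) ∷ reached)
        choose : ∀ w₁ w₂ → HEdge n x w₁ → NonSym w₁ → HEdge n x w₂ → NonSym w₂ → w₁ ≢ w₂ → ComponentHasCycle n v₀
        choose w₁ w₂ e₁ n₁ e₂ n₂ w₁≢w₂ with w₁ ≟ᶜ y
        ... | yes refl = extend w₂ e₂ n₂ (λ e → w₁≢w₂ (sym e))
        ... | no w₁≢y  = extend w₁ e₁ n₁ w₁≢y

    nonSym-cycle : ∀ {v} → IsNCMatching n v → Reach n v₀ v → NonSym v → ComponentHasCycle n v₀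
    nonSym-cycle {v} V reach nonSym =
      let w , _ , e , n′ , _ = nonSym-flips V nonSym
      in walk (suc configs) w v [] (s≤s (ℕₚ.m≤m+n configs _)) n′
           ((HEdge⇒≢ {v} {w} e ∷ []) ∷ [] ∷ []) (HEdge-sym {v} {w} e ∷ [-]) ((reach ◅◅ e ◅ ε) ∷ reach ∷ [])

  -- The arc at z has become exposed with an antipodal copy, while the partners of z and z + H are
  -- still those of `v`. For a point at which `v` is asymmetric this outcome is contradictory.
  Dug : Config n → ℤ → Config n → Set
  Dug v z w = Reach n v w × IsNCMatching n w × lf w z ≡ lf v z × lf w (z + H) ≡ lf v (z + H) ×
    Exposed w z × lf w (z + H) ≡ lf v z + H

  -- As long as no free gap faces a covered one, the outermost arc around z has an
  -- antipodal copy, and flipping the two removes it from around z.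
  dig′ : ∀ fuel v → IsNCMatching n v → ∀ z a → z < lf v z → a ≤ z → lf v z ≤ lf v a → Exposed v a → z ≤ a + + fuel →
    (∃ λ w → Reach n v w × IsNCMatching n w × NonSym w) ⊎ ∃ (Dug v z)
  dig′ fuel v V z a z<fz a≤z fz≤fa ea z≤ with Exposure.cover v V (a + H) | Exposure.cover v V (lf v a + + 1 + H)
  ... | inj₂ (x , x< , ≤fx , _) | _ = inj₁ (v , ε , V , a - + 1 ,
        subst (Free v) (lin (a ∷ []) (λ a → ⊢ a ≐ a ⊖ κ 1 ⊕ κ 1))
          (Exposure.opens⇒free v V (lin (z ∷ lf v z ∷ a ∷ lf v a ∷ []) (λ a b c d → a ≺ b ⇒ c ≼ a ⇒ b ≼ d ⇒ ⊢ c ≺ d)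
          z<fz a≤z fz≤fa) ea) , x , (lin (x ∷ a ∷ H ∷ []) (λ a b c → a ≺ b ⊕ c ⇒ ⊢ a ≺ b ⊖ κ 1 ⊕ κ 1 ⊕ c) x<) ,
          (lin (a ∷ H ∷ lf v x ∷ []) (λ a b c → a ⊕ b ≼ c ⇒ ⊢ a ⊖ κ 1 ⊕ κ 1 ⊕ b ≼ c) ≤fx))
  ... | inj₁ _ | inj₂ (x , x< , ≤fx , _) = inj₁ (v , ε , V , lf v a ,
        Exposure.closes⇒free v V (lin (z ∷ lf v z ∷ a ∷ lf v a ∷ lf v (lf v a) ∷ [])
          (λ a b c d e → a ≺ b ⇒ c ≼ a ⇒ b ≼ d ⇒ e ≐ c ⇒ ⊢ e ≺ d) z<fz a≤z fz≤fa (Lifted.involutive v V a))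
          (Exposure.exposed-partner v V ea) , x , x< , ≤fx)
  ... | inj₁ free-a | inj₁ free-b = antipode (ℤₚ.<-cmp (lf v (a + H)) (lf v a + H))
    where
    open Lifted v V
    open Exposure v V
    a<b : a < lf v a
    a<b = lin (z ∷ lf v z ∷ a ∷ lf v a ∷ []) (λ a b c d → a ≺ b ⇒ c ≼ a ⇒ b ≼ d ⇒ ⊢ c ≺ d) z<fz a≤z fz≤fa
    descend : ∀ fuel → z ≤ a + + fuel → a < z → lf v (a + H) ≡ lf v a + H →
      (∃ λ w → Reach n v w × IsNCMatching n w × NonSym w) ⊎ ∃ (Dug v z)
    antipode : _ → (∃ λ w → Reach n v w × IsNCMatching n w × NonSym w) ⊎ ∃ (Dug v z)
    -- The gap just after b′ is free, because the arc from a + H closes there and is exposed. The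
    -- opposite gap lies under the arc from `a`, taken in its translate from a + 2H.
    antipode (tri< b′<b+H _ _) = inj₁ (v , ε , V , lf v (a + H) ,
      closes⇒free (lin (a ∷ H ∷ lf v (a + H) ∷ lf v (lf v (a + H)) ∷ []) (λ a b c d → a ⊕ b ≺ c ⇒ d ≐ a ⊕ b ⇒ ⊢ d ≺ c)
        (free⇒opens free-a) (involutive (a + H))) (exposed-partner (free⇒exposed free-a)) ,
      a + (H + H) , (lin (a ∷ H ∷ lf v (a + H) ∷ []) (λ a b c → a ⊕ b ≺ c ⇒ ⊢ a ⊕ (b ⊕ b) ≺ c ⊕ κ 1 ⊕ b)
        (free⇒opens free-a)) , (lin (lf v (a + (H + H)) ∷ lf v a ∷ H ∷ lf v (a + H) ∷ [])
        (λ a b c d → a ≐ b ⊕ (c ⊕ c) ⇒ d ≺ b ⊕ c ⇒ ⊢ d ⊕ κ 1 ⊕ c ≼ a) (lf-+N v a) b′<b+H))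
    antipode (tri> _ _ b+H<b′) =
      ⊥-elim (free-b (a + H) (lin (a ∷ lf v a ∷ H ∷ []) (λ a b c → a ≺ b ⇒ ⊢ a ⊕ c ≺ b ⊕ κ 1 ⊕ c) a<b)
      (lin (lf v a ∷ H ∷ lf v (a + H) ∷ []) (λ a b c → a ⊕ b ≺ c ⇒ ⊢ a ⊕ κ 1 ⊕ b ≼ c) b+H<b′))
    antipode (tri≈ _ b′≡ _) with a ≟ z
    ... | yes refl = inj₂ (v , ε , V , refl , refl , ea , b′≡)
    ... | no a≢z   = descend fuel z≤ (ℤₚ.≤∧≢⇒< a≤z a≢z) b′≡
    descend zero z≤a a<z _ = ⊥-elim (lin (z ∷ a ∷ []) (λ a b → a ≼ b ⊕ κ 0 ⇒ b ≺ a ⇒ ⊢⊥) z≤a a<z)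
    descend (suc fuel) z≤a a<z b′≡ = continue (QuadFacts.flip V quad)
      where
      b<a+H : lf v a < a + H
      b<a+H = lf< v a
      quad : Quad v a (lf v a) (a + H) (lf v a + H)
      quad = record
        { a<b = a<b ; b<c = b<a+H ; c<d = (lin (a ∷ lf v a ∷ H ∷ []) (λ a b c → a ≺ b ⇒ ⊢ a ⊕ c ≺ b ⊕ c) a<b) ; d<a =
          (lin (lf v a ∷ a ∷ H ∷ []) (λ a b c → a ≺ b ⊕ c ⇒ ⊢ a ⊕ c ≺ b ⊕ (c ⊕ c)) b<a+H) ; va = refl ; vc = b′≡
        ; ea = ea ; ec = free⇒exposed free-a ; bc≤ = (lin (a ∷ lf v a ∷ H ∷ []) (λ a b c → a ≺ b ⇒ ⊢ a ⊕ c ≼ b ⊕ c)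
          a<b) ; da≤ = (lin (a ∷ lf v a ∷ H ∷ []) (λ a b c → a ≺ b ⇒ ⊢ a ⊕ c ≼ b ⊕ c) a<b) }
      continue : (∃ λ w → HEdge n v w × Flip v w a (lf v a) (a + H) (lf v a + H)) →
        (∃ λ w → Reach n v w × IsNCMatching n w × NonSym w) ⊎ ∃ (Dug v z)
      continue (w , edge@(_ , W , _) , F) = around (Exposure.cover w W (z + + 1))
        where
        open FlipFacts V W F
        ≢-sym′ : ∀ {x y : Pt n} → x ≢ y → y ≢ x
        ≢-sym′ p e = p (sym e)
        wz : lf w z ≡ lf v z
        wz = Flip.other F z (≢-sym′
          (π-distinct a<z (lin (z ∷ lf v z ∷ lf v a ∷ a ∷ H ∷ [])
          (λ a b c d e → a ≺ b ⇒ b ≼ c ⇒ c ≺ d ⊕ e ⇒ κ 0 ≺ e ⇒ ⊢ a ≺ d ⊕ (e ⊕ e)) z<fz fz≤fa b<a+H 0<H)))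
          (π-distinct (ℤₚ.<-≤-trans z<fz fz≤fa)
          (lin (a ∷ z ∷ lf v a ∷ H ∷ []) (λ a b c d → a ≺ b ⇒ c ≺ a ⊕ d ⇒ κ 0 ≺ d ⇒ ⊢ c ≺ b ⊕ (d ⊕ d)) a<z b<a+H 0<H))
          (π-distinct (lin (z ∷ lf v z ∷ lf v a ∷ a ∷ H ∷ []) (λ a b c d e → a ≺ b ⇒ b ≼ c ⇒ c ≺ d ⊕ e ⇒ ⊢ a ≺ d ⊕ e)
            z<fz fz≤fa b<a+H) (lin (a ∷ z ∷ H ∷ []) (λ a b c → a ≺ b ⇒ κ 0 ≺ c ⇒ ⊢ a ⊕ c ≺ b ⊕ (c ⊕ c)) a<z 0<H))
            (π-distinct (lin (z ∷ lf v z ∷ lf v a ∷ H ∷ []) (λ a b c d → a ≺ b ⇒ b ≼ c ⇒ κ 0 ≺ d ⇒ ⊢ a ≺ c ⊕ d) z<fz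
            fz≤fa 0<H) (lin (a ∷ z ∷ lf v a ∷ H ∷ []) (λ a b c d → a ≺ b ⇒ c ≺ a ⊕ d ⇒ ⊢ c ⊕ d ≺ b ⊕ (d ⊕ d)) a<z
            b<a+H))
        wz+H : lf w (z + H) ≡ lf v (z + H)
        wz+H = Flip.other F (z + H)
          (≢-sym′ (π-distinct (lin (a ∷ z ∷ H ∷ []) (λ a b c → a ≺ b ⇒ κ 0 ≺ c ⇒ ⊢ a ≺ b ⊕ c) a<z 0<H)
          (lin (z ∷ lf v z ∷ lf v a ∷ a ∷ H ∷ []) (λ a b c d e → a ≺ b ⇒ b ≼ c ⇒ c ≺ d ⊕ e ⇒ ⊢ a ⊕ e ≺ d ⊕ (e ⊕ e))
          z<fz fz≤fa b<a+H))) (≢-sym′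
          (π-distinct (lin (a ∷ z ∷ lf v a ∷ H ∷ []) (λ a b c d → a ≺ b ⇒ c ≺ a ⊕ d ⇒ ⊢ c ≺ b ⊕ d) a<z b<a+H)
          (lin (z ∷ lf v z ∷ lf v a ∷ H ∷ []) (λ a b c d → a ≺ b ⇒ b ≼ c ⇒ κ 0 ≺ d ⇒ ⊢ a ⊕ d ≺ c ⊕ (d ⊕ d)) z<fz fz≤fa
          0<H)))
          (≢-sym′ (π-distinct (lin (a ∷ z ∷ H ∷ []) (λ a b c → a ≺ b ⇒ ⊢ a ⊕ c ≺ b ⊕ c) a<z)
            (lin (z ∷ lf v z ∷ lf v a ∷ a ∷ H ∷ [])
            (λ a b c d e → a ≺ b ⇒ b ≼ c ⇒ c ≺ d ⊕ e ⇒ κ 0 ≺ e ⇒ ⊢ a ⊕ e ≺ d ⊕ e ⊕ (e ⊕ e)) z<fz fz≤fa b<a+H 0<H)))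
            (π-distinct (lin (z ∷ lf v z ∷ lf v a ∷ H ∷ []) (λ a b c d → a ≺ b ⇒ b ≼ c ⇒ ⊢ a ⊕ d ≺ c ⊕ d) z<fz fz≤fa)
            (lin (a ∷ z ∷ lf v a ∷ H ∷ []) (λ a b c d → a ≺ b ⇒ c ≺ a ⊕ d ⇒ κ 0 ≺ d ⇒ ⊢ c ⊕ d ≺ b ⊕ d ⊕ (d ⊕ d)) a<z
            b<a+H 0<H))
        -- No translate of a new arc passes over gap z + 1, and an old arc over this gap that
        -- started left of `a` would also have been over the exposed point `a`. So the next
        -- outermost arc starts further right, which is what the fuel measures.
        inward : ∀ p → p < z + + 1 → z + + 1 ≤ lf w p → a < p
        inward p p≤z z<wp with view p
        ... | at-a e q = ⊥-elim (lin (lf w p ∷ p ∷ lf v a ∷ H ∷ a ∷ z ∷ [])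
          (λ a b c d e f → a ≐ b ⊕ (c ⊕ d ⊖ (d ⊕ d) ⊖ e) ⇒ b ≺ f ⊕ κ 1 ⇒ f ⊕ κ 1 ≼ a ⇒ c ≺ e ⊕ d ⇒ ⊢⊥) q p≤z z<wp
          b<a+H)
        ... | at-b e q = ⊥-elim (lin (lf w p ∷ p ∷ a ∷ H ∷ lf v a ∷ z ∷ [])
          (λ a b c d e f → a ≐ b ⊕ (c ⊕ d ⊖ e) ⇒ f ⊕ κ 1 ≼ a ⇒ b ⊕ (d ⊕ d) ≼ e ⇒ c ≺ f ⇒ κ 0 ≺ d ⇒ ⊢⊥) q z<wp
          (congruent-gap e (lin (p ∷ z ∷ lf v z ∷ lf v a ∷ []) (λ a b c d → a ≺ b ⊕ κ 1 ⇒ b ≺ c ⇒ c ≼ d ⇒ ⊢ a ≺ d) p≤z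
          z<fz fz≤fa)) a<z 0<H)
        ... | at-c e q = ⊥-elim (lin (lf w p ∷ p ∷ lf v a ∷ a ∷ H ∷ z ∷ [])
          (λ a b c d e f → a ≐ b ⊕ (c ⊖ (d ⊕ e)) ⇒ b ≺ f ⊕ κ 1 ⇒ f ⊕ κ 1 ≼ a ⇒ c ≺ d ⊕ e ⇒ ⊢⊥) q p≤z z<wp b<a+H)
        ... | at-d e q = ⊥-elim (lin (lf w p ∷ p ∷ a ∷ H ∷ lf v a ∷ z ∷ [])
          (λ a b c d e f → a ≐ b ⊕ (c ⊕ (d ⊕ d) ⊖ (e ⊕ d)) ⇒ f ⊕ κ 1 ≼ a ⇒ b ⊕ (d ⊕ d) ≼ e ⊕ d ⇒ c ≺ f ⇒ ⊢⊥) q z<wp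
          (congruent-gap e (lin (p ∷ z ∷ lf v z ∷ lf v a ∷ H ∷ [])
          (λ a b c d e → a ≺ b ⊕ κ 1 ⇒ b ≺ c ⇒ c ≼ d ⇒ κ 0 ≺ e ⇒ ⊢ a ≺ d ⊕ e) p≤z z<fz fz≤fa 0<H)) a<z)
        ... | off p≢a _ _ _ q with ℤₚ.<-cmp p a
        ...   | tri< p<a _ _ =
          ⊥-elim (ea p p<a (lin (lf w p ∷ lf v p ∷ z ∷ a ∷ []) (λ a b c d → a ≐ b ⇒ c ⊕ κ 1 ≼ a ⇒ d ≺ c ⇒ ⊢ d ≺ b) q
          z<wp a<z))
        ...   | tri≈ _ refl _ = ⊥-elim (p≢a refl)
        ...   | tri> _ _ a<p = a<p
        around : Free w (z + + 1) ⊎ (∃ λ p → p < z + + 1 × z + + 1 ≤ lf w p × Exposed w p) →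
          (∃ λ u → Reach n v u × IsNCMatching n u × NonSym u) ⊎ ∃ (Dug v z)
        around (inj₁ free) = ⊥-elim (free z (lin (z ∷ []) (λ a → ⊢ a ≺ a ⊕ κ 1))
          (lin (lf w z ∷ lf v z ∷ z ∷ []) (λ a b c → a ≐ b ⇒ c ≺ b ⇒ ⊢ c ⊕ κ 1 ≼ a) wz z<fz))
        around (inj₂ (p , p≤z , z<wp , ep)) =
          [ (λ (u , reach , rest) → inj₁ (u , edge ◅ reach , rest))
          , (λ (u , reach , U , uz , uz+H , eu , sym-u) → inj₂ (u , edge ◅ reach , U , trans uz wz , trans uz+H wz+H ,
            eu , trans sym-u (cong (_+ H) wz)))
          ]′ (dig′ fuel w W z p (lin (lf w z ∷ lf v z ∷ z ∷ []) (λ a b c → a ≐ b ⇒ c ≺ b ⇒ ⊢ c ≺ a) wz z<fz)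
            (lin (p ∷ z ∷ []) (λ a b → a ≺ b ⊕ κ 1 ⇒ ⊢ a ≼ b) p≤z) enclosing ep
            (lin (z ∷ a ∷ + suc fuel ∷ + fuel ∷ p ∷ []) (λ a b c d e → a ≼ b ⊕ c ⇒ c ≐ d ⊕ κ 1 ⇒ b ≺ e ⇒ ⊢ a ≼ e ⊕ d)
            z≤a (pos-suc fuel) (inward p p≤z z<wp)))
          where
          enclosing : lf w z ≤ lf w p
          enclosing with p ≟ z
          ... | yes refl = ℤₚ.≤-refl
          ... | no p≢z   = ℤₚ.<⇒≤
            (Lifted.nested w W (ℤₚ.≤∧≢⇒< {p} {z} (lin (p ∷ z ∷ []) (λ a b → a ≺ b ⊕ κ 1 ⇒ ⊢ a ≼ b) p≤z) p≢z)
            (lin (z ∷ lf w p ∷ []) (λ a b → a ⊕ κ 1 ≼ b ⇒ ⊢ a ≺ b) z<wp))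

  dig : ∀ v → IsNCMatching n v → ∀ z → z < lf v z →
    (∃ λ w → Reach n v w × IsNCMatching n w × NonSym w) ⊎ ∃ (Dug v z)
  dig v V z z<fz with Exposure.cover v V (z + + 1)
  ... | inj₁ free = ⊥-elim (free z (lin (z ∷ []) (λ a → ⊢ a ≺ a ⊕ κ 1))
    (lin (z ∷ lf v z ∷ []) (λ a b → a ≺ b ⇒ ⊢ a ⊕ κ 1 ≼ b) z<fz))
  ... | inj₂ (p , p≤z , z<fp , ep) = dig′ n v V z p z<fz (lin (p ∷ z ∷ []) (λ a b → a ≺ b ⊕ κ 1 ⇒ ⊢ a ≼ b) p≤z)
    enclosing ep (lin (z ∷ lf v p ∷ p ∷ H ∷ + n ∷ []) (λ a b c d e → a ⊕ κ 1 ≼ b ⇒ b ≺ c ⊕ d ⇒ d ≐ e ⇒ ⊢ a ≼ c ⊕ e)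
    z<fp (lf< v p) H≡n)
    where
    enclosing : lf v z ≤ lf v p
    enclosing with p ≟ z
    ... | yes refl = ℤₚ.≤-refl
    ... | no p≢z   = ℤₚ.<⇒≤
      (Lifted.nested v V (ℤₚ.≤∧≢⇒< {p} {z} (lin (p ∷ z ∷ []) (λ a b → a ≺ b ⊕ κ 1 ⇒ ⊢ a ≼ b) p≤z) p≢z)
      (lin (z ∷ lf v p ∷ []) (λ a b → a ⊕ κ 1 ≼ b ⇒ ⊢ a ≺ b) z<fp))

  -- Symmetric matchings

  Sym : Config n → Set
  Sym v = ∀ z → lf v (z + H) ≡ lf v z + H

  antipodal-π : ∀ x → Antipodal n (toℕ (π x)) (toℕ (π (x + H)))
  antipodal-π x with wrap {x} {x + H} (lin (H ∷ x ∷ []) (λ a b → κ 0 ≺ a ⇒ ⊢ b ≼ b ⊕ a) 0<H)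
    (lin (H ∷ x ∷ []) (λ a b → κ 0 ≺ a ⇒ ⊢ b ⊕ a ≺ b ⊕ (a ⊕ a)) 0<H)
  ... | inj₁ e = r-Antipodal⁺ {π x} {π (x + H)}
    (inj₁ (lin (x ∷ H ∷ r (π (x + H)) ∷ r (π x) ∷ []) (λ a b c d → a ⊕ b ⊖ a ≐ c ⊖ d ⇒ ⊢ d ⊕ b ≐ c) e))
  ... | inj₂ e = r-Antipodal⁺ {π x} {π (x + H)}
    (inj₂ (lin (x ∷ H ∷ r (π (x + H)) ∷ r (π x) ∷ []) (λ a b c d → a ⊕ b ⊖ a ≐ c ⊖ d ⊕ (b ⊕ b) ⇒ ⊢ c ⊕ b ≐ d) e))

  π-antipodal : ∀ {i j x} → Antipodal n (toℕ i) (toℕ j) → π x ≡ i → π (x + H) ≡ j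
  π-antipodal {i} {j} {x} anti e = trans (π-shift H (trans e (sym (π-r i))))
    ([ forth , back ]′ (r-Antipodal⁻ {i} {j} anti))
    where
    forth : r i + H ≡ r j → π (r i + H) ≡ j
    forth p = trans (cong π p) (π-r j)
    back : r j + H ≡ r i → π (r i + H) ≡ j
    back p = trans (cong π {r i + H} {r j + (H + H)}
      (lin (r j ∷ H ∷ r i ∷ []) (λ a b c → a ⊕ b ≐ c ⇒ ⊢ c ⊕ b ≐ a ⊕ (b ⊕ b)) p)) (trans (π-+N (r j)) (π-r j))

  symmetric⇒Sym : ∀ {v} → CentrallySymmetric n v → Sym v
  symmetric⇒Sym {v} cs z = lf-unique v
    (π-antipodal (cs (π z) (π (z + H)) (antipodal-π z)) (π-lf v z))
      (lin (z ∷ H ∷ lf v z ∷ []) (λ a b c → a ⊖ b ≼ c ⇒ ⊢ a ⊕ b ⊖ b ≼ c ⊕ b) (lf≥ v z))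
      (lin (lf v z ∷ z ∷ H ∷ []) (λ a b c → a ≺ b ⊕ c ⇒ ⊢ a ⊕ c ≺ b ⊕ c ⊕ c) (lf< v z))

  Sym⇒symmetric : ∀ {v} → Sym v → CentrallySymmetric n v
  Sym⇒symmetric {v} S i j anti = subst₂ (λ k l → Antipodal n (toℕ k) (toℕ l)) (partner-of (π-r i))
    (partner-of (π-antipodal anti (π-r i)))
    (subst (λ y → Antipodal n (toℕ (π (lf v (r i)))) (toℕ (π y))) (sym (S (r i))) (antipodal-π (lf v (r i))))
    where
    partner-of : ∀ {x k} → π x ≡ k → π (lf v x) ≡ lookup v k
    partner-of {x} e = trans (π-lf v x) (cong (lookup v) e)

  -- Only the finitely many residues have to be tested, by decidable equations; hence the negation
  -- yields a witness constructively.
  asymmetric : ∀ {v} → ¬ CentrallySymmetric n v → ∃ λ z → lf v (z + H) ≢ lf v z + H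
  asymmetric {v} ¬cs =
    let i , p = ¬∀⟶∃¬ (2 ℕ.* n) _ (λ i → lf v (r i + H) ≟ lf v (r i) + H) (λ all → ¬cs (Sym⇒symmetric (extend all)))
          in r i , p
    where
    extend : (∀ i → lf v (r i + H) ≡ lf v (r i) + H) → Sym v
    extend all z = lin (lf v (r (π z) + H) ∷ lf v (r (π z)) ∷ H ∷ lf v z ∷ z ∷ r (π z) ∷ lf v (z + H) ∷ [])
      (λ a b c d e f g → a ≐ b ⊕ c ⇒ d ≐ b ⊕ (e ⊖ f) ⇒ g ≐ a ⊕ (e ⊕ c ⊖ (f ⊕ c)) ⇒ ⊢ g ≐ d ⊕ c) (all (π z))
      (lf-shift v {r (π z)} {z} (π-r (π z))) (lf-shift v {r (π z) + H} {z + H} (π-shift H (π-r (π z))))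

  asymmetric-cycle : ∀ v → IsNCMatching n v → ¬ CentrallySymmetric n v → ComponentHasCycle n v
  asymmetric-cycle v V ¬cs = let z , z≢ = asymmetric ¬cs in split z z≢ (ℤₚ.<-cmp z (lf v z))
    where
    open Lifted v V
    from : ∀ z → z < lf v z → lf v (z + H) ≢ lf v z + H → ComponentHasCycle n v
    from z z<fz z≢ = [ (λ (w , reach , W , nonSym) → nonSym-cycle v W reach nonSym)
                     , (λ (w , _ , _ , _ , e , _ , e′) → ⊥-elim (z≢ (trans (sym e) e′))) ]′ (dig v V z z<fz)
    split : ∀ z → lf v (z + H) ≢ lf v z + H → Tri (z < lf v z) (z ≡ lf v z) (lf v z < z) → ComponentHasCycle n v
    split z z≢ (tri< z<fz _ _) = from z z<fz z≢
    split z z≢ (tri≈ _ z≡fz _) = ⊥-elim (irreflexive z (sym z≡fz))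
    -- Digging starts at the left end of an arc. If z is a right end, the asymmetry is carried over
    -- to its partner.
    split z z≢ (tri> _ _ fz<z) =
      from (lf v z) (lin (lf v z ∷ z ∷ lf v (lf v z) ∷ []) (λ a b c → a ≺ b ⇒ c ≐ b ⇒ ⊢ a ≺ c) fz<z (involutive z))
      λ e → z≢ (trans (cong (lf v) (sym (trans e (cong (_+ H) (involutive z))))) (involutive (lf v z + H)))

  Sym-back : ∀ {v} → Sym v → ∀ z → lf v (z - H) ≡ lf v z - H
  Sym-back {v} S z = lin (lf v (z - H + H) ∷ lf v (z - H) ∷ H ∷ lf v z ∷ [])
    (λ a b c d → a ≐ b ⊕ c ⇒ a ≐ d ⇒ ⊢ b ≐ d ⊖ c) (S (z - H))
    (cong (lf v) {z - H + H} {z} (lin (z ∷ H ∷ []) (λ a b → ⊢ a ⊖ b ⊕ b ≐ a)))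

  exposed-+H : ∀ {v} → Sym v → ∀ {a} → Exposed v a → Exposed v (a + H)
  exposed-+H {v} S {a} ea x p q = ea (x - H) (lin (x ∷ a ∷ H ∷ []) (λ a b c → a ≺ b ⊕ c ⇒ ⊢ a ⊖ c ≺ b) p)
    (lin (a ∷ H ∷ lf v x ∷ lf v (x - H) ∷ []) (λ a b c d → a ⊕ b ≺ c ⇒ d ≐ c ⊖ b ⇒ ⊢ a ≺ d) q (Sym-back S x))

  Sym⇒¬NonSym : ∀ {v} → Sym v → ¬ NonSym v
  Sym⇒¬NonSym {v} S (e , free , x , p , q) =
    free (x - H) (lin (x ∷ e ∷ H ∷ []) (λ a b c → a ≺ b ⊕ κ 1 ⊕ c ⇒ ⊢ a ⊖ c ≺ b ⊕ κ 1) p)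
    (lin (e ∷ H ∷ lf v x ∷ lf v (x - H) ∷ []) (λ a b c d → a ⊕ κ 1 ⊕ b ≼ c ⇒ d ≐ c ⊖ b ⇒ ⊢ a ⊕ κ 1 ≼ d) q
    (Sym-back S x))

  π-+H+H : ∀ x → π (x + H + H) ≡ π x
  π-+H+H x = trans (cong π {x + H + H} {x + (H + H)} (lin (x ∷ H ∷ []) (λ a b → ⊢ a ⊕ b ⊕ b ≐ a ⊕ (b ⊕ b)))) (π-+N x)

  π-cancel-H : ∀ {x y} → π (x + H) ≡ π y → π x ≡ π (y + H)
  π-cancel-H {x} e = trans (sym (π-+H+H x)) (π-shift H e)

  -- A flip of two antipodal arcs, seen at one of them.
  record SymFlip (v w : Config n) (a b : ℤ) : Set where
    field
      a<b   : a < b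
      va    : lf v a ≡ b
      ea    : Exposed v a
      wa    : lf w a ≡ b - H
      ew    : Exposed w a
      other : ∀ z → π z ≢ π a → π z ≢ π (a + H) → π z ≢ π b → π z ≢ π (b + H) → lf w z ≡ lf v z

  module _ {v w : Config n} (V : IsNCMatching n v) (W : IsNCMatching n w) (S : Sym v) where
    open Lifted v V
    private
      module W = Lifted w W

    -- By symmetry a + H is exposed and opens an arc to b + H. If c < a + H, the centre condition
    -- `a + H ≤ d` puts a + H under the arc from `c`; if c > a + H, the condition `c ≤ b + H` puts
    -- `c` under the arc from a + H. Equality in either condition would make a point both open and
    -- close an arc. So only antipodal arcs can be flipped together.
    sym-quad : ∀ {a b c d} → Quad v a b c d → c ≡ a + H × d ≡ b + H
    sym-quad {a} {b} {c} {d} Q = c≡ , (lin (d ∷ lf v c ∷ lf v (a + H) ∷ lf v a ∷ H ∷ b ∷ [])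
      (λ a b c d e f → a ≐ b ⇒ b ≐ c ⇒ c ≐ d ⊕ e ⇒ d ≐ f ⇒ ⊢ a ≐ f ⊕ e) (sym vc) (cong (lf v) c≡) (S a) va)
      where
      open Quad Q
      vb : lf v b ≡ a
      vb = trans (cong (lf v) (sym va)) (involutive a)
      c≡ : c ≡ a + H
      c≡ with ℤₚ.<-cmp c (a + H)
      ... | tri≈ _ e _ = e
      ... | tri< c<a+H _ _ with ℤₚ.≤∧≢⇒< {a + H} {d} da≤
        (λ e → (lin (lf v (a + H) ∷ lf v d ∷ lf v a ∷ H ∷ b ∷ a ∷ lf v (lf v c) ∷ c ∷ [])
        (λ a b c d e f g h → a ≐ b ⇒ a ≐ c ⊕ d ⇒ c ≐ e ⇒ f ≺ e ⇒ b ≐ g ⇒ g ≐ h ⇒ h ≺ f ⊕ d ⇒ ⊢⊥) (cong (lf v) e) (S a)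
        va a<b (cong (lf v) (sym vc)) (involutive c) c<a+H))
      ...   | a+H<d = ⊥-elim
        (exposed-+H S ea c c<a+H (lin (a ∷ H ∷ d ∷ lf v c ∷ []) (λ a b c d → a ⊕ b ≺ c ⇒ d ≐ c ⇒ ⊢ a ⊕ b ≺ d) a+H<d
        vc))
      c≡ | tri> _ _ a+H<c with ℤₚ.≤∧≢⇒< {c} {b + H} bc≤
        (λ e → (lin (lf v c ∷ lf v (b + H) ∷ lf v b ∷ H ∷ a ∷ d ∷ c ∷ [])
        (λ a b c d e f g → a ≐ b ⇒ b ≐ c ⊕ d ⇒ c ≐ e ⇒ a ≐ f ⇒ g ≺ f ⇒ e ⊕ d ≺ g ⇒ ⊢⊥) (cong (lf v) e) (S b) vb vc c<d
        a+H<c))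
      ...   | c<b+H = ⊥-elim
        (ec (a + H) a+H<c (lin (c ∷ b ∷ H ∷ lf v (a + H) ∷ lf v a ∷ [])
        (λ a b c d e → a ≺ b ⊕ c ⇒ d ≐ e ⊕ c ⇒ e ≐ b ⇒ ⊢ a ≺ d) c<b+H (S a) va))

    flip⇒symFlip : ∀ {a b c d} → Flip v w a b c d → SymFlip v w a b
    flip⇒symFlip {a} {b} {c} {d} F with sym-quad (Flip.quad F)
    ... | refl , refl = record
      { a<b = a<b ; va = va ; ea = ea ; wa = lin (lf w a ∷ b ∷ H ∷ []) (λ a b c → a ≐ b ⊕ c ⊖ (c ⊕ c) ⇒ ⊢ a ≐ b ⊖ c)
        (FlipFacts.wa V W F)
      ; ew = Exposure.exposed-shift w W (sym (π-+N a))
        (subst (Exposed w) wd (Exposure.exposed-partner w W (FlipFacts.wd-exposed V W F)))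
      ; other = λ z za zc zb zd → other z za zb zc zd }
      where open Flip F

    symFlip⇒Sym : ∀ {a b} → SymFlip v w a b → lf w b ≡ a + H → lf w (a + H) ≡ b → lf w (b + H) ≡ a + (H + H) → Sym w
    symFlip⇒Sym {a} {b} F wb wc wd z with π z ≟ᶠ π a | π z ≟ᶠ π (a + H) | π z ≟ᶠ π b | π z ≟ᶠ π (b + H)
    ... | yes e | _ | _ | _ = lin (lf w z ∷ lf w a ∷ z ∷ a ∷ b ∷ H ∷ lf w (z + H) ∷ lf w (a + H) ∷ [])
      (λ a b c d e f g h → a ≐ b ⊕ (c ⊖ d) ⇒ b ≐ e ⊖ f ⇒ g ≐ h ⊕ (c ⊕ f ⊖ (d ⊕ f)) ⇒ h ≐ e ⇒ ⊢ g ≐ a ⊕ f)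
      (lf-shift w (sym e)) wa (lf-shift w (sym (π-shift H e))) wc
      where open SymFlip F
    ... | no _ | yes e | _ | _ = lin (lf w z ∷ lf w (a + H) ∷ z ∷ a ∷ H ∷ b ∷ lf w (z + H) ∷ lf w a ∷ [])
      (λ a b c d e f g h → a ≐ b ⊕ (c ⊖ (d ⊕ e)) ⇒ b ≐ f ⇒ g ≐ h ⊕ (c ⊕ e ⊖ d) ⇒ h ≐ f ⊖ e ⇒ ⊢ g ≐ a ⊕ e)
      (lf-shift w (sym e)) wc (lf-shift w (sym (trans (π-shift H e) (π-+H+H a)))) wa
      where open SymFlip F
    ... | no _ | no _ | yes e | _ = lin (lf w z ∷ lf w b ∷ z ∷ b ∷ a ∷ H ∷ lf w (z + H) ∷ lf w (b + H) ∷ [])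
      (λ a b c d e f g h → a ≐ b ⊕ (c ⊖ d) ⇒ b ≐ e ⊕ f ⇒ g ≐ h ⊕ (c ⊕ f ⊖ (d ⊕ f)) ⇒ h ≐ e ⊕ (f ⊕ f) ⇒ ⊢ g ≐ a ⊕ f)
      (lf-shift w (sym e)) wb (lf-shift w (sym (π-shift H e))) wd
    ... | no _ | no _ | no _ | yes e = lin (lf w z ∷ lf w (b + H) ∷ z ∷ b ∷ H ∷ a ∷ lf w (z + H) ∷ lf w b ∷ [])
      (λ a b c d e f g h → a ≐ b ⊕ (c ⊖ (d ⊕ e)) ⇒ b ≐ f ⊕ (e ⊕ e) ⇒ g ≐ h ⊕ (c ⊕ e ⊖ d) ⇒ h ≐ f ⊕ e ⇒ ⊢ g ≐ a ⊕ e)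
      (lf-shift w (sym e)) wd (lf-shift w (sym (trans (π-shift H e) (π-+H+H b)))) wb
    ... | no za | no zc | no zb | no zd =
      trans (other (z + H) (λ e → zc (π-cancel-H e)) (λ e → za (trans (π-cancel-H e) (π-+H+H a)))
                           (λ e → zd (π-cancel-H e)) (λ e → zb (trans (π-cancel-H e) (π-+H+H b))))
        (trans (S z) (cong (_+ H) (sym (other z za zc zb zd))))
      where open SymFlip F

    flip⇒Sym : ∀ {a b c d} → Flip v w a b c d → Sym w
    flip⇒Sym F with sym-quad (Flip.quad F)
    ... | refl , refl = symFlip⇒Sym (flip⇒symFlip F) (Flip.wb F) (FlipFacts.wc V W F) (Flip.wd F)

  SymMatching : Config n → Set
  SymMatching v = IsNCMatching n v × Sym v

  HEdge-SymMatching : ∀ {v w} → HEdge n v w → Sym v → SymMatching w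
  HEdge-SymMatching {v} {w} edge@(V , W , _) S =
    let _ , _ , _ , _ , F = HEdge⇒Flip {v} {w} edge in W , flip⇒Sym V W S F

  Reach-SymMatching : ∀ {v w} → Reach n v w → SymMatching v → SymMatching w
  Reach-SymMatching ε            (V , S) = V , S
  Reach-SymMatching {v} (_◅_ {j = u} e es) (_ , S) = Reach-SymMatching es (HEdge-SymMatching {v} {u} e S)

  lf-ext : ∀ {v w} → (∀ z → lf v z ≡ lf w z) → v ≡ w
  lf-ext {v} {w} eq = Config-ext λ i →
    trans (sym (at v i)) (trans (cong π (eq (r i))) (at w i))
    where
    at : ∀ v i → π (lf v (r i)) ≡ lookup v i
    at v i = trans (π-lf v (r i)) (cong (lookup v) (π-r i))

  module _ {v w : Config n} (V : IsNCMatching n v) (W : IsNCMatching n w) where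
    open SymFlip

    symFlip-congruent : ∀ {a b a′} → π a ≡ π a′ → SymFlip v w a b → SymFlip v w a′ (b + (a′ - a))
    symFlip-congruent {a} {b} {a′} e F = record
      { a<b = lin (a ∷ b ∷ a′ ∷ []) (λ a b c → a ≺ b ⇒ ⊢ c ≺ b ⊕ (c ⊖ a)) (a<b F)
      ; va = lin (lf v a′ ∷ lf v a ∷ a′ ∷ a ∷ b ∷ []) (λ a b c d e → a ≐ b ⊕ (c ⊖ d) ⇒ b ≐ e ⇒ ⊢ a ≐ e ⊕ (c ⊖ d))
        (lf-shift v e) (va F)
      ; ea = Exposure.exposed-shift v V (sym e) (ea F)
      ; wa = lin (lf w a′ ∷ lf w a ∷ a′ ∷ a ∷ b ∷ H ∷ [])
        (λ a b c d e f → a ≐ b ⊕ (c ⊖ d) ⇒ b ≐ e ⊖ f ⇒ ⊢ a ≐ e ⊕ (c ⊖ d) ⊖ f) (lf-shift w e) (wa F)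
      ; ew = Exposure.exposed-shift w W (sym e) (ew F)
      ; other = λ z za zc zb zd → other F z (λ p → za (trans p e)) (λ p → zc (trans p (π-shift H e)))
          (λ p → zb (trans p (sym (π-translate e b)))) (λ p → zd (trans p (π-shift H (sym (π-translate e b)))))
      }

    module _ (S : Sym v) (T : Sym w) where
      symFlip-antipode : ∀ {a b} → SymFlip v w a b → SymFlip v w (a + H) (b + H)
      symFlip-antipode {a} {b} F = record
        { a<b = lin (a ∷ b ∷ H ∷ []) (λ a b c → a ≺ b ⇒ ⊢ a ⊕ c ≺ b ⊕ c) (a<b F)
        ; va = lin (lf v (a + H) ∷ lf v a ∷ H ∷ b ∷ []) (λ a b c d → a ≐ b ⊕ c ⇒ b ≐ d ⇒ ⊢ a ≐ d ⊕ c) (S a) (va F)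
        ; ea = exposed-+H S (ea F)
        ; wa = lin (lf w (a + H) ∷ lf w a ∷ H ∷ b ∷ []) (λ a b c d → a ≐ b ⊕ c ⇒ b ≐ d ⊖ c ⇒ ⊢ a ≐ d ⊕ c ⊖ c) (T a)
          (wa F)
        ; ew = exposed-+H T (ew F)
        ; other = λ z za zc zb zd → other F z (λ p → zc (trans p (sym (π-+H+H a)))) za
          (λ p → zd (trans p (sym (π-+H+H b)))) zb
        }

      -- Of two antipodal points one has its residue in [0, H); the flip is viewed at the arc that
      -- opens there.
      symFlip-normal : ∀ {a b} → SymFlip v w a b → ∃ λ a′ → ∃ λ b′ → + 0 ≤ a′ × a′ < H × SymFlip v w a′ b′
      symFlip-normal {a} {b} F with ℤₚ.<-cmp (rep (+ 0) (π a)) H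
      ... | tri< p _ _ = rep (+ 0) (π a) , _ , rep≥ (+ 0) (π a) , p , symFlip-congruent (sym (π-rep (+ 0) (π a))) F
      ... | tri≈ _ p _ = rep (+ 0) (π a) - H , _ , (lin (rep (+ 0) (π a) ∷ H ∷ []) (λ a b → a ≐ b ⇒ ⊢ κ 0 ≼ a ⊖ b) p)
        , (lin (rep (+ 0) (π a) ∷ H ∷ []) (λ a b → a ≐ b ⇒ κ 0 ≺ b ⇒ ⊢ a ⊖ b ≺ b) p 0<H) , symFlip-congruent opposite
        (symFlip-antipode F)
        where
        opposite : π (a + H) ≡ π (rep (+ 0) (π a) - H)
        opposite = sym (π-cancel-H
          (trans (cong π {rep (+ 0) (π a) - H + H} {rep (+ 0) (π a)}
          (lin (rep (+ 0) (π a) ∷ H ∷ []) (λ a b → ⊢ a ⊖ b ⊕ b ≐ a))) (π-rep (+ 0) (π a))))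
      ... | tri> _ _ p = rep (+ 0) (π a) - H , _ , (lin (H ∷ rep (+ 0) (π a) ∷ []) (λ a b → a ≺ b ⇒ ⊢ κ 0 ≼ b ⊖ a) p)
        , (lin (rep (+ 0) (π a) ∷ H ∷ []) (λ a b → a ≺ κ 0 ⊕ (b ⊕ b) ⇒ ⊢ a ⊖ b ≺ b) (rep< (+ 0) (π a))) ,
        symFlip-congruent opposite (symFlip-antipode F)
        where
        opposite : π (a + H) ≡ π (rep (+ 0) (π a) - H)
        opposite = sym (π-cancel-H
          (trans (cong π {rep (+ 0) (π a) - H + H} {rep (+ 0) (π a)}
          (lin (rep (+ 0) (π a) ∷ H ∷ []) (λ a b → ⊢ a ⊖ b ⊕ b ≐ a))) (π-rep (+ 0) (π a))))

  -- After the flip, `a` closes the exposed arc from b - H; flipping this arc and its antipode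
  -- restores `v`.
  symFlip-reverse : ∀ {v w} → SymMatching v → SymMatching w → ∀ {a b} → SymFlip v w a b → SymFlip w v (b - H) a
  symFlip-reverse {v} {w} (V , S) (W , T) {a} {b} F = record
    { a<b = lin (lf v a ∷ a ∷ H ∷ b ∷ []) (λ a b c d → a ≺ b ⊕ c ⇒ a ≐ d ⇒ ⊢ d ⊖ c ≺ b) (lf< v a) va
    ; va = trans (cong (lf w) (sym wa)) (Lifted.involutive w W a)
    ; ea = subst (Exposed w) wa (Exposure.exposed-partner w W ew)
    ; wa = lin (lf v (b - H) ∷ lf v b ∷ H ∷ lf v (lf v a) ∷ a ∷ [])
      (λ a b c d e → a ≐ b ⊖ c ⇒ b ≐ d ⇒ d ≐ e ⇒ ⊢ a ≐ e ⊖ c) (Sym-back S b) (cong (lf v) (sym va))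
      (Lifted.involutive v V a)
    ; ew = λ x p q → exposed-+H S (subst (Exposed v) va (Exposure.exposed-partner v V ea)) (x + (H + H))
      (lin (x ∷ b ∷ H ∷ []) (λ a b c → a ≺ b ⊖ c ⇒ ⊢ a ⊕ (c ⊕ c) ≺ b ⊕ c) p)
      (lin (b ∷ H ∷ lf v x ∷ lf v (x + (H + H)) ∷ []) (λ a b c d → a ⊖ b ≺ c ⇒ d ≐ c ⊕ (b ⊕ b) ⇒ ⊢ a ⊕ b ≺ d) q
      (lf-+N v x))
    ; other = λ z zb zb′ za za′ → sym (other z za za′
        (λ e → zb′ (trans e (cong π {b} {b - H + H} (lin (b ∷ H ∷ []) (λ a b → ⊢ a ≐ a ⊖ b ⊕ b)))))
          (λ e → zb (trans e (trans
          (cong π {b + H} {b - H + (H + H)} (lin (b ∷ H ∷ []) (λ a b → ⊢ a ⊕ b ≐ a ⊖ b ⊕ (b ⊕ b)))) (π-+N (b - H))))))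
    }
    where open SymFlip F

  -- Orienting flips away from gap 0, and acyclicity

  record Up (v w : Config n) (a b : ℤ) : Set where
    field
      0≤a  : + 0 ≤ a
      b<H  : b < H
      flip : SymFlip v w a b
    open SymFlip flip public

  -- In an `Up` step an arc inside [0, H) is exchanged for one over gap 0, so the centre moves away
  -- from the face of that gap. A flip at an arc starting in [0, H) is such a step if the arc ends
  -- before H. Otherwise the reverse flip is one, at the arc from b - H to a.
  orient : ∀ {v w} → HEdge n v w → Sym v → (∃ λ a → ∃ λ b → Up v w a b) ⊎ (∃ λ a → ∃ λ b → Up w v a b)
  orient {v} {w} edge@(V , W , _) S =
    let _ , _ , _ , _ , F = HEdge⇒Flip {v} {w} edge
        T = flip⇒Sym V W S F
        a , b , 0≤a , a<H , G = symFlip-normal V W S T (flip⇒symFlip V W S F)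
    in decide T a b 0≤a a<H G
    where
    decide : Sym w → ∀ a b → + 0 ≤ a → a < H → SymFlip v w a b →
      (∃ λ a → ∃ λ b → Up v w a b) ⊎ (∃ λ a → ∃ λ b → Up w v a b)
    decide T a b 0≤a a<H G with b <? H
    ... | yes b<H = inj₁ (a , b , record { 0≤a = 0≤a ; b<H = b<H ; flip = G })
    ... | no b≮H  = inj₂ (b - H , a , record { 0≤a = (lin (H ∷ b ∷ []) (λ a b → a ≼ b ⇒ ⊢ κ 0 ≼ b ⊖ a) (ℤₚ.≮⇒≥ b≮H)) ;
      b<H = a<H ; flip = symFlip-reverse (V , S) (W , T) G })

  -- The label of a symmetric matching is the right end of the exposed arc over
  -- gap 0, and -1 if there is no such arc.
  data Label (v : Config n) : ℤ → Set where
    none : Free v (+ 0) → Label v -1ℤ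
    top  : ∀ {q} → + 0 ≤ q → lf v q < + 0 → Exposed v q → Label v q

  label : ∀ {v} → IsNCMatching n v → ∃ (Label v)
  label {v} V with Exposure.cover v V (+ 0)
  ... | inj₁ free = -1ℤ , none free
  ... | inj₂ (p , p<0 , 0≤q , ep) = lf v p , top 0≤q
    (lin (lf v (lf v p) ∷ p ∷ []) (λ a b → a ≐ b ⇒ b ≺ κ 0 ⇒ ⊢ a ≺ κ 0) (Lifted.involutive v V p) p<0)
    (Exposure.exposed-partner v V ep)

  module _ {v : Config n} (V : IsNCMatching n v) where
    open Lifted v V

    free-¬top : Free v (+ 0) → ∀ {q} → + 0 ≤ q → lf v q < + 0 → ⊥
    free-¬top free {q} 0≤q fq<0 = free (lf v q) fq<0
      (lin (lf v (lf v q) ∷ q ∷ []) (λ a b → a ≐ b ⇒ κ 0 ≼ b ⇒ ⊢ κ 0 ≼ a) (involutive q) 0≤q)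

    top-≮ : ∀ {q q′} → + 0 ≤ q → Exposed v q → lf v q′ < + 0 → ¬ q < q′
    top-≮ {q} {q′} 0≤q eq fq′<0 q<q′ = eq (lf v q′) (lin (lf v q′ ∷ q ∷ []) (λ a b → a ≺ κ 0 ⇒ κ 0 ≼ b ⇒ ⊢ a ≺ b)
      fq′<0 0≤q) (lin (lf v (lf v q′) ∷ q′ ∷ q ∷ []) (λ a b c → a ≐ b ⇒ c ≺ b ⇒ ⊢ c ≺ a) (involutive q′) q<q′)

    label-unique : ∀ {k l} → Label v k → Label v l → k ≡ l
    label-unique (none _)    (none _)    = refl
    label-unique (none free) (top p q _) = ⊥-elim (free-¬top free p q)
    label-unique (top p q _) (none free) = ⊥-elim (free-¬top free p q)
    label-unique {k} {l} (top p q e) (top p′ q′ e′) with ℤₚ.<-cmp k l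
    ... | tri< k<l _ _ = ⊥-elim (top-≮ p e q′ k<l)
    ... | tri≈ _ k≡l _ = k≡l
    ... | tri> _ _ l<k = ⊥-elim (top-≮ p′ e′ q l<k)

  module _ {v w : Config n} {a b : ℤ} (V : IsNCMatching n v) (U : Up v w a b) where
    open Up U

    up-label : Label w a
    up-label = top 0≤a (lin (lf w a ∷ b ∷ H ∷ []) (λ a b c → a ≐ b ⊖ c ⇒ b ≺ c ⇒ ⊢ a ≺ κ 0) wa b<H) ew

    -- The exposed arc over gap 0 ends at k, while `a` is exposed as well. For k > a it would pass
    -- over `a`, and k = a is impossible because `a` opens an arc.
    up-increases : ∀ {k} → Label v k → k < a
    up-increases (none _) = ℤₚ.<-≤-trans -<+ 0≤a
    up-increases {k} (top p q e) with ℤₚ.<-cmp k a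
    ... | tri< k<a _ _  = k<a
    ... | tri≈ _ refl _ = ⊥-elim (lin (lf v k ∷ b ∷ k ∷ []) (λ a b c → a ≐ b ⇒ a ≺ κ 0 ⇒ c ≺ b ⇒ κ 0 ≼ c ⇒ ⊢⊥) va q
      a<b p)
    ... | tri> _ _ a<k  = ⊥-elim (top-≮ V 0≤a ea q a<k)

  -- The lower neighbour is obtained by flipping the exposed arc over gap 0.
  up-unique : ∀ {u u′ w a b a′ b′} → SymMatching u → SymMatching u′ → IsNCMatching n w →
    Up u w a b → Up u′ w a′ b′ → u ≡ u′
  up-unique {u} {u′} {w} {a} {b} {a′} {b′} (U , S) (U′ , S′) W F F′ =
    conclude (label-unique W (up-label U F) (up-label U′ F′))
    where
    module F = Up F
    conclude : a ≡ a′ → u ≡ u′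
    conclude refl = lf-ext agree
      where
      module F′ = Up F′
      b≡b′ : b ≡ b′
      b≡b′ = lin (lf w a ∷ b ∷ H ∷ b′ ∷ []) (λ a b c d → a ≐ b ⊖ c ⇒ a ≐ d ⊖ c ⇒ ⊢ b ≐ d) F.wa F′.wa
      at-b : ∀ {x} → IsNCMatching n x → lf x a ≡ b → lf x b ≡ a
      at-b {x} X e = trans (cong (lf x) (sym e)) (Lifted.involutive x X a)
      ub : lf u b ≡ a
      ub = at-b U F.va
      u′b : lf u′ b ≡ a
      u′b = at-b U′ (trans F′.va (sym b≡b′))
      agree : ∀ z → lf u z ≡ lf u′ z
      agree z with π z ≟ᶠ π a | π z ≟ᶠ π (a + H) | π z ≟ᶠ π b | π z ≟ᶠ π (b + H)
      ... | yes e | _ | _ | _ = lin (lf u z ∷ lf u a ∷ z ∷ a ∷ lf u′ z ∷ lf u′ a ∷ b ∷ b′ ∷ [])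
        (λ a b c d e f g h → a ≐ b ⊕ (c ⊖ d) ⇒ e ≐ f ⊕ (c ⊖ d) ⇒ b ≐ g ⇒ f ≐ h ⇒ g ≐ h ⇒ ⊢ a ≐ e) (lf-shift u (sym e))
        (lf-shift u′ (sym e)) F.va F′.va b≡b′
      ... | no _ | yes e | _ | _ =
        lin (lf u z ∷ lf u (a + H) ∷ z ∷ a ∷ H ∷ lf u′ z ∷ lf u′ (a + H) ∷ lf u a ∷ lf u′ a ∷ b ∷ b′ ∷ [])
        (λ a b c d e f g h i j k → a ≐ b ⊕ (c ⊖ (d ⊕ e)) ⇒ f ≐ g ⊕ (c ⊖ (d ⊕ e)) ⇒ b ≐ h ⊕ e ⇒ g ≐ i ⊕ e ⇒ h ≐ j ⇒ i ≐
        k ⇒ j ≐ k ⇒ ⊢ a ≐ f) (lf-shift u (sym e)) (lf-shift u′ (sym e)) (S a) (S′ a) F.va F′.va b≡b′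
      ... | no _ | no _ | yes e | _ = lin (lf u z ∷ lf u b ∷ z ∷ b ∷ lf u′ z ∷ lf u′ b ∷ a ∷ [])
        (λ a b c d e f g → a ≐ b ⊕ (c ⊖ d) ⇒ e ≐ f ⊕ (c ⊖ d) ⇒ b ≐ g ⇒ f ≐ g ⇒ ⊢ a ≐ e) (lf-shift u (sym e))
        (lf-shift u′ (sym e)) ub u′b
      ... | no _ | no _ | no _ | yes e =
        lin (lf u z ∷ lf u (b + H) ∷ z ∷ b ∷ H ∷ lf u′ z ∷ lf u′ (b + H) ∷ lf u b ∷ lf u′ b ∷ a ∷ [])
        (λ a b c d e f g h i j → a ≐ b ⊕ (c ⊖ (d ⊕ e)) ⇒ f ≐ g ⊕ (c ⊖ (d ⊕ e)) ⇒ b ≐ h ⊕ e ⇒ g ≐ i ⊕ e ⇒ h ≐ j ⇒ i ≐ j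
        ⇒ ⊢ a ≐ f) (lf-shift u (sym e)) (lf-shift u′ (sym e)) (S b) (S′ b) ub u′b
      ... | no za | no zc | no zb | no zd = trans (sym (F.other z za zc zb zd))
        (F′.other z za zc (λ e → zb (trans e (cong π (sym b≡b′))))
          (λ e → zd (trans e (cong (λ y → π (y + H)) (sym b≡b′)))))

  Rising : Config n → Config n → Set
  Rising v w = ∃ λ a → ∃ λ b → Up v w a b

  Below : Config n → Config n → Set
  Below v w = ∀ k l → Label v k → Label w l → k < l

  rising⇒below : ∀ {v w} → SymMatching v → SymMatching w → Rising v w → Below v w
  rising⇒below {v} {w} (V , _) (W , _) (a , b , U) k l lv lw with label-unique W lw (up-label V U)
  ... | refl = up-increases V U lv

  below-trans : ∀ {u v w} → SymMatching v → Below u v → Below v w → Below u w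
  below-trans (V , _) p q j l lu lw = let k , lv = label V in ℤₚ.<-trans (p j k lu lv) (q k l lv lw)

  below-irrefl : ∀ {v} → SymMatching v → ¬ Below v v
  below-irrefl (V , _) p = let k , l = label V in ℤₚ.<-irrefl refl (p k k l l)

  -- Walk x y p e: a walk without immediate reversals that starts with the
  -- step from x to y and ends with the step from p to e.
  data Walk : (x y p e : Config n) → Set where
    stop : ∀ {x e} → HEdge n x e → Walk x e x e
    step : ∀ {x y z p e} → HEdge n x y → x ≢ z → Walk y z p e → Walk x y p e

  first-edge : ∀ {x y p e} → Walk x y p e → HEdge n x y
  first-edge (stop edge)     = edge
  first-edge (step edge _ _) = edge

  -- Once risen, always rising: a step down from `y` would lead to its only lower neighbour, which
  -- is `x`, and reversals are excluded. Hence the label grows along the whole walk.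
  ascend : ∀ {x y p e} → SymMatching x → Walk x y p e → Rising x y → Below x e × Rising p e
  ascend {x} {e = e} X (stop edge) up = rising⇒below X (HEdge-SymMatching {x} {e} edge (proj₂ X)) up , up
  ascend {x} {y} X (step {z = z} edge x≢z walk) up@(_ , _ , U) =
    [ (λ up′ → let below , last = ascend Y walk up′ in below-trans Y (rising⇒below X Y up) below , last)
    , (λ (_ , _ , U′) → ⊥-elim (x≢z (up-unique X (HEdge-SymMatching {y} {z} (first-edge walk) (proj₂ Y)) (proj₁ Y) U
      U′)))
    ]′ (orient {y} {z} (first-edge walk) (proj₂ Y))
    where
    Y : SymMatching y
    Y = HEdge-SymMatching {x} {y} edge (proj₂ X)

  -- A walk descends for a while and, from its first rise on, keeps rising. It therefore either ends
  -- with a rise or descends throughout.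
  rises-at-end : ∀ {x y p e} → SymMatching x → Walk x y p e → Rising p e ⊎ Below e x
  rises-at-end {x} {e = e} X (stop edge) =
    [ inj₁ , (λ down → inj₂ (rising⇒below (HEdge-SymMatching {x} {e} edge (proj₂ X)) X down)) ]′
      (orient {x} {e} edge (proj₂ X))
  rises-at-end {x} {y} X (step edge x≢z walk) =
    [ (λ up → inj₁ (proj₂ (ascend X (step edge x≢z walk) up)))
    , (λ down → [ inj₁ , (λ below → inj₂ (below-trans Y below (rising⇒below Y X down))) ]′ (rises-at-end Y walk))
    ]′ (orient {x} {y} edge (proj₂ X))
    where
    Y : SymMatching y
    Y = HEdge-SymMatching {x} {y} edge (proj₂ X)

  lastOf : Config n → List (Config n) → Config n
  lastOf x []       = x
  lastOf x (y ∷ ys) = lastOf y ys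

  headOf : List (Config n) → Config n → Config n
  headOf []      e = e
  headOf (y ∷ _) e = y

  walk-along : ∀ y ys e → Linked (HEdge n) (y ∷ ys ++ [ e ]) → Unique (y ∷ ys) → All (_≢ e) (y ∷ ys) →
    Walk y (headOf ys e) (lastOf y ys) e
  walk-along y []           e (edge ∷ _)      _            _          = stop edge
  walk-along y (z ∷ [])     e (edge ∷ linked) (_ ∷ unique) (y≢e ∷ ne) =
    step edge y≢e (walk-along z [] e linked unique ne)
  walk-along y (z ∷ u ∷ us) e (edge ∷ linked) ((_ ∷ y≢u ∷ _) ∷ unique) (_ ∷ ne) =
    step edge y≢u (walk-along z (u ∷ us) e linked unique ne)

  lastOf-∈ : ∀ z zs → lastOf z zs ∈ z ∷ zs
  lastOf-∈ z []       = here refl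
  lastOf-∈ z (u ∷ us) = there (lastOf-∈ u us)

  -- Traverse the cycle once. If the first step rises, the label has grown on return. If it descends
  -- to `y`, the walk either descends all the way, again changing the label, or comes back to `x` by
  -- a rise from the last vertex; then this vertex and `y` are two distinct lower neighbours of `x`.
  symmetric-acyclic : ∀ {v} → SymMatching v → ComponentIsTree n v
  symmetric-acyclic M (x ∷ [] , (() , _) , _)
  symmetric-acyclic M (x ∷ y ∷ [] , (s≤s () , _) , _)
  symmetric-acyclic M (x ∷ y ∷ z ∷ zs , (_ , (x≢ ∷ unique@(y≢ ∷ _)) , edge ∷ linked) , reach ∷ _) =
    [ (λ up → below-irrefl X (proj₁ (ascend X walk up)))
    , (λ (_ , _ , down) → [ (λ (_ , _ , up) → All.lookup y≢ (lastOf-∈ z zs) (up-unique Y P (proj₁ X) down up))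
                          , below-irrefl X ]′ (rises-at-end X walk))
    ]′ (orient {x} {y} edge (proj₂ X))
    where
    X : SymMatching x
    X = Reach-SymMatching reach M
    Y : SymMatching y
    Y = HEdge-SymMatching {x} {y} edge (proj₂ X)
    ne : All (_≢ x) (y ∷ z ∷ zs)
    ne = All.map (λ p e → p (sym e)) x≢
    walk : Walk x y (lastOf z zs) x
    walk = step edge (All.lookup x≢ (there (here refl))) (walk-along y (z ∷ zs) x linked unique ne)
    P : SymMatching (lastOf z zs)
    P = walk-last X walk
      where
      walk-last : ∀ {x y p e} → SymMatching x → Walk x y p e → SymMatching p
      walk-last X (stop _) = X
      walk-last {x} {y} X (step edge _ walk) = walk-last (HEdge-SymMatching {x} {y} edge (proj₂ X)) walk

  -- The components of symmetric matchings

  -- Equality of the matchings induced on residues modulo n, the invariant of a component. Both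
  -- lifts stay within H of z, so only the differences 0, H and -H can occur.
  SameModH : Config n → Config n → Set
  SameModH v w = ∀ z → lf w z ≡ lf v z ⊎ lf w z ≡ lf v z + H ⊎ lf w z + H ≡ lf v z

  sameModH-sym : ∀ {v w} → SameModH v w → SameModH w v
  sameModH-sym K z with K z
  ... | inj₁ e        = inj₁ (sym e)
  ... | inj₂ (inj₁ e) = inj₂ (inj₂ (sym e))
  ... | inj₂ (inj₂ e) = inj₂ (inj₁ (sym e))

  -- Two shifts in the same direction would add up to 2H, which is impossible between two partners
  -- that both lie strictly within H of z.
  sameModH-trans : ∀ {u v w} → IsNCMatching n u → IsNCMatching n w → SameModH u v → SameModH v w → SameModH u w
  sameModH-trans {u} {v} {w} U W K L z with K z | L z
  ... | inj₁ e        | inj₁ f        = inj₁ (lin (lf v z ∷ lf u z ∷ lf w z ∷ []) (λ a b c → a ≐ b ⇒ c ≐ a ⇒ ⊢ c ≐ b)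
    e f)
  ... | inj₁ e        | inj₂ (inj₁ f) =
    inj₂ (inj₁ (lin (lf v z ∷ lf u z ∷ lf w z ∷ H ∷ []) (λ a b c d → a ≐ b ⇒ c ≐ a ⊕ d ⇒ ⊢ c ≐ b ⊕ d) e f))
  ... | inj₁ e        | inj₂ (inj₂ f) =
    inj₂ (inj₂ (lin (lf v z ∷ lf u z ∷ lf w z ∷ H ∷ []) (λ a b c d → a ≐ b ⇒ c ⊕ d ≐ a ⇒ ⊢ c ⊕ d ≐ b) e f))
  ... | inj₂ (inj₁ e) | inj₁ f        =
    inj₂ (inj₁ (lin (lf v z ∷ lf u z ∷ H ∷ lf w z ∷ []) (λ a b c d → a ≐ b ⊕ c ⇒ d ≐ a ⇒ ⊢ d ≐ b ⊕ c) e f))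
  ... | inj₂ (inj₁ e) | inj₂ (inj₁ f) =
    ⊥-elim (lin (lf v z ∷ lf u z ∷ H ∷ lf w z ∷ z ∷ [])
    (λ a b c d e → a ≐ b ⊕ c ⇒ d ≐ a ⊕ c ⇒ d ≺ e ⊕ c ⇒ e ⊖ c ≺ b ⇒ ⊢⊥) e f (lf< w z) (Lifted.lf> u U z))
  ... | inj₂ (inj₁ e) | inj₂ (inj₂ f) =
    inj₁ (lin (lf v z ∷ lf u z ∷ H ∷ lf w z ∷ []) (λ a b c d → a ≐ b ⊕ c ⇒ d ⊕ c ≐ a ⇒ ⊢ d ≐ b) e f)
  ... | inj₂ (inj₂ e) | inj₁ f        =
    inj₂ (inj₂ (lin (lf v z ∷ H ∷ lf u z ∷ lf w z ∷ []) (λ a b c d → a ⊕ b ≐ c ⇒ d ≐ a ⇒ ⊢ d ⊕ b ≐ c) e f))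
  ... | inj₂ (inj₂ e) | inj₂ (inj₁ f) =
    inj₁ (lin (lf v z ∷ H ∷ lf u z ∷ lf w z ∷ []) (λ a b c d → a ⊕ b ≐ c ⇒ d ≐ a ⊕ b ⇒ ⊢ d ≐ c) e f)
  ... | inj₂ (inj₂ e) | inj₂ (inj₂ f) =
    ⊥-elim (lin (lf v z ∷ H ∷ lf u z ∷ lf w z ∷ z ∷ [])
    (λ a b c d e → a ⊕ b ≐ c ⇒ d ⊕ b ≐ a ⇒ c ≺ e ⊕ b ⇒ e ⊖ b ≺ d ⇒ ⊢⊥) e f (lf< u z) (Lifted.lf> w W z))

  symFlip⇒sameModH : ∀ {v w a b} → SymMatching v → SymMatching w → SymFlip v w a b → SameModH v w
  symFlip⇒sameModH {v} {w} {a} {b} (V , S) (W , T) F z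
    with π z ≟ᶠ π a | π z ≟ᶠ π (a + H) | π z ≟ᶠ π b | π z ≟ᶠ π (b + H)
  ... | yes e | _ | _ | _ =
    inj₂ (inj₂ (lin (lf w z ∷ lf w a ∷ z ∷ a ∷ lf v z ∷ lf v a ∷ b ∷ H ∷ [])
    (λ a b c d e f g h → a ≐ b ⊕ (c ⊖ d) ⇒ e ≐ f ⊕ (c ⊖ d) ⇒ f ≐ g ⇒ b ≐ g ⊖ h ⇒ ⊢ a ⊕ h ≐ e) (lf-shift w (sym e))
    (lf-shift v (sym e)) (SymFlip.va F) (SymFlip.wa F)))
  ... | no _ | yes e | _ | _ =
    inj₂ (inj₂ (lin (lf w z ∷ lf w (a + H) ∷ z ∷ a ∷ H ∷ lf v z ∷ lf v (a + H) ∷ lf v a ∷ lf w a ∷ b ∷ [])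
    (λ a b c d e f g h i j → a ≐ b ⊕ (c ⊖ (d ⊕ e)) ⇒ f ≐ g ⊕ (c ⊖ (d ⊕ e)) ⇒ g ≐ h ⊕ e ⇒ b ≐ i ⊕ e ⇒ h ≐ j ⇒ i ≐ j ⊖ e
    ⇒ ⊢ a ⊕ e ≐ f) (lf-shift w (sym e)) (lf-shift v (sym e)) (S a) (T a) (SymFlip.va F) (SymFlip.wa F)))
  ... | no _ | no _ | yes e | _ =
    inj₂ (inj₁ (lin (lf w z ∷ lf w b ∷ z ∷ b ∷ lf v z ∷ lf v b ∷ a ∷ H ∷ [])
    (λ a b c d e f g h → a ≐ b ⊕ (c ⊖ d) ⇒ e ≐ f ⊕ (c ⊖ d) ⇒ f ≐ g ⇒ b ≐ g ⊕ h ⇒ ⊢ a ≐ e ⊕ h) (lf-shift w (sym e))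
    (lf-shift v (sym e)) vb wb))
    where
    vb : lf v b ≡ a
    vb = trans (cong (lf v) (sym (SymFlip.va F))) (Lifted.involutive v V a)
    wb : lf w b ≡ a + H
    wb = lin (lf w (b - H) ∷ lf w b ∷ H ∷ lf w (lf w a) ∷ a ∷ [])
      (λ a b c d e → a ≐ b ⊖ c ⇒ a ≐ d ⇒ d ≐ e ⇒ ⊢ b ≐ e ⊕ c) (Sym-back T b) (cong (lf w) (sym (SymFlip.wa F)))
      (Lifted.involutive w W a)
  ... | no _ | no _ | no _ | yes e =
    inj₂ (inj₁ (lin (lf w z ∷ lf w (b + H) ∷ z ∷ b ∷ H ∷ lf v z ∷ lf v (b + H) ∷ lf v b ∷ lf w b ∷ a ∷ [])
    (λ a b c d e f g h i j → a ≐ b ⊕ (c ⊖ (d ⊕ e)) ⇒ f ≐ g ⊕ (c ⊖ (d ⊕ e)) ⇒ g ≐ h ⊕ e ⇒ b ≐ i ⊕ e ⇒ h ≐ j ⇒ i ≐ j ⊕ e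
    ⇒ ⊢ a ≐ f ⊕ e) (lf-shift w (sym e)) (lf-shift v (sym e)) (S b) (T b) vb wb))
    where
    vb : lf v b ≡ a
    vb = trans (cong (lf v) (sym (SymFlip.va F))) (Lifted.involutive v V a)
    wb : lf w b ≡ a + H
    wb = lin (lf w (b - H) ∷ lf w b ∷ H ∷ lf w (lf w a) ∷ a ∷ [])
      (λ a b c d e → a ≐ b ⊖ c ⇒ a ≐ d ⇒ d ≐ e ⇒ ⊢ b ≐ e ⊕ c) (Sym-back T b) (cong (lf w) (sym (SymFlip.wa F)))
      (Lifted.involutive w W a)
  ... | no za | no zc | no zb | no zd = inj₁ (SymFlip.other F z za zc zb zd)

  Reach⇒sameModH : ∀ {v w} → Reach n v w → SymMatching v → SameModH v w
  Reach⇒sameModH ε _ z = inj₁ refl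
  Reach⇒sameModH {v} {w} (_◅_ {j = u} edge reach) (V , S) =
    let _ , _ , _ , _ , F = HEdge⇒Flip {v} {u} edge
        U = HEdge-SymMatching {v} {u} edge S
    in sameModH-trans V (proj₁ (Reach-SymMatching reach U))
         (symFlip⇒sameModH (V , S) U (flip⇒symFlip V (proj₁ U) S F)) (Reach⇒sameModH reach U)

  -- One point of [0, H) serves all symmetric matchings at once, so two of them can be compared
  -- there.
  normalise : ∀ z → ∃ λ z′ → + 0 ≤ z′ × z′ < H × (∀ u → Sym u → lf u z ≡ lf u z′ + (z - z′))
  normalise z with rep (+ 0) (π z) <? H
  ... | yes p = rep (+ 0) (π z) , rep≥ (+ 0) (π z) , p , λ u _ → lf-shift u (π-rep (+ 0) (π z))
  ... | no ¬p = rep (+ 0) (π z) - H , (lin (H ∷ rep (+ 0) (π z) ∷ []) (λ a b → a ≼ b ⇒ ⊢ κ 0 ≼ b ⊖ a) (ℤₚ.≮⇒≥ ¬p)) ,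
    (lin (rep (+ 0) (π z) ∷ H ∷ []) (λ a b → a ≺ κ 0 ⊕ (b ⊕ b) ⇒ ⊢ a ⊖ b ≺ b) (rep< (+ 0) (π z))) ,
    λ u S → (lin (lf u z ∷ lf u (rep (+ 0) (π z)) ∷ z ∷ rep (+ 0) (π z) ∷ lf u (rep (+ 0) (π z) - H) ∷ H ∷ [])
      (λ a b c d e f → a ≐ b ⊕ (c ⊖ d) ⇒ e ≐ b ⊖ f ⇒ ⊢ a ≐ e ⊕ (c ⊖ (d ⊖ f))) (lf-shift u (π-rep (+ 0) (π z)))
      (Sym-back S (rep (+ 0) (π z))))

  -- In w, the arc that joins y - H to z passes over gap 0, hence under the top
  -- arc; in v, this top arc would cross the arc from z to y.
  label-clash : ∀ {v w} → IsNCMatching n v → IsNCMatching n w → SameModH v w → ∀ {k} → Label v k → Label w k →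
    ∀ {z y} → + 0 ≤ z → z < y → y < H → lf v z ≡ y → lf w z ≡ y - H → ⊥
  label-clash {v} {w} V W K lv (none free) {z} {y} 0≤z z<y y<H vz wz = free-¬top W free 0≤z
    (lin (lf w z ∷ y ∷ H ∷ []) (λ a b c → a ≐ b ⊖ c ⇒ b ≺ c ⇒ ⊢ a ≺ κ 0) wz y<H)
  label-clash {v} {w} V W K (none _) (top () _ _)
  label-clash {v} {w} V W K {q} (top _ vq<0 _) (top 0≤q wq<0 eq) {z} {y} 0≤z z<y y<H vz wz with ℤₚ.<-cmp z q
  ... | tri≈ _ refl _ = lin (lf v q ∷ y ∷ q ∷ []) (λ a b c → a ≺ κ 0 ⇒ a ≐ b ⇒ κ 0 ≼ c ⇒ c ≺ b ⇒ ⊢⊥) vq<0 vz 0≤z z<y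
  ... | tri> _ _ q<z  = top-≮ W {q} {z} 0≤q eq (lin (lf w z ∷ y ∷ H ∷ []) (λ a b c → a ≐ b ⊖ c ⇒ b ≺ c ⇒ ⊢ a ≺ κ 0) wz
    y<H) q<z
  ... | tri< z<q _ _  = lin (lf v q ∷ lf w q ∷ q ∷ H ∷ lf w z ∷ y ∷ lf v z ∷ [])
    (λ a b c d e f g → a ≐ b ⇒ c ⊖ d ≺ a ⇒ b ≺ e ⇒ e ≐ f ⊖ d ⇒ g ≐ f ⇒ g ≺ c ⇒ ⊢⊥) p≡ (Lifted.lf> v V q) below wz vz
    inside
    where
    p≡ : lf v q ≡ lf w q
    p≡ = [ sym , [ (λ e → ⊥-elim
      (lin (lf w q ∷ lf v q ∷ H ∷ q ∷ []) (λ a b c d → a ≐ b ⊕ c ⇒ a ≺ κ 0 ⇒ d ⊖ c ≺ b ⇒ κ 0 ≼ d ⇒ ⊢⊥) e wq<0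
      (Lifted.lf> v V q) 0≤q)) ,
      (λ e → ⊥-elim (lin (lf w q ∷ H ∷ lf v q ∷ q ∷ []) (λ a b c d → a ⊕ b ≐ c ⇒ c ≺ κ 0 ⇒ d ⊖ b ≺ a ⇒ κ 0 ≼ d ⇒ ⊢⊥) e
      vq<0 (Lifted.lf> w W q) 0≤q)) ]′ ]′ (K q)
    below : lf w q < lf w z
    below = Lifted.nestedˡ w W {lf w q} {z} (lin (lf w q ∷ z ∷ []) (λ a b → a ≺ κ 0 ⇒ κ 0 ≼ b ⇒ ⊢ a ≺ b) wq<0 0≤z)
      (lin (lf w (lf w q) ∷ q ∷ z ∷ []) (λ a b c → a ≐ b ⇒ c ≺ b ⇒ ⊢ c ≺ a) (Lifted.involutive w W q) z<q)
    inside : lf v z < q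
    inside = lin (lf v z ∷ lf v (lf v q) ∷ q ∷ []) (λ a b c → a ≺ b ⇒ b ≐ c ⇒ ⊢ a ≺ c)
      (Lifted.nested v V {lf v q} {z} (lin (lf v q ∷ z ∷ []) (λ a b → a ≺ κ 0 ⇒ κ 0 ≼ b ⇒ ⊢ a ≺ b) vq<0 0≤z)
      (lin (lf v (lf v q) ∷ q ∷ z ∷ []) (λ a b c → a ≐ b ⇒ c ≺ b ⇒ ⊢ c ≺ a) (Lifted.involutive v V q) z<q))
      (Lifted.involutive v V q)

  -- Where the two matchings differ, one partner is the other lowered by H. This is turned into an
  -- arc that lies inside [0, H) in one matching and is replaced by an arc over gap 0 in the other,
  -- which `label-clash` forbids.
  label-injective : ∀ {v w} → SymMatching v → SymMatching w → SameModH v w → ∀ {k} → Label v k → Label w k → v ≡ w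
  label-injective {v} {w} (V , S) (W , T) K lv lw = lf-ext λ z → agree z (normalise z)
    where
    lowered : ∀ {v w} → SymMatching v → SymMatching w → SameModH v w → ∀ {k} → Label v k → Label w k →
      ∀ {z} → + 0 ≤ z → z < H → lf w z + H ≡ lf v z → ⊥
    lowered {v} {w} (V , S) (W , T) K lv lw {z} 0≤z z<H e with lf v z <? H
    ... | yes p = label-clash V W K lv lw 0≤z
      (lin (lf w z ∷ H ∷ lf v z ∷ z ∷ []) (λ a b c d → a ⊕ b ≐ c ⇒ d ⊖ b ≺ a ⇒ ⊢ d ≺ c) e (Lifted.lf> w W z)) p refl
      (lin (lf w z ∷ H ∷ lf v z ∷ []) (λ a b c → a ⊕ b ≐ c ⇒ ⊢ a ≐ c ⊖ b) e)
    -- Here z is joined beyond H in `v`. The exchange of `v` and `w` makes the arc from `lf w z` to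
    -- z the one inside [0, H).
    ... | no ¬p = label-clash W V (sameModH-sym K) lw lv {lf w z} {z}
      (lin (lf w z ∷ H ∷ lf v z ∷ []) (λ a b c → a ⊕ b ≐ c ⇒ b ≼ c ⇒ ⊢ κ 0 ≼ a) e (ℤₚ.≮⇒≥ ¬p))
      (lin (lf w z ∷ H ∷ lf v z ∷ z ∷ []) (λ a b c d → a ⊕ b ≐ c ⇒ c ≺ d ⊕ b ⇒ ⊢ a ≺ d) e (lf< v z)) z<H
      (Lifted.involutive w W z)
      (lin (lf v (lf w z + H) ∷ lf v (lf v z) ∷ z ∷ lf v (lf w z) ∷ H ∷ [])
        (λ a b c d e → a ≐ b ⇒ b ≐ c ⇒ a ≐ d ⊕ e ⇒ ⊢ d ≐ c ⊖ e) (cong (lf v) {lf w z + H} {lf v z} e)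
        (Lifted.involutive v V z) (S (lf w z)))
    agree : ∀ z → (∃ λ z′ → + 0 ≤ z′ × z′ < H × (∀ u → Sym u → lf u z ≡ lf u z′ + (z - z′))) → lf v z ≡ lf w z
    agree z (z′ , 0≤z′ , z′<H , shift) with K z′
    ... | inj₁ e        = lin (lf w z′ ∷ lf v z′ ∷ lf v z ∷ z ∷ z′ ∷ lf w z ∷ [])
      (λ a b c d e f → a ≐ b ⇒ c ≐ b ⊕ (d ⊖ e) ⇒ f ≐ a ⊕ (d ⊖ e) ⇒ ⊢ c ≐ f) e (shift v S) (shift w T)
    ... | inj₂ (inj₁ e) = ⊥-elim (lowered (W , T) (V , S) (sameModH-sym K) lw lv 0≤z′ z′<H (sym e))
    ... | inj₂ (inj₂ e) = ⊥-elim (lowered (V , S) (W , T) K lv lw 0≤z′ z′<H e)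

  antipodal-quad : ∀ {v} → SymMatching v → ∀ {a b} → a < b → lf v a ≡ b → Exposed v a → Quad v a b (a + H) (b + H)
  antipodal-quad {v} (V , S) {a} {b} a<b va ea = record
    { a<b = a<b ; b<c = b<a+H ; c<d = (lin (a ∷ b ∷ H ∷ []) (λ a b c → a ≺ b ⇒ ⊢ a ⊕ c ≺ b ⊕ c) a<b) ; d<a =
      (lin (b ∷ a ∷ H ∷ []) (λ a b c → a ≺ b ⊕ c ⇒ ⊢ a ⊕ c ≺ b ⊕ (c ⊕ c)) b<a+H) ; va = va ; vc =
      trans (S a) (cong (_+ H) va)
    ; ea = ea ; ec = exposed-+H S ea ; bc≤ = (lin (a ∷ b ∷ H ∷ []) (λ a b c → a ≺ b ⇒ ⊢ a ⊕ c ≼ b ⊕ c) a<b) ; da≤ =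
      (lin (a ∷ b ∷ H ∷ []) (λ a b c → a ≺ b ⇒ ⊢ a ⊕ c ≼ b ⊕ c) a<b) }
    where
    b<a+H : b < a + H
    b<a+H = lin (lf v a ∷ b ∷ a ∷ H ∷ []) (λ a b c d → a ≐ b ⇒ a ≺ c ⊕ d ⇒ ⊢ b ≺ c ⊕ d) va (lf< v a)

  -- Flipping the exposed arc over gap 0 together with its antipode is the step down. It lowers the
  -- label, until no arc is left over gap 0.
  root : ∀ fuel {v} → SymMatching v → ∀ {k} → Label v k → k < + fuel → ∃ λ w → Reach n v w × Free w (+ 0)
  root fuel {v} M (none free) _ = v , ε , free
  root zero M {k} (top 0≤q _ _) q<0 = ⊥-elim (lin (k ∷ []) (λ a → κ 0 ≼ a ⇒ a ≺ κ 0 ⇒ ⊢⊥) 0≤q q<0)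
  root (suc fuel) {v} (V , S) {q} (top 0≤q p<0 eq) q< = continue
    (QuadFacts.flip V (antipodal-quad (V , S) {lf v q} {q}
      (lin (lf v q ∷ q ∷ []) (λ a b → a ≺ κ 0 ⇒ κ 0 ≼ b ⇒ ⊢ a ≺ b) p<0 0≤q) (Lifted.involutive v V q)
      (Exposure.exposed-partner v V eq)))
    where
    continue : (∃ λ w → HEdge n v w × Flip v w (lf v q) q (lf v q + H) (q + H)) → ∃ λ w → Reach n v w × Free w (+ 0)
    continue (w , edge@(_ , W , _) , F) =
      let k , lw = label W
          u , reach , free = root fuel (W , T) lw (lin (k ∷ q ∷ + suc fuel ∷ + fuel ∷ [])
            (λ a b c d → a ≺ b ⇒ b ≺ c ⇒ c ≐ d ⊕ κ 1 ⇒ ⊢ a ≺ d) (up-increases W up lw) q< (pos-suc fuel))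
      in u , edge ◅ reach , free
      where
      T : Sym w
      T = flip⇒Sym V W S F
      back : SymFlip w v q (lf v q + H)
      back = subst (λ x → SymFlip w v x (lf v q + H)) (lin (q ∷ H ∷ []) (λ a b → ⊢ a ⊖ b ⊕ b ≐ a))
        (symFlip-antipode W V T S (symFlip-reverse (V , S) (W , T) (flip⇒symFlip V W S F)))
      up : Up w v q (lf v q + H)
      up = record { 0≤a = 0≤q ; b<H = (lin (lf v q ∷ H ∷ []) (λ a b → a ≺ κ 0 ⇒ ⊢ a ⊕ b ≺ b) p<0) ; flip = back }

  label<n : ∀ {v} → IsNCMatching n v → ∀ {k} → Label v k → k < + n
  label<n V (none _) = -<+
  label<n {v} V {q} (top _ p<0 _) = lin (lf v q ∷ q ∷ H ∷ + n ∷ [])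
    (λ a b c d → a ≺ κ 0 ⇒ b ⊖ c ≺ a ⇒ c ≐ d ⇒ ⊢ b ≺ d) p<0 (Lifted.lf> v V q) H≡n

  reach-root : ∀ {v} → SymMatching v → ∃ λ w → Reach n v w × Free w (+ 0)
  reach-root {v} M@(V , _) = let k , l = label V in root n M l (label<n V l)

  up-flip : ∀ {v} → SymMatching v → ∀ {a b} → + 0 ≤ a → a < b → b < H → lf v a ≡ b → Exposed v a →
    ∃ λ w → Reach n v w × Label w a
  up-flip {v} (V , S) {a} {b} 0≤a a<b b<H va ea = continue (QuadFacts.flip V (antipodal-quad (V , S) a<b va ea))
    where
    continue : (∃ λ w → HEdge n v w × Flip v w a b (a + H) (b + H)) → ∃ λ w → Reach n v w × Label w a
    continue (w , edge@(_ , W , _) , F) =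
      w , edge ◅ ε , up-label V (record { 0≤a = 0≤a ; b<H = b<H ; flip = flip⇒symFlip V W S F })

  -- In a symmetric component digging cannot meet `NonSym`, so it exposes the arc at `a` without
  -- changing it. Flipping that arc then puts one that ends at `a` over gap 0.
  reach-label : ∀ {v} → SymMatching v → ∀ {a} → + 0 ≤ a → a < lf v a → lf v a < H → ∃ λ w → Reach n v w × Label w a
  reach-label {v} (V , S) {a} 0≤a a<b b<H =
    [ (λ (w , reach , W , nonSym) → ⊥-elim (Sym⇒¬NonSym (proj₂ (Reach-SymMatching reach (V , S))) nonSym))
    , (λ (w , reach , W , wa , _ , ew , _) →
         let u , reach′ , l = up-flip (Reach-SymMatching reach (V , S)) 0≤a a<b b<H wa ew in u , reach ◅◅ reach′ , l)
    ]′ (dig v V a a<b)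

  -- Roots of components and trees

  interval-¬cross : ∀ {h} → IntervalMatching h (+ 0) (H + H) → ∀ {a c d} → + 0 ≤ a → a < H + H → h c ≡ d →
    (a < c × c < h a) ⊎ (h a < c × c < a) → (d < a × d < h a) ⊎ (a < d × h a < d) → ⊥
  interval-¬cross {h} M {a} {c} {d} 0≤a a<N hc btw out = contradict inside out
    where
    open IntervalMatching M
    inside : (a < d × d < h a) ⊎ (h a < d × d < a)
    inside = [ (λ (p , q) → inj₁
      ((lin (h c ∷ d ∷ a ∷ []) (λ a b c → a ≐ b ⇒ c ≺ a ⇒ ⊢ c ≺ b) hc (interval-nestedˡ M a c 0≤a a<N p q)) ,
      (lin (h c ∷ d ∷ h a ∷ []) (λ a b c → a ≐ b ⇒ a ≺ c ⇒ ⊢ b ≺ c) hc (nested a c 0≤a a<N p q))))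
             , (λ (p , q) → inj₂ (below p q)) ]′ btw
      where
      below : h a < c → c < a → h a < d × d < a
      below p q =
        let ha = closed a 0≤a a<N
            e  = involutive a 0≤a a<N
        in (lin (h c ∷ d ∷ h a ∷ []) (λ a b c → a ≐ b ⇒ c ≺ a ⇒ ⊢ c ≺ b) hc
             (interval-nestedˡ M (h a) c (proj₁ ha) (proj₂ ha) p
             (lin (c ∷ a ∷ h (h a) ∷ []) (λ a b c → a ≺ b ⇒ c ≐ b ⇒ ⊢ a ≺ c) q e))) ,
             (lin (h c ∷ d ∷ h (h a) ∷ a ∷ []) (λ a b c d → a ≐ b ⇒ a ≺ c ⇒ c ≐ d ⇒ ⊢ b ≺ d) hc
             (nested (h a) c (proj₁ ha) (proj₂ ha) p (lin (c ∷ a ∷ h (h a) ∷ []) (λ a b c → a ≺ b ⇒ c ≐ b ⇒ ⊢ a ≺ c) q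
             e)) e)
    contradict : (a < d × d < h a) ⊎ (h a < d × d < a) → (d < a × d < h a) ⊎ (a < d × h a < d) → ⊥
    contradict (inj₁ p) (inj₁ q) = ℤₚ.<-asym (proj₁ p) (proj₁ q)
    contradict (inj₁ p) (inj₂ q) = ℤₚ.<-asym (proj₂ p) (proj₂ q)
    contradict (inj₂ p) (inj₁ q) = ℤₚ.<-asym (proj₁ p) (proj₂ q)
    contradict (inj₂ p) (inj₂ q) = ℤₚ.<-asym (proj₂ p) (proj₁ q)

  module FromInterval (h : ℤ → ℤ) (M : IntervalMatching h (+ 0) (H + H)) where
    open IntervalMatching M

    config : Config n
    config = tabulate λ i → π (h (r i))

    r-lookup : ∀ i → r (lookup config i) ≡ h (r i)
    r-lookup i = trans (cong r (lookup∘tabulate (λ i → π (h (r i))) i))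
      (r-π (h (r i)) (proj₁ (closed (r i) (0≤r i) (r<N i))) (proj₂ (closed (r i) (0≤r i) (r<N i))))

    private
      back : ∀ i → h (r (lookup config i)) ≡ r i
      back i = trans (cong h (r-lookup i)) (involutive (r i) (0≤r i) (r<N i))

      perfect : IsPerfectMatching n config
      perfect i = r-injective (trans (r-lookup (lookup config i)) (back i)) ,
        λ e → irreflexive (r i) (0≤r i) (r<N i) (trans (sym (r-lookup i)) (cong r e))

      noncrossing : NonCrossing n config
      noncrossing i j (inj₁ (btw , out)) = interval-¬cross M (0≤r i) (r<N i) (sym (r-lookup j))
        (subst (λ y → (r i < r j × r j < y) ⊎ (y < r j × r j < r i)) (r-lookup i)
          (r-Btw⁻ {i} {lookup config i} {j} btw))
        (subst (λ y → (r (lookup config j) < r i × r (lookup config j) < y) ⊎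
          (r i < r (lookup config j) × y < r (lookup config j))) (r-lookup i)
          (r-Out⁻ {i} {lookup config i} {lookup config j} out))
      noncrossing i j (inj₂ (out , btw)) = interval-¬cross M (0≤r i) (r<N i) (back j)
        (subst (λ y → (r i < r (lookup config j) × r (lookup config j) < y) ⊎
          (y < r (lookup config j) × r (lookup config j) < r i)) (r-lookup i)
          (r-Btw⁻ {i} {lookup config i} {lookup config j} btw))
        (subst (λ y → (r j < r i × r j < y) ⊎ (r i < r j × y < r j)) (r-lookup i)
          (r-Out⁻ {i} {lookup config i} {j} out))

    matching : IsNCMatching n config
    matching = perfect , noncrossing

    lf-config : ∀ z → + 0 ≤ z → z < H + H → z - H ≤ h z → h z < z + H → lf config z ≡ h z
    lf-config z p q = lf-unique config (trans (cong π (trans (cong h (sym (r-π z p q))) (sym (r-lookup (π z)))))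
      (π-r (lookup config (π z))))

  size⇒width : ∀ t → size t ≡ m → width t ≡ H
  size⇒width t e = trans (width≡ t) (trans (cong (λ k → + (k ℕ.+ k)) e) (sym (trans H≡n (cong +_ n≡m+m))))

  module TreeRoot (t : Tree) (w≡H : width t ≡ H) where
    private
      h : ℤ → ℤ
      h = partner (join t t) (+ 0)
      hi≡ : + 0 + width (join t t) ≡ H + H
      hi≡ = lin (width (join t t) ∷ width t ∷ H ∷ []) (λ a b c → a ≐ b ⊕ b ⇒ b ≐ c ⇒ ⊢ κ 0 ⊕ a ≐ c ⊕ c)
        (width-join t t) w≡H
      module I = FromInterval h (subst (IntervalMatching h (+ 0)) hi≡ (partner-matching (join t t) (+ 0)))
      bounds : ∀ z → + 0 ≤ z → z < H → + 0 ≤ partner t (+ 0) z × partner t (+ 0) z < H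
      bounds z p q =
        let b = IntervalMatching.closed (partner-matching t (+ 0)) z p
              (lin (z ∷ H ∷ width t ∷ []) (λ a b c → a ≺ b ⇒ c ≐ b ⇒ ⊢ a ≺ κ 0 ⊕ c) q w≡H)
        in (proj₁ b) , (lin (partner t (+ 0) z ∷ width t ∷ H ∷ []) (λ a b c → a ≺ κ 0 ⊕ b ⇒ b ≐ c ⇒ ⊢ a ≺ c) (proj₂ b)
             w≡H)
      first : ∀ z → + 0 ≤ z → z < H → h z ≡ partner t (+ 0) z
      first z p q = partner-joinˡ t t (+ 0) z p (lin (z ∷ H ∷ width t ∷ []) (λ a b c → a ≺ b ⇒ c ≐ b ⇒ ⊢ a ≺ κ 0 ⊕ c)
        q w≡H)
      second : ∀ z → + 0 ≤ z → z < H → h (z + H) ≡ partner t (+ 0) z + H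
      second z p q = trans (partner-joinʳ t t (+ 0) (z + H)
        (lin (z ∷ width t ∷ H ∷ []) (λ a b c → κ 0 ≼ a ⇒ b ≐ c ⇒ ⊢ κ 0 ⊕ b ≼ a ⊕ c) p w≡H))
        (trans (cong (λ o → partner t o (z + H)) {+ 0 + width t} {+ 0 + H}
          (lin (width t ∷ H ∷ []) (λ a b → a ≐ b ⇒ ⊢ κ 0 ⊕ a ≐ κ 0 ⊕ b) w≡H))
          (partner-shift t (+ 0) H z p (lin (z ∷ H ∷ width t ∷ []) (λ a b c → a ≺ b ⇒ c ≐ b ⇒ ⊢ a ≺ κ 0 ⊕ c) q w≡H)))

    abstract
      treeRoot : Config n
      treeRoot = I.config

      treeRoot-matching : IsNCMatching n treeRoot
      treeRoot-matching = I.matching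

      lf-treeRoot : ∀ z → + 0 ≤ z → z < H → lf treeRoot z ≡ partner t (+ 0) z
      lf-treeRoot z p q = trans (I.lf-config z p (lin (z ∷ H ∷ []) (λ a b → a ≺ b ⇒ κ 0 ≺ b ⇒ ⊢ a ≺ b ⊕ b) q 0<H)
        (lin (h z ∷ partner t (+ 0) z ∷ z ∷ H ∷ []) (λ a b c d → a ≐ b ⇒ κ 0 ≼ b ⇒ c ≺ d ⇒ ⊢ c ⊖ d ≼ a) (first z p q)
        (proj₁ (bounds z p q)) q) (lin (h z ∷ partner t (+ 0) z ∷ H ∷ z ∷ [])
        (λ a b c d → a ≐ b ⇒ b ≺ c ⇒ κ 0 ≼ d ⇒ ⊢ a ≺ d ⊕ c) (first z p q) (proj₂ (bounds z p q)) p)) (first z p q)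

      lf-second : ∀ z → + 0 ≤ z → z < H → lf treeRoot (z + H) ≡ lf treeRoot z + H
      lf-second z p q =
        trans (I.lf-config (z + H) (lin (z ∷ H ∷ []) (λ a b → κ 0 ≼ a ⇒ κ 0 ≺ b ⇒ ⊢ κ 0 ≼ a ⊕ b) p 0<H)
          (lin (z ∷ H ∷ []) (λ a b → a ≺ b ⇒ ⊢ a ⊕ b ≺ b ⊕ b) q) (lin (h (z + H) ∷ partner t (+ 0) z ∷ H ∷ z ∷ [])
          (λ a b c d → a ≐ b ⊕ c ⇒ κ 0 ≼ b ⇒ d ≺ c ⇒ ⊢ d ⊕ c ⊖ c ≼ a) (second z p q) (proj₁ (bounds z p q)) q)
          (lin (h (z + H) ∷ partner t (+ 0) z ∷ H ∷ z ∷ [])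
          (λ a b c d → a ≐ b ⊕ c ⇒ b ≺ c ⇒ κ 0 ≼ d ⇒ ⊢ a ≺ d ⊕ c ⊕ c) (second z p q) (proj₂ (bounds z p q)) p))
          (trans (second z p q) (cong (_+ H) (sym (lf-treeRoot z p q))))

    treeRoot-sym : Sym treeRoot
    treeRoot-sym z with rep (+ 0) (π z) <? H
    ... | yes p = lin (lf treeRoot z ∷ lf treeRoot (rep (+ 0) (π z)) ∷ z ∷ rep (+ 0) (π z) ∷ lf treeRoot (z + H) ∷ lf
      treeRoot (rep (+ 0) (π z) + H) ∷ H ∷ [])
      (λ a b c d e f g → a ≐ b ⊕ (c ⊖ d) ⇒ e ≐ f ⊕ (c ⊕ g ⊖ (d ⊕ g)) ⇒ f ≐ b ⊕ g ⇒ ⊢ e ≐ a ⊕ g)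
      (lf-shift treeRoot (π-rep (+ 0) (π z))) (lf-shift treeRoot (π-shift H (π-rep (+ 0) (π z))))
      (lf-second (rep (+ 0) (π z)) (rep≥ (+ 0) (π z)) p)
    ... | no ¬p = lin (lf treeRoot z ∷ lf treeRoot z₁ ∷ z ∷ z₁ ∷ lf treeRoot (z + H) ∷ lf treeRoot (z₁ + H) ∷ H ∷ lf
      treeRoot (z₁ - H + H) ∷ lf treeRoot (z₁ - H) ∷ lf treeRoot (z₁ - H + (H + H)) ∷ [])
      (λ a b c d e f g h i j → a ≐ b ⊕ (c ⊖ d) ⇒ e ≐ f ⊕ (c ⊕ g ⊖ (d ⊕ g)) ⇒ h ≐ i ⊕ g ⇒ h ≐ b ⇒ j ≐ i ⊕ (g ⊕ g) ⇒ j ≐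
      f ⇒ ⊢ e ≐ a ⊕ g) (lf-shift treeRoot {z₁} {z} (π-rep (+ 0) (π z)))
      (lf-shift treeRoot {z₁ + H} {z + H} (π-shift H (π-rep (+ 0) (π z))))
      (lf-second (z₁ - H) (lin (H ∷ rep (+ 0) (π z) ∷ []) (λ a b → a ≼ b ⇒ ⊢ κ 0 ≼ b ⊖ a) (ℤₚ.≮⇒≥ ¬p))
      (lin (rep (+ 0) (π z) ∷ H ∷ []) (λ a b → a ≺ κ 0 ⊕ (b ⊕ b) ⇒ ⊢ a ⊖ b ≺ b) (rep< (+ 0) (π z))))
      (cong (lf treeRoot) {z₁ - H + H} {z₁} (lin (z₁ ∷ H ∷ []) (λ a b → ⊢ a ⊖ b ⊕ b ≐ a))) (lf-+N treeRoot (z₁ - H))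
      (cong (lf treeRoot) {z₁ - H + (H + H)} {z₁ + H} (lin (z₁ ∷ H ∷ []) (λ a b → ⊢ a ⊖ b ⊕ (b ⊕ b) ≐ a ⊕ b)))
      where
      z₁ = rep (+ 0) (π z)

    treeRoot-free : Free treeRoot (+ 0)
    treeRoot-free x x<0 0≤fx = lin (lf treeRoot (x + H) ∷ lf treeRoot x ∷ H ∷ partner t (+ 0) (x + H) ∷ [])
      (λ a b c d → a ≐ b ⊕ c ⇒ a ≐ d ⇒ d ≺ c ⇒ κ 0 ≼ b ⇒ ⊢⊥) (treeRoot-sym x)
      (lf-treeRoot (x + H) low (lin (x ∷ H ∷ []) (λ a b → a ≺ κ 0 ⇒ ⊢ a ⊕ b ≺ b) x<0))
      (proj₂ (bounds (x + H) low (lin (x ∷ H ∷ []) (λ a b → a ≺ κ 0 ⇒ ⊢ a ⊕ b ≺ b) x<0))) 0≤fx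
      where
      low : + 0 ≤ x + H
      low = lin (lf treeRoot x ∷ x ∷ H ∷ []) (λ a b c → a ≺ b ⊕ c ⇒ κ 0 ≼ a ⇒ ⊢ κ 0 ≼ b ⊕ c) (lf< treeRoot x) 0≤fx

    sym-treeRoot : SymMatching treeRoot
    sym-treeRoot = treeRoot-matching , treeRoot-sym

  -- Symmetry frees gap H along with gap 0, so no arc leaves [0, H).
  free-interval : ∀ {v} → SymMatching v → Free v (+ 0) → IntervalMatching (lf v) (+ 0) H
  free-interval {v} (V , S) free = record
    { closed      = λ z p q → ℤₚ.≮⇒≥
      (λ fz<0 → free (lf v z) fz<0 (lin (lf v (lf v z) ∷ z ∷ []) (λ a b → a ≐ b ⇒ κ 0 ≼ b ⇒ ⊢ κ 0 ≼ a)
      (Lifted.involutive v V z) p)) ,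
                              ℤₚ.≰⇒> (λ H≤fz → free (z - H) (lin (z ∷ H ∷ []) (λ a b → a ≺ b ⇒ ⊢ a ⊖ b ≺ κ 0) q)
                                (lin (H ∷ lf v z ∷ lf v (z - H) ∷ []) (λ a b c → a ≼ b ⇒ c ≐ b ⊖ a ⇒ ⊢ κ 0 ≼ c) H≤fz
                                (Sym-back S z)))
    ; involutive  = λ z _ _ → Lifted.involutive v V z
    ; irreflexive = λ z _ _ → Lifted.irreflexive v V z
    ; nested      = λ x y _ _ → Lifted.nested v V
    }

  root-tree : ∀ {v} → SymMatching v → Free v (+ 0) → ∃ λ t → width t ≡ H × (∀ z → + 0 ≤ z → z < H → lf v z ≡ partner t
    (+ 0) z)
  root-tree {v} M free =
    let t , sum , agree = decompose n {lf v} {+ 0} {H} (lin (H ∷ []) (λ a → κ 0 ≺ a ⇒ ⊢ κ 0 ≼ a) 0<H)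
          (lin (H ∷ + n ∷ []) (λ a b → a ≐ b ⇒ ⊢ a ≼ κ 0 ⊕ b) H≡n) (free-interval M free) in t ,
          (lin (width t ∷ H ∷ []) (λ a b → κ 0 ⊕ a ≐ b ⇒ ⊢ a ≐ b) sum) , agree

  sym-ext : ∀ {v w} → Sym v → Sym w → (∀ z → + 0 ≤ z → z < H → lf v z ≡ lf w z) → v ≡ w
  sym-ext {v} {w} S T eq = lf-ext λ z →
    let z′ , p , q , shift = normalise z
    in (lin (lf v z ∷ lf v z′ ∷ z ∷ z′ ∷ lf w z ∷ lf w z′ ∷ [])
         (λ a b c d e f → a ≐ b ⊕ (c ⊖ d) ⇒ e ≐ f ⊕ (c ⊖ d) ⇒ b ≐ f ⇒ ⊢ a ≐ e) (shift v S) (shift w T) (eq z′ p q))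

  width⇒size : ∀ t → width t ≡ H → size t ≡ m
  width⇒size t e = double-injective (size t) m
    (ℤₚ.+-injective (trans (sym (width≡ t)) (trans e (trans H≡n (cong +_ n≡m+m)))))
    where
    double-injective : ∀ a b → a ℕ.+ a ≡ b ℕ.+ b → a ≡ b
    double-injective zero    zero    _ = refl
    double-injective (suc a) (suc b) e = cong suc (double-injective a b (ℕₚ.suc-injective
      (trans (sym (ℕₚ.+-suc a a)) (trans (ℕₚ.suc-injective e) (ℕₚ.+-suc b b)))))

  Reach-sym : ∀ {v w} → Reach n v w → Reach n w v
  Reach-sym = reverse (λ {v} {w} → HEdge-sym {v} {w})

  -- Within a component the label determines the matching. The labels that occur are -1 at the root
  -- and the left ends of the m arcs of the root in [0, H), each of which `reach-label` realises.
  component : ∀ {v} → SymMatching v → HasCard (Reach n v) (m ℕ.+ 1)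
  component {v} M = build (reach-root M)
    where
    build : (∃ λ w → Reach n v w × Free w (+ 0)) → HasCard (Reach n v) (m ℕ.+ 1)
    build (ρ , reach , free) = fill (root-tree R free)
      where
      R : SymMatching ρ
      R = Reach-SymMatching reach M
      Member : ℤ → Set
      Member a = ∃ λ w → Reach n ρ w × Label w a
      members : ∀ {as} → All Member as → List (Config n)
      members []             = []
      members ((w , _) ∷ ps) = w ∷ members ps
      length-members : ∀ {as} (ps : All Member as) → length (members ps) ≡ length as
      length-members []       = refl
      length-members (_ ∷ ps) = cong suc (length-members ps)
      members-sound : ∀ {as} (ps : All Member as) {x} → x ∈ members ps → ∃ λ a → a ∈ as × Reach n ρ x × Label x a
      members-sound ((w , reach , l) ∷ ps) (here refl) = _ , here refl , reach , l
      members-sound (_ ∷ ps) (there x∈) = let a , a∈ , rest = members-sound ps x∈ in a , there a∈ , rest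
      members-complete : ∀ {as} (ps : All Member as) {a} → a ∈ as → ∃ λ x → x ∈ members ps × Reach n ρ x × Label x a
      members-complete ((w , reach , l) ∷ ps) (here refl) = w , here refl , reach , l
      members-complete (_ ∷ ps) (there a∈) = let x , x∈ , rest = members-complete ps a∈ in x , there x∈ , rest
      same-label : ∀ {x y k} → Reach n ρ x → Reach n ρ y → Label x k → Label y k → x ≡ y
      same-label rx ry = label-injective (Reach-SymMatching rx R) (Reach-SymMatching ry R)
        (Reach⇒sameModH (Reach-sym rx ◅◅ ry) (Reach-SymMatching rx R))
      members-unique : ∀ {as} (ps : All Member as) → AllPairs _<_ as → Unique (members ps)
      members-unique [] _ = []
      members-unique ((w , reach , l) ∷ ps) (a< ∷ sorted) = All.tabulate fresh ∷ members-unique ps sorted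
        where
        fresh : ∀ {x} → x ∈ members ps → w ≢ x
        fresh x∈ refl = let b , b∈ , _ , l′ = members-sound ps x∈
                        in ℤₚ.<-irrefl (label-unique (proj₁ (Reach-SymMatching reach R)) l l′) (All.lookup a< b∈)
      fill : (∃ λ t → width t ≡ H × (∀ z → + 0 ≤ z → z < H → lf ρ z ≡ partner t (+ 0) z)) → HasCard (Reach n v)
        (m ℕ.+ 1)
      fill (t , w≡H , agree) = ρ ∷ members ps , All.tabulate root-fresh ∷ members-unique ps (openings-sorted t (+ 0))
        ,
        (λ x → sound , complete) ,
        trans (cong suc (trans (length-members ps) (trans (length-openings t (+ 0)) (width⇒size t w≡H))))
          (ℕₚ.+-comm 1 m)
        where
        inner-arc : ∀ {a} → + 0 ≤ a × a < + 0 + width t × a < partner t (+ 0) a → Member a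
        inner-arc {a} (p , q , s) = reach-label R p (lin (a ∷ partner t (+ 0) a ∷ lf ρ a ∷ [])
          (λ a b c → a ≺ b ⇒ c ≐ b ⇒ ⊢ a ≺ c) s
          (agree a p (lin (a ∷ width t ∷ H ∷ []) (λ a b c → a ≺ κ 0 ⊕ b ⇒ b ≐ c ⇒ ⊢ a ≺ c) q w≡H)))
          (proj₂ (IntervalMatching.closed (free-interval R free) a p
            (lin (a ∷ width t ∷ H ∷ []) (λ a b c → a ≺ κ 0 ⊕ b ⇒ b ≐ c ⇒ ⊢ a ≺ c) q w≡H)))
        ps : All Member (openings t (+ 0))
        ps = All.map inner-arc (openings-sound t (+ 0))
        root-fresh : ∀ {x} → x ∈ members ps → ρ ≢ x
        root-fresh x∈ refl with members-sound ps x∈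
        ... | a , a∈ , _ , l with label-unique (proj₁ R) (none free) l | All.lookup (openings-sound t (+ 0)) a∈
        ...   | refl | (() , _)
        sound : ∀ {x} → x ∈ ρ ∷ members ps → Reach n v x
        sound (here refl) = reach
        sound (there x∈)  = let _ , _ , reach′ , _ = members-sound ps x∈ in reach ◅◅ reach′
        complete : ∀ {x} → Reach n v x → x ∈ ρ ∷ members ps
        complete {x} reach-x = locate (label (proj₁ X))
          where
          ρ-x : Reach n ρ x
          ρ-x = Reach-sym reach ◅◅ reach-x
          X : SymMatching x
          X = Reach-SymMatching ρ-x R
          -- In `x` the partner of the label q is negative, in the root it lies in [0, H), and both
          -- agree modulo H. So the root has it raised by H, to the right of q.
          opening : ∀ {q} → + 0 ≤ q → lf x q < + 0 → q ∈ openings t (+ 0)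
          opening {q} 0≤q p<0 = openings-complete t (+ 0) q 0≤q
            (lin (q ∷ H ∷ width t ∷ []) (λ a b c → a ≺ b ⇒ c ≐ b ⇒ ⊢ a ≺ κ 0 ⊕ c) q<H w≡H)
            (lin (partner t (+ 0) q ∷ lf ρ q ∷ lf x q ∷ H ∷ q ∷ [])
            (λ a b c d e → a ≐ b ⇒ c ⊕ d ≐ b ⇒ e ⊖ d ≺ c ⇒ ⊢ e ≺ a) (sym (agree q 0≤q q<H)) flipped
            (Lifted.lf> x (proj₁ X) q))
            where
            q<H : q < H
            q<H = lin (lf x q ∷ q ∷ H ∷ []) (λ a b c → a ≺ κ 0 ⇒ b ⊖ c ≺ a ⇒ ⊢ b ≺ c) p<0 (Lifted.lf> x (proj₁ X) q)
            in-root : + 0 ≤ lf ρ q × lf ρ q < H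
            in-root = IntervalMatching.closed (free-interval R free) q 0≤q q<H
            flipped : lf x q + H ≡ lf ρ q
            flipped = [ (λ e → ⊥-elim (lin (lf x q ∷ lf ρ q ∷ []) (λ a b → a ≐ b ⇒ a ≺ κ 0 ⇒ κ 0 ≼ b ⇒ ⊢⊥) e p<0
              (proj₁ in-root))) , [
              (λ e → ⊥-elim (lin (lf x q ∷ lf ρ q ∷ H ∷ []) (λ a b c → a ≐ b ⊕ c ⇒ a ≺ κ 0 ⇒ κ 0 ≼ b ⇒ κ 0 ≺ c ⇒ ⊢⊥) e
              p<0 (proj₁ in-root) 0<H)) , (λ e → e) ]′ ]′ (Reach⇒sameModH ρ-x R q)
          locate : ∃ (Label x) → x ∈ ρ ∷ members ps
          locate (_ , none free-x) = here (same-label ρ-x ε (none free-x) (none free))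
          locate (q , top 0≤q p<0 ex) =
            let y , y∈ , ρ-y , ly = members-complete ps (opening 0≤q p<0)
            in there (subst (_∈ members ps) (same-label ρ-y ρ-x ly (top 0≤q p<0 ex)) y∈)

  -- Counting components and symmetric matchings

  treeRoot-injective : ∀ {t t′} (w : width t ≡ H) (w′ : width t′ ≡ H) →
    Reach n (TreeRoot.treeRoot t w) (TreeRoot.treeRoot t′ w′) → t ≡ t′
  treeRoot-injective {t} {t′} w w′ reach = partner-injective t t′ (+ 0) (trans w (sym w′)) λ z p q → agree z p
    (lin (z ∷ width t ∷ H ∷ []) (λ a b c → a ≺ κ 0 ⊕ b ⇒ b ≐ c ⇒ ⊢ a ≺ c) q w)
    where
    module T = TreeRoot t w
    module T′ = TreeRoot t′ w′
    inside : ∀ t (w : width t ≡ H) z → + 0 ≤ z → z < H → + 0 ≤ lf (TreeRoot.treeRoot t w) z × lf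
      (TreeRoot.treeRoot t w) z < H
    inside t w = IntervalMatching.closed (free-interval (TreeRoot.sym-treeRoot t w) (TreeRoot.treeRoot-free t w))
    agree : ∀ z → + 0 ≤ z → z < H → partner t (+ 0) z ≡ partner t′ (+ 0) z
    agree z p q = trans (sym (T.lf-treeRoot z p q)) (trans same (T′.lf-treeRoot z p q))
      where
      same : lf T.treeRoot z ≡ lf T′.treeRoot z
      -- Both roots keep [0, H) invariant, so their partners, which agree modulo H, cannot differ by
      -- H.
      same = [ sym , [ (λ e → ⊥-elim (lin (lf (TreeRoot.treeRoot t′ w′) z ∷ lf (TreeRoot.treeRoot t w) z ∷ H ∷ [])
        (λ a b c → a ≐ b ⊕ c ⇒ κ 0 ≼ b ⇒ a ≺ c ⇒ ⊢⊥) e (proj₁ (inside t w z p q)) (proj₂ (inside t′ w′ z p q))))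
                     , (λ e → ⊥-elim (lin (lf (TreeRoot.treeRoot t′ w′) z ∷ H ∷ lf (TreeRoot.treeRoot t w) z ∷ [])
                       (λ a b c → a ⊕ b ≐ c ⇒ c ≺ b ⇒ κ 0 ≼ a ⇒ ⊢⊥) e (proj₂ (inside t w z p q))
                       (proj₁ (inside t′ w′ z p q)))) ]′ ]′ (Reach⇒sameModH reach T.sym-treeRoot z)

  Wide : Tree → Set
  Wide t = width t ≡ H

  treeRoots : ∀ {ts} → All Wide ts → List (Config n)
  treeRoots []                 = []
  treeRoots {t ∷ _} (w ∷ wide) = TreeRoot.treeRoot t w ∷ treeRoots wide

  length-treeRoots : ∀ {ts} (wide : All Wide ts) → length (treeRoots wide) ≡ length ts
  length-treeRoots []         = refl
  length-treeRoots (_ ∷ wide) = cong suc (length-treeRoots wide)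

  treeRoots-sym : ∀ {ts} (wide : All Wide ts) → All SymMatching (treeRoots wide)
  treeRoots-sym []                 = []
  treeRoots-sym {t ∷ _} (w ∷ wide) = TreeRoot.sym-treeRoot t w ∷ treeRoots-sym wide

  treeRoots-separate : ∀ {ts} (wide : All Wide ts) → Unique ts → AllPairs (λ x y → ¬ Reach n x y) (treeRoots wide)
  treeRoots-separate []         []              = []
  treeRoots-separate {t ∷ _} (w ∷ wide) (t≢ ∷ unique) = apart wide t≢ ∷ treeRoots-separate wide unique
    where
    apart : ∀ {us} (wide : All Wide us) → All (t ≢_) us → All (λ y → ¬ Reach n (TreeRoot.treeRoot t w) y)
      (treeRoots wide)
    apart []          []         = []
    apart (w′ ∷ wide) (t≢u ∷ ne) = (λ reach → t≢u (treeRoot-injective {t} w w′ reach)) ∷ apart wide ne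

  treeRoots-complete : ∀ {ts} (wide : All Wide ts) {t} → t ∈ ts → ∀ {v} → Sym v →
    (∀ z → + 0 ≤ z → z < H → lf v z ≡ partner t (+ 0) z) → v ∈ treeRoots wide
  treeRoots-complete {t ∷ _} (w ∷ _) (here refl) S agree =
    here (sym-ext S (TreeRoot.treeRoot-sym t w) λ z p q → trans (agree z p q) (sym (TreeRoot.lf-treeRoot t w z p q)))
  treeRoots-complete (_ ∷ wide) (there t∈) S agree = there (treeRoots-complete wide t∈ S agree)

  wideTrees : All Wide (trees m)
  wideTrees = All.tabulate λ {t} t∈ → size⇒width t (trees-sound m t∈)

  reach-treeRoot : ∀ {v} → SymMatching v → Any (Reach n v) (treeRoots wideTrees)
  reach-treeRoot {v} M =
    let ρ , reach , free = reach-root M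
        R = Reach-SymMatching reach M
        t , w , agree = root-tree R free
        t∈ = subst (λ k → t ∈ trees k) (width⇒size t w) (trees-complete t)
    in Any.map (λ { refl → reach }) (treeRoots-complete wideTrees t∈ (proj₂ R) agree)

  union : ∀ rs → All SymMatching rs → AllPairs (λ x y → ¬ Reach n x y) rs →
    HasCard (λ x → Any (λ r → Reach n r x) rs) (length rs ℕ.* (m ℕ.+ 1))
  union []       _        _                  = [] , [] , (λ x → (λ ()) , (λ ())) , refl
  union (r ∷ rs) (R ∷ Rs) (apart ∷ separate) =
    let xs , unique , exact , size = component R
        ys , unique′ , exact′ , size′ = union rs Rs separate
        disjoint : ∀ {x} → ¬ (x ∈ xs × x ∈ ys)
        disjoint = λ {x} (x∈xs , x∈ys) →
          let r′ , r′∈ , reach = find (proj₁ (exact′ x) x∈ys)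
          in All.lookup apart r′∈ (proj₁ (exact x) x∈xs ◅◅ Reach-sym reach)
    in xs ++ ys , Uniqueₚ.++⁺ unique unique′ disjoint ,
       (λ x → (λ x∈ → [ (λ p → here (proj₁ (exact x) p)) , (λ p → there (proj₁ (exact′ x) p)) ]′ (∈-++⁻ xs x∈)) ,
              (λ { (here p) → ∈-++⁺ˡ (proj₂ (exact x) p) ; (there p) → ∈-++⁺ʳ xs (proj₂ (exact′ x) p) })) ,
       trans (length-++ xs) (cong₂ ℕ._+_ size size′)

  -- The quotient in `catalan` is exact: by `length-trees` its numerator is m + 1 times the number
  -- of trees.
  length-roots : length (treeRoots wideTrees) ≡ catalan m
  length-roots = trans (length-treeRoots wideTrees) (sym (trans
    (cong (λ k → k ℕ./ suc m) (sym (trans (ℕₚ.*-comm (length (trees m)) (suc m)) (length-trees m))))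
      (m*n/n≡m (length (trees m)) (suc m))))

  length-all : length (treeRoots wideTrees) ℕ.* (m ℕ.+ 1) ≡ (2 ℕ.* m) C m
  length-all = trans (cong₂ ℕ._*_ (length-treeRoots wideTrees) (ℕₚ.+-comm m 1))
    (trans (ℕₚ.*-comm (length (trees m)) (suc m)) (length-trees m))

  SymmetricMatching : Config n → Set
  SymmetricMatching v = IsNCMatching n v × CentrallySymmetric n v

  from-Sym : ∀ {v} → SymMatching v → SymmetricMatching v
  from-Sym (V , S) = V , Sym⇒symmetric S

  to-Sym : ∀ {v} → SymmetricMatching v → SymMatching v
  to-Sym (V , cs) = V , symmetric⇒Sym cs

  -- The total comes from the components: they are disjoint, one for each tree, with m + 1 matchings
  -- each, and this product is the central binomial coefficient.
  symmetric-card : HasCard SymmetricMatching ((2 ℕ.* m) C m)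
  symmetric-card =
    let xs , unique , exact , size = union (treeRoots wideTrees) (treeRoots-sym wideTrees)
          (treeRoots-separate wideTrees (trees-unique m))
    in xs , unique ,
       (λ x → (λ x∈ → let r , r∈ , reach = find (proj₁ (exact x) x∈) in from-Sym (Reach-SymMatching reach (All.lookup (treeRoots-sym wideTrees) r∈))) ,
              (λ M → proj₂ (exact x) (Any.map Reach-sym (reach-treeRoot (to-Sym M))))) ,
       trans size length-all

  component-count : HasComponentCount n SymmetricMatching (catalan m)
  component-count = treeRoots wideTrees , All.map from-Sym (treeRoots-sym wideTrees) , treeRoots-separate wideTrees
    (trees-unique m) ,
    (λ v M → reach-treeRoot (to-Sym M)) , length-roots

  reach-symmetric : ∀ v w → IsNCMatching n v → CentrallySymmetric n v → Reach n v w → CentrallySymmetric n w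
  reach-symmetric v w V cs reach = proj₂ (from-Sym (Reach-SymMatching reach (to-Sym (V , cs))))

open import Data.Nat using (ℕ; _*_; _+_; _≤_)
open import Data.Nat.Combinatorics using (_C_)
open import Data.Product using (_×_)
open import Relation.Nullary using (¬_)

theorem9 : (m : ℕ) → 1 ≤ m →
    HasCard (λ v → IsNCMatching (2 * m) v × CentrallySymmetric (2 * m) v) ((2 * m) C m) ×
    (∀ v w → IsNCMatching (2 * m) v → CentrallySymmetric (2 * m) v →
    Reach (2 * m) v w → CentrallySymmetric (2 * m) w) ×
    (∀ v → IsNCMatching (2 * m) v → CentrallySymmetric (2 * m) v →
    ComponentIsTree (2 * m) v) ×
    HasComponentCount (2 * m)
    (λ v → IsNCMatching (2 * m) v × CentrallySymmetric (2 * m) v) (catalan m) ×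
    (∀ v → IsNCMatching (2 * m) v → CentrallySymmetric (2 * m) v →
    HasCard (Reach (2 * m) v) (m + 1)) ×
    (∀ v → IsNCMatching (2 * m) v → ¬ CentrallySymmetric (2 * m) v →
    ComponentHasCycle (2 * m) v)
theorem9 m 1≤m =
  symmetric-card ,
  reach-symmetric ,
  (λ v V cs → symmetric-acyclic (to-Sym (V , cs))) ,
  component-count ,
  (λ v V cs → component (to-Sym (V , cs))) ,
  asymmetric-cycle
  where open Matchings (2 * m) m (cong (_+_ m) (ℕₚ.+-identityʳ m)) 1≤m (+ (2 * m)) refl
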